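{- Let $t\ge2$, $N=t+2$, $\zeta=e^{2\pi i/t}$, and let $\lambda$ be a partition with at most $N$ parts such that every residue class modulo $t$ meets $\beta(\lambda)$ and $\tilde d_3\neq0$. Write $\chi_k(z)=(z^{k+1}-z^{ -k-1})/(z-z^{ -1})$. For an integer $k\ge0$ this is the character of the $(k+1)$-dimensional irreducible $\mathfrak{sl}_2$-module; for half-integral $k$ the same formula is kept, read in $u=z^{1/2}$, and it is then notation and not a character, since the individual factors are not Laurent in $z$. Then the product formula $$s_\lambda(1,\zeta,\dots,\zeta^{t-1},z,z^{ -1})=\varepsilon_\lambda\,\frac{\sinh(d_1\theta/2)\sinh(d_2\theta/2)\sinh(d_3\theta/2)}{\sinh^2(t\theta/2)\sinh\theta},\qquad z=e^\theta,$$ can be written with no exponential and no convention for $\theta$ as $$s_\lambda(1,\zeta,\dots,\zeta^{t-1},z,z^{ -1})=\varepsilon_\lambda\,\frac{\chi_{\frac{d_1}{2}-1}(z)\,\chi_{\frac{d_2}{2}-1}(z)\,\chi_{\frac{d_3}{2}-1}(z)}{\chi_{\frac t2-1}(z)^2}.$$ For $t=2$ the denominator is $\chi_0=1$ and every $d_i$ is even, so the left-hand side is a signed product of three $\mathfrak{sl}_2$ characters outright. For odd $t$ the indices are half-integers: the three factors are not separately Laurent in $z$, and only the ratio is. Each factor is read in $u=z^{1/2}$ and reverses sign under $u\mapsto-u$ exactly when its index is half-integral; since $d_1+d_2+d_3$ is even (it has the parity of $d_1+d_2+\tilde d_3=2(a_1-b_2)$), the ratio does not reverse sign, and it is the Laurent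 polynomial in $z$ given by the product formula.
   Context: For $\lambda=(\lambda_1\ge\dots\ge\lambda_N\ge0)$ let $\beta_j=\lambda_j+N-j$ ($1\le j\le N$; $j$ is the column of $\beta_j$), $\beta(\lambda)=\{\beta_1>\dots>\beta_N\}$, and let $n_i$ be the number of $\beta_j\equiv i\pmod t$. Since $\sum_i n_i=t+2$, if no class is empty then either exactly two classes have size $2$ (others $1$) or exactly one has size $3$ (others $1$). In the first case let $r_A<r_B$ be the two residues and $A=\{a_1>a_2\}$, $B=\{b_1>b_2\}$ the elements of $\beta(\lambda)$ in classes $r_A,r_B$; in the second case, with class $\{p>q>r\}$, let $A=\{a_1>a_2\}=\{p,q\}$, $B=\{b_1>b_2\}=\{q,r\}$. Put $d_1=a_1-a_2$, $d_2=b_1-b_2$, $\tilde d_3=a_1+a_2-b_1-b_2$, $d_3=|\tilde d_3|$. With $j_{A_1},j_{B_1}$ the columns of $a_1,b_1$, $S=\{1,\dots,N\}\setminus\{j_{A_1},j_{B_1}\}$, and $b_S$ the word of residues $\beta_j\bmod t\in\{0,\dots,t-1\}$ for $j\in S$ in increasing order of $j$, the sign is $\varepsilon_\lambda=(-1)^{t+\binom{N+1}{2}}(-1)^{j_{A_1}+j_{B_1}+\operatorname{inv}(b_S)}\operatorname{sgn}(a_1-b_1)\operatorname{sgn}(\tilde d_3)=\pm1$, where $\operatorname{inv}$ counts inversions. The product formula is an identity in $\mathbb{C}(z)$; its left-hand side is a Laurent polynomial in $z$.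
   Formalization: For odd t the three indices need not be half-integers (t=3, λ=(3,3): d=(6,6,2), all three factors Laurent in z); proved instead: the index t/2-1 is half-integral and its factor not Laurent, and each factor is Laurent in z exactly when its index is an integer. -}

module Defs where

open import Level using (Level; _⊔_)
open import Algebra.Bundles using (CommutativeRing)
open import Algebra.Apartness.Bundles using (HeytingField; HeytingCommutativeRing)
import Algebra.Definitions.RawMonoid as RawMonoidOps
import Algebra.Properties.AbelianGroup as AbelianGroupProperties
import Algebra.Properties.CommutativeSemigroup as CommutativeSemigroupProperties
import Algebra.Properties.Monoid.Mult as MonoidMult
import Algebra.Properties.Ring as RingProperties
import Algebra.Properties.Semiring.Exp as SemiringExp
open import Data.Bool.Base using (if_then_else_)
open import Data.Fin.Base as Fin using (Fin; zero; suc; toℕ; opposite)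
import Data.Fin.Properties as Fin
open import Data.Integer.Base as ℤ using (ℤ; +_; -[1+_])
import Data.Integer.Divisibility as ℤ using (_∣_)
import Data.Integer.Properties as ℤ
open import Data.Integer.Tactic.RingSolver using (solve-∀)
open import Data.List.Base as List
  using (List; []; _∷_; _++_; map; filter; length; allFin)
open import Data.Nat.Base as ℕ using (ℕ; zero; suc; NonZero; s≤s; z≤n; parity)
open import Data.Nat.Combinatorics using (_C_)
open import Data.Nat.DivMod using (_mod_)
import Data.Nat.Properties as ℕ
open import Data.Parity.Base as ℙ using (Parity; 0ℙ; 1ℙ; toSign)
import Data.Parity.Properties as ℙ
open import Data.Product.Base using (Σ; ∃; _×_; _,_; proj₁; proj₂)
open import Data.Sign.Base as Sign using (Sign)
open import Data.Vec.Functional as Vector using (Vector; removeAt)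
open import Relation.Binary.PropositionalEquality as ≡
  using (_≡_; _≢_; module ≡-Reasoning)
open import Relation.Nullary using (¬_; does; yes; no; contradiction)
open import Relation.Nullary.Decidable using (¬?; _×-dec_)
open import Relation.Unary using (Pred; _∈_)

private variable
  c ℓ ℓ₁ ℓ₂ : Level

infix 8 -1^_

-1^_ : ℕ → Sign
-1^ n = toSign (parity n)

module SignAction (R : CommutativeRing c ℓ) where

  open CommutativeRing R using (Carrier; -_)

  signed : Sign → Carrier → Carrier
  signed Sign.+ x = x
  signed Sign.- x = - x

-- Total ring of fractions of a commutative ring.  When the ring is an
-- integral domain the regular elements are the nonzero ones, and this is
-- its field of fractions.

module Fractions (R : CommutativeRing c ℓ) where

  open CommutativeRing R

  record Regular (d : Carrier) : Set (c ⊔ ℓ) where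
    constructor cancelling
    field cancel : ∀ x → d * x ≈ 0# → x ≈ 0#

  open Regular public

  *-regular : ∀ {d e} → Regular d → Regular e → Regular (d * e)
  *-regular {d} {e} rd re .cancel x dex≈0 =
    re .cancel x (rd .cancel (e * x) (trans (sym (*-assoc d e x)) dex≈0))

  1-regular : Regular 1#
  1-regular .cancel x 1x≈0 = trans (sym (*-identityˡ x)) 1x≈0

  record Frac : Set (c ⊔ ℓ) where
    constructor _/_⟨_⟩
    field
      num     : Carrier
      den     : Carrier
      regular : Regular den

  open Frac public

  infix  4 _≃_
  infixl 7 _·_
  infix  6 _÷_⟨_⟩
  infixr 8 _•_

  _≃_ : Frac → Frac → Set ℓ
  x ≃ y = num x * den y ≈ num y * den x

  ι : Carrier → Frac
  ι a = a / 1# ⟨ 1-regular ⟩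

  _·_ : Frac → Frac → Frac
  (a / d ⟨ rd ⟩) · (b / e ⟨ re ⟩) = (a * b) / (d * e) ⟨ *-regular rd re ⟩

  neg : Frac → Frac
  neg (a / d ⟨ rd ⟩) = (- a) / d ⟨ rd ⟩

  _÷_⟨_⟩ : Frac → (y : Frac) → Regular (num y) → Frac
  (a / d ⟨ rd ⟩) ÷ (b / e ⟨ re ⟩) ⟨ rb ⟩ = (a * e) / (d * b) ⟨ *-regular rd rb ⟩

  _•_ : Sign → Frac → Frac
  Sign.+ • x = x
  Sign.- • x = neg x

-- Columns are numbered from 1 in the formula and by Fin, from 0, here:
-- βⱼ = λⱼ + n - j becomes lam j + (n - 1 - j).
β : ∀ {n} → Vector ℕ n → Vector ℕ n
β lam j = lam j ℕ.+ toℕ (opposite j)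

IsPartition : ∀ {n} → Vector ℕ n → Set
IsPartition lam = ∀ i j → i Fin.≤ j → lam j ℕ.≤ lam i

module Schur (R : CommutativeRing c ℓ) where

  open CommutativeRing R hiding (zero)
  open RawMonoidOps +-rawMonoid using (sum)
  open SemiringExp semiring using (_^_)
  open Fractions R

  open SignAction R

  det : ∀ {n} → (Fin n → Fin n → Carrier) → Carrier
  det {zero}  M = 1#
  det {suc n} M = sum λ j →
    signed (-1^ toℕ j) (M zero j * det (λ i → removeAt (M (suc i)) j))

  alternant : ∀ {n} → Vector ℕ n → Vector Carrier n → Carrier
  alternant α x = det λ i j → x i ^ α j

  vandermonde : ∀ {n} → Vector Carrier n → Carrier
  vandermonde = alternant (β λ _ → 0)

  -- s_λ(x₁,…,xₙ) = det(xᵢ^(λⱼ+n-j)) / det(xᵢ^(n-j))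
  schur : ∀ {n} (lam : Vector ℕ n) (x : Vector Carrier n) →
          Regular (vandermonde x) → Frac
  schur lam x reg = alternant (β lam) x / vandermonde x ⟨ reg ⟩

-- Laurent polynomials in one variable.  A list of pairs (a , i) stands for
-- the sum of the a·uⁱ; repeated exponents are allowed, and equality is
-- equality of all coefficients.

module LaurentPolynomials (R : CommutativeRing c ℓ) where

  private module R = CommutativeRing R
  open SignAction R
  open R using (Carrier; _≈_; 0#; 1#)

  Laurent : Set c
  Laurent = List (Carrier × ℤ)

  coeff : Laurent → ℤ → Carrier
  coeff []            n = 0#
  coeff ((a , i) ∷ p) n = (if does (i ℤ.≟ n) then a else 0#) R.+ coeff p n

  infix  4 _≈ᴸ_
  infixl 7 _*ᴸ_

  -- A record, so that both sides can be inferred from a proof.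
  record _≈ᴸ_ (p q : Laurent) : Set ℓ where
    constructor coeffwise
    field coeff-≈ : ∀ n → coeff p n ≈ coeff q n

  open _≈ᴸ_ public

  mulTerm : Carrier → ℤ → Laurent → Laurent
  mulTerm a i = map λ (b , j) → (a R.* b , i ℤ.+ j)

  _*ᴸ_ : Laurent → Laurent → Laurent
  []            *ᴸ q = []
  ((a , i) ∷ p) *ᴸ q = mulTerm a i q ++ p *ᴸ q

  negᴸ : Laurent → Laurent
  negᴸ = map λ (a , i) → (R.- a , i)

  const : Carrier → Laurent
  const a = (a , + 0) ∷ []

  mono : ℤ → Laurent
  mono i = (1# , i) ∷ []

  -- u ↦ -u
  flip : Laurent → Laurent
  flip = map λ (a , i) → (signed (-1^ ℤ.∣ i ∣) a , i)

  -- u ↦ u²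
  square : Laurent → Laurent
  square = map λ (a , i) → (a , + 2 ℤ.* i)

  private
    open import Relation.Binary.Reasoning.Setoid R.setoid
    module RP = RingProperties R.ring
    module SG = CommutativeSemigroupProperties R.+-commutativeSemigroup
    term : Carrier → ℤ → ℤ → Carrier
    term a i n = if does (i ℤ.≟ n) then a else 0#

    term-cong : ∀ {a b} i n → a ≈ b → term a i n ≈ term b i n
    term-cong i n a≈b with i ℤ.≟ n
    ... | yes _ = a≈b
    ... | no  _ = R.refl

    term-map : ∀ (f : Carrier → Carrier) → f 0# ≈ 0# → ∀ a i n →
               term (f a) i n ≈ f (term a i n)
    term-map f f0 a i n with i ℤ.≟ n
    ... | yes _ = R.refl
    ... | no  _ = R.sym f0

    cancelˡ : ∀ i j → (i ℤ.+ j) ℤ.- i ≡ j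
    cancelˡ = solve-∀

    cancelʳ : ∀ i n → i ℤ.+ (n ℤ.- i) ≡ n
    cancelʳ = solve-∀

    term-shift : ∀ a i j n → term a (i ℤ.+ j) n ≈ term a j (n ℤ.- i)
    term-shift a i j n with i ℤ.+ j ℤ.≟ n | j ℤ.≟ n ℤ.- i
    ... | yes _ | yes _ = R.refl
    ... | no  _ | no  _ = R.refl
    ... | yes ≡.refl | no ≢ = contradiction (≡.sym (cancelˡ i j)) ≢
    ... | no ≢ | yes ≡.refl = contradiction (cancelʳ i n) ≢

    coeff-++ : ∀ p q n → coeff (p ++ q) n ≈ coeff p n R.+ coeff q n
    coeff-++ []            q n = R.sym (R.+-identityˡ _)
    coeff-++ ((a , i) ∷ p) q n =
      R.trans (R.+-congˡ (coeff-++ p q n)) (R.sym (R.+-assoc _ _ _))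

    coeff-mulTerm : ∀ a i q n →
                    coeff (mulTerm a i q) n ≈ a R.* coeff q (n ℤ.- i)
    coeff-mulTerm a i []            n = R.sym (R.zeroʳ a)
    coeff-mulTerm a i ((b , j) ∷ q) n = begin
      term (a R.* b) (i ℤ.+ j) n R.+ coeff (mulTerm a i q) n
        ≈⟨ R.+-cong (term-shift _ i j n) (coeff-mulTerm a i q n) ⟩
      term (a R.* b) j (n ℤ.- i) R.+ a R.* coeff q (n ℤ.- i)
        ≈⟨ R.+-congʳ (term-map (a R.*_) (R.zeroʳ a) b j (n ℤ.- i)) ⟩
      a R.* term b j (n ℤ.- i) R.+ a R.* coeff q (n ℤ.- i)
        ≈⟨ R.distribˡ a _ _ ⟨
      a R.* coeff ((b , j) ∷ q) (n ℤ.- i) ∎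

    conv : Laurent → (ℤ → Carrier) → ℤ → Carrier
    conv []            f n = 0#
    conv ((a , i) ∷ p) f n = a R.* f (n ℤ.- i) R.+ conv p f n

    coeff-* : ∀ p q n → coeff (p *ᴸ q) n ≈ conv p (coeff q) n
    coeff-* []            q n = R.refl
    coeff-* ((a , i) ∷ p) q n = begin
      coeff (mulTerm a i q ++ p *ᴸ q) n
        ≈⟨ coeff-++ (mulTerm a i q) (p *ᴸ q) n ⟩
      coeff (mulTerm a i q) n R.+ coeff (p *ᴸ q) n
        ≈⟨ R.+-cong (coeff-mulTerm a i q n) (coeff-* p q n) ⟩
      a R.* coeff q (n ℤ.- i) R.+ conv p (coeff q) n ∎

    conv-cong : ∀ p {f g : ℤ → Carrier} → (∀ n → f n ≈ g n) →
                ∀ n → conv p f n ≈ conv p g n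
    conv-cong []            f≈g n = R.refl
    conv-cong ((a , i) ∷ p) f≈g n =
      R.+-cong (R.*-congˡ (f≈g (n ℤ.- i))) (conv-cong p f≈g n)

    conv-++ : ∀ p q f n → conv (p ++ q) f n ≈ conv p f n R.+ conv q f n
    conv-++ []            q f n = R.sym (R.+-identityˡ _)
    conv-++ ((a , i) ∷ p) q f n =
      R.trans (R.+-congˡ (conv-++ p q f n)) (R.sym (R.+-assoc _ _ _))

    sub-sub : ∀ n i j → n ℤ.- (i ℤ.+ j) ≡ (n ℤ.- i) ℤ.- j
    sub-sub = solve-∀

    conv-mulTerm : ∀ a i q f n →
                   conv (mulTerm a i q) f n ≈ a R.* conv q f (n ℤ.- i)
    conv-mulTerm a i []            f n = R.sym (R.zeroʳ a)
    conv-mulTerm a i ((b , j) ∷ q) f n = begin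
      a R.* b R.* f (n ℤ.- (i ℤ.+ j)) R.+ conv (mulTerm a i q) f n
        ≈⟨ R.+-cong (R.*-congˡ (R.reflexive (≡.cong f (sub-sub n i j))))
                    (conv-mulTerm a i q f n) ⟩
      a R.* b R.* f (n ℤ.- i ℤ.- j) R.+ a R.* conv q f (n ℤ.- i)
        ≈⟨ R.+-congʳ (R.*-assoc a b _) ⟩
      a R.* (b R.* f (n ℤ.- i ℤ.- j)) R.+ a R.* conv q f (n ℤ.- i)
        ≈⟨ R.distribˡ a _ _ ⟨
      a R.* conv ((b , j) ∷ q) f (n ℤ.- i) ∎

    conv-* : ∀ p q f n → conv (p *ᴸ q) f n ≈ conv p (conv q f) n
    conv-* []            q f n = R.refl
    conv-* ((a , i) ∷ p) q f n = begin
      conv (mulTerm a i q ++ p *ᴸ q) f n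
        ≈⟨ conv-++ (mulTerm a i q) (p *ᴸ q) f n ⟩
      conv (mulTerm a i q) f n R.+ conv (p *ᴸ q) f n
        ≈⟨ R.+-cong (conv-mulTerm a i q f n) (conv-* p q f n) ⟩
      conv ((a , i) ∷ p) (conv q f) n ∎

    reflᴸ : ∀ {p} → p ≈ᴸ p
    reflᴸ .coeff-≈ n = R.refl

    symᴸ : ∀ {p q} → p ≈ᴸ q → q ≈ᴸ p
    symᴸ p≈q .coeff-≈ n = R.sym (p≈q .coeff-≈ n)

    transᴸ : ∀ {p q r} → p ≈ᴸ q → q ≈ᴸ r → p ≈ᴸ r
    transᴸ p≈q q≈r .coeff-≈ n = R.trans (p≈q .coeff-≈ n) (q≈r .coeff-≈ n)

    ++-congᴸ : ∀ {p p′ q q′} → p ≈ᴸ p′ → q ≈ᴸ q′ → p ++ q ≈ᴸ p′ ++ q′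
    ++-congᴸ {p} {p′} {q} {q′} e f .coeff-≈ n = begin
      coeff (p ++ q) n           ≈⟨ coeff-++ p q n ⟩
      coeff p n R.+ coeff q n    ≈⟨ R.+-cong (e .coeff-≈ n) (f .coeff-≈ n) ⟩
      coeff p′ n R.+ coeff q′ n  ≈⟨ coeff-++ p′ q′ n ⟨
      coeff (p′ ++ q′) n         ∎

    ++-assocᴸ : ∀ p q r → (p ++ q) ++ r ≈ᴸ p ++ (q ++ r)
    ++-assocᴸ p q r .coeff-≈ n = begin
      coeff ((p ++ q) ++ r) n                    ≈⟨ coeff-++ (p ++ q) r n ⟩
      coeff (p ++ q) n R.+ coeff r n             ≈⟨ R.+-congʳ (coeff-++ p q n) ⟩
      coeff p n R.+ coeff q n R.+ coeff r n      ≈⟨ R.+-assoc _ _ _ ⟩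
      coeff p n R.+ (coeff q n R.+ coeff r n)    ≈⟨ R.+-congˡ (coeff-++ q r n) ⟨
      coeff p n R.+ coeff (q ++ r) n             ≈⟨ coeff-++ p (q ++ r) n ⟨
      coeff (p ++ (q ++ r)) n                    ∎

    ++-commᴸ : ∀ p q → p ++ q ≈ᴸ q ++ p
    ++-commᴸ p q .coeff-≈ n = begin
      coeff (p ++ q) n         ≈⟨ coeff-++ p q n ⟩
      coeff p n R.+ coeff q n  ≈⟨ R.+-comm _ _ ⟩
      coeff q n R.+ coeff p n  ≈⟨ coeff-++ q p n ⟨
      coeff (q ++ p) n         ∎

    coeff-neg : ∀ p n → coeff (negᴸ p) n ≈ R.- coeff p n
    coeff-neg []            n = R.sym RP.-0#≈0#
    coeff-neg ((a , i) ∷ p) n = begin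
      term (R.- a) i n R.+ coeff (negᴸ p) n
        ≈⟨ R.+-cong (term-map R.-_ RP.-0#≈0# a i n) (coeff-neg p n) ⟩
      R.- term a i n R.+ R.- coeff p n
        ≈⟨ RP.-‿+-comm _ _ ⟩
      R.- (term a i n R.+ coeff p n) ∎

    neg-congᴸ : ∀ {p q} → p ≈ᴸ q → negᴸ p ≈ᴸ negᴸ q
    neg-congᴸ {p} {q} e .coeff-≈ n = begin
      coeff (negᴸ p) n  ≈⟨ coeff-neg p n ⟩
      R.- coeff p n     ≈⟨ R.-‿cong (e .coeff-≈ n) ⟩
      R.- coeff q n     ≈⟨ coeff-neg q n ⟨
      coeff (negᴸ q) n  ∎

    inverseʳᴸ : ∀ p → p ++ negᴸ p ≈ᴸ []
    inverseʳᴸ p .coeff-≈ n = begin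
      coeff (p ++ negᴸ p) n          ≈⟨ coeff-++ p (negᴸ p) n ⟩
      coeff p n R.+ coeff (negᴸ p) n ≈⟨ R.+-congˡ (coeff-neg p n) ⟩
      coeff p n R.+ R.- coeff p n    ≈⟨ R.-‿inverseʳ _ ⟩
      0#                             ∎

    *-congˡᴸ : ∀ p {q q′} → q ≈ᴸ q′ → p *ᴸ q ≈ᴸ p *ᴸ q′
    *-congˡᴸ p {q} {q′} e .coeff-≈ n = begin
      coeff (p *ᴸ q) n      ≈⟨ coeff-* p q n ⟩
      conv p (coeff q) n    ≈⟨ conv-cong p (e .coeff-≈) n ⟩
      conv p (coeff q′) n   ≈⟨ coeff-* p q′ n ⟨
      coeff (p *ᴸ q′) n     ∎

    *-assocᴸ : ∀ p q r → (p *ᴸ q) *ᴸ r ≈ᴸ p *ᴸ (q *ᴸ r)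
    *-assocᴸ p q r .coeff-≈ n = begin
      coeff ((p *ᴸ q) *ᴸ r) n       ≈⟨ coeff-* (p *ᴸ q) r n ⟩
      conv (p *ᴸ q) (coeff r) n     ≈⟨ conv-* p q (coeff r) n ⟩
      conv p (conv q (coeff r)) n   ≈⟨ conv-cong p (coeff-* q r) n ⟨
      conv p (coeff (q *ᴸ r)) n     ≈⟨ coeff-* p (q *ᴸ r) n ⟨
      coeff (p *ᴸ (q *ᴸ r)) n       ∎

    conv-[] : ∀ p n → conv p (coeff []) n ≈ 0#
    conv-[] []            n = R.refl
    conv-[] ((a , i) ∷ p) n =
      R.trans (R.+-cong (R.zeroʳ a) (conv-[] p n)) (R.+-identityˡ 0#)

    swap-sub : ∀ n i j → (n ℤ.- i) ℤ.- j ≡ (n ℤ.- j) ℤ.- i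
    swap-sub = solve-∀

    term-swap : ∀ b i j n → term b j (n ℤ.- i) ≈ term b i (n ℤ.- j)
    term-swap b i j n = begin
      term b j (n ℤ.- i)  ≈⟨ term-shift b i j n ⟨
      term b (i ℤ.+ j) n  ≡⟨ ≡.cong (λ k → term b k n) (ℤ.+-comm i j) ⟩
      term b (j ℤ.+ i) n  ≈⟨ term-shift b j i n ⟩
      term b i (n ℤ.- j)  ∎

    term-* : ∀ a b i n → a R.* term b i n ≈ b R.* term a i n
    term-* a b i n with i ℤ.≟ n
    ... | yes _ = R.*-comm a b
    ... | no  _ = R.trans (R.zeroʳ a) (R.sym (R.zeroʳ b))

    conv-∷ : ∀ p b j q n → conv p (coeff ((b , j) ∷ q)) n ≈
             b R.* coeff p (n ℤ.- j) R.+ conv p (coeff q) n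
    conv-∷ []            b j q n =
      R.sym (R.trans (R.+-identityʳ _) (R.zeroʳ b))
    conv-∷ ((a , i) ∷ p) b j q n = begin
      a R.* (term b j (n ℤ.- i) R.+ coeff q (n ℤ.- i))
          R.+ conv p (coeff ((b , j) ∷ q)) n
        ≈⟨ R.+-cong (R.distribˡ a _ _) (conv-∷ p b j q n) ⟩
      (a R.* term b j (n ℤ.- i) R.+ a R.* coeff q (n ℤ.- i))
          R.+ (b R.* coeff p (n ℤ.- j) R.+ conv p (coeff q) n)
        ≈⟨ SG.interchange _ _ _ _ ⟩
      (a R.* term b j (n ℤ.- i) R.+ b R.* coeff p (n ℤ.- j))
          R.+ (a R.* coeff q (n ℤ.- i) R.+ conv p (coeff q) n)
        ≈⟨ R.+-congʳ (R.+-congʳ (R.trans (R.*-congˡ (term-swap b i j n))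
                                         (term-* a b i (n ℤ.- j)))) ⟩
      (b R.* term a i (n ℤ.- j) R.+ b R.* coeff p (n ℤ.- j))
          R.+ (a R.* coeff q (n ℤ.- i) R.+ conv p (coeff q) n)
        ≈⟨ R.+-congʳ (R.distribˡ b _ _) ⟨
      b R.* coeff ((a , i) ∷ p) (n ℤ.- j)
          R.+ conv ((a , i) ∷ p) (coeff q) n ∎

    conv-comm : ∀ p q n → conv p (coeff q) n ≈ conv q (coeff p) n
    conv-comm p []            n = conv-[] p n
    conv-comm p ((b , j) ∷ q) n =
      R.trans (conv-∷ p b j q n) (R.+-congˡ (conv-comm p q n))

    *-commᴸ : ∀ p q → p *ᴸ q ≈ᴸ q *ᴸ p
    *-commᴸ p q .coeff-≈ n = begin
      coeff (p *ᴸ q) n     ≈⟨ coeff-* p q n ⟩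
      conv p (coeff q) n   ≈⟨ conv-comm p q n ⟩
      conv q (coeff p) n   ≈⟨ coeff-* q p n ⟨
      coeff (q *ᴸ p) n     ∎

    *-congᴸ : ∀ {p p′ q q′} → p ≈ᴸ p′ → q ≈ᴸ q′ → p *ᴸ q ≈ᴸ p′ *ᴸ q′
    *-congᴸ {p} {p′} {q} {q′} e f =
      transᴸ (*-congˡᴸ p f)
        (transᴸ (*-commᴸ p q′) (transᴸ (*-congˡᴸ q′ e) (*-commᴸ q′ p′)))

    sub-0 : ∀ n → n ℤ.- + 0 ≡ n
    sub-0 = ℤ.+-identityʳ

    *-identityˡᴸ : ∀ p → const 1# *ᴸ p ≈ᴸ p
    *-identityˡᴸ p .coeff-≈ n = begin
      coeff (const 1# *ᴸ p) n            ≈⟨ coeff-* (const 1#) p n ⟩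
      1# R.* coeff p (n ℤ.- + 0) R.+ 0#  ≈⟨ R.+-identityʳ _ ⟩
      1# R.* coeff p (n ℤ.- + 0)         ≈⟨ R.*-identityˡ _ ⟩
      coeff p (n ℤ.- + 0)                ≡⟨ ≡.cong (coeff p) (sub-0 n) ⟩
      coeff p n                          ∎

    distribʳᴸ : ∀ r p q → (p ++ q) *ᴸ r ≈ᴸ p *ᴸ r ++ q *ᴸ r
    distribʳᴸ r p q .coeff-≈ n = begin
      coeff ((p ++ q) *ᴸ r) n                    ≈⟨ coeff-* (p ++ q) r n ⟩
      conv (p ++ q) (coeff r) n                  ≈⟨ conv-++ p q (coeff r) n ⟩
      conv p (coeff r) n R.+ conv q (coeff r) n
        ≈⟨ R.+-cong (coeff-* p r n) (coeff-* q r n) ⟨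
      coeff (p *ᴸ r) n R.+ coeff (q *ᴸ r) n
        ≈⟨ coeff-++ (p *ᴸ r) (q *ᴸ r) n ⟨
      coeff (p *ᴸ r ++ q *ᴸ r) n                 ∎

    distribˡᴸ : ∀ r p q → r *ᴸ (p ++ q) ≈ᴸ r *ᴸ p ++ r *ᴸ q
    distribˡᴸ r p q = transᴸ (*-commᴸ r (p ++ q))
      (transᴸ (distribʳᴸ r p q) (++-congᴸ (*-commᴸ p r) (*-commᴸ q r)))

  laurentRing : CommutativeRing c ℓ
  laurentRing = record
    { Carrier = Laurent
    ; _≈_     = _≈ᴸ_
    ; _+_     = _++_
    ; _*_     = _*ᴸ_
    ; -_      = negᴸ
    ; 0#      = []
    ; 1#      = const 1#
    ; isCommutativeRing = record
      { isRing = record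
        { +-isAbelianGroup = record
          { isGroup = record
            { isMonoid = record
              { isSemigroup = record
                { isMagma = record
                  { isEquivalence = record
                    { refl = reflᴸ ; sym = symᴸ ; trans = transᴸ }
                  ; ∙-cong = ++-congᴸ
                  }
                ; assoc = ++-assocᴸ
                }
              ; identity =
                  (λ p → reflᴸ) , (λ p → transᴸ (++-commᴸ p []) reflᴸ)
              }
            ; inverse = (λ p → transᴸ (++-commᴸ (negᴸ p) p) (inverseʳᴸ p))
                      , inverseʳᴸ
            ; ⁻¹-cong = neg-congᴸ
            }
          ; comm = ++-commᴸ
          }
        ; *-cong     = *-congᴸ
        ; *-assoc    = *-assocᴸ
        ; *-identity = *-identityˡᴸ
                     , (λ p → transᴸ (*-commᴸ p (const 1#)) (*-identityˡᴸ p))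
        ; distrib    = distribˡᴸ , distribʳᴸ
        }
      ; *-comm = *-commᴸ
      }
    }

  open Fractions laurentRing public

  private
    bound : Laurent → ℕ
    bound []            = 0
    bound ((a , i) ∷ p) = ℤ.∣ i ∣ ℕ.+ bound p

    coeff-bound : ∀ p n → bound p ℕ.< ℤ.∣ n ∣ → coeff p n ≈ 0#
    coeff-bound []            n _ = R.refl
    coeff-bound ((a , i) ∷ p) n b<n with i ℤ.≟ n
    ... | yes ≡.refl =
      contradiction (ℕ.≤-<-trans (ℕ.m≤m+n ℤ.∣ i ∣ (bound p)) b<n) (ℕ.<-irrefl ≡.refl)
    ... | no _ = R.trans (R.+-identityˡ _)
      (coeff-bound p n (ℕ.≤-<-trans (ℕ.m≤n+m (bound p) ℤ.∣ i ∣) b<n))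

    2n≢0 : ∀ n → n ≢ + 0 → n ℤ.+ n ≢ + 0
    2n≢0 (+ zero)    n≢0 _ = n≢0 ≡.refl
    2n≢0 (+ (suc n)) n≢0 ()
    2n≢0 -[1+ n ]    n≢0 ()

    unshift₁ : ∀ k n → k ≡ (k ℤ.+ n) ℤ.- n
    unshift₁ = solve-∀

    unshift₂ : ∀ k n → (k ℤ.+ n) ℤ.- (ℤ.- n) ≡ k ℤ.+ (n ℤ.+ n)
    unshift₂ = solve-∀

    next : ∀ k s m → (k ℤ.+ s) ℤ.+ m ℤ.* s ≡ k ℤ.+ (+ 1 ℤ.+ m) ℤ.* s
    next = solve-∀

    undo : ∀ k x → x ≡ (k ℤ.+ x) ℤ.- k
    undo = solve-∀

  -- uⁿ - u⁻ⁿ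
  binomial : ℤ → Laurent
  binomial n = mono n ++ negᴸ (mono (ℤ.- n))

  binomial-regular : ∀ n → n ≢ + 0 → Regular (binomial n)
  binomial-regular n n≢0 .cancel p np≈0 .coeff-≈ k = begin
    coeff p k                  ≈⟨ periodic m k ⟩
    coeff p (k ℤ.+ + m ℤ.* s)  ≈⟨ coeff-bound p _ far ⟩
    0#                         ∎
    where
    s : ℤ
    s = n ℤ.+ n

    m : ℕ
    m = suc (ℤ.∣ k ∣ ℕ.+ bound p)

    step : ∀ k → coeff p k ≈ coeff p (k ℤ.+ s)
    step k = begin
      coeff p k
        ≡⟨ ≡.cong (coeff p) (unshift₁ k n) ⟩
      coeff p (k ℤ.+ n ℤ.- n)
        ≈⟨ RP.+-cancelʳ (R.- coeff p (k ℤ.+ n ℤ.- (ℤ.- n))) _ _ lemma ⟩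
      coeff p (k ℤ.+ n ℤ.- (ℤ.- n))
        ≡⟨ ≡.cong (coeff p) (unshift₂ k n) ⟩
      coeff p (k ℤ.+ s) ∎
      where
      lemma : coeff p (k ℤ.+ n ℤ.- n) R.+ R.- coeff p (k ℤ.+ n ℤ.- (ℤ.- n)) ≈
              coeff p (k ℤ.+ n ℤ.- (ℤ.- n)) R.+ R.- coeff p (k ℤ.+ n ℤ.- (ℤ.- n))
      lemma = begin
        coeff p (k ℤ.+ n ℤ.- n) R.+ R.- coeff p (k ℤ.+ n ℤ.- (ℤ.- n))
          ≈⟨ R.+-cong (R.sym (R.*-identityˡ _))
               (R.sym (R.trans (R.+-identityʳ _) (RP.-1*x≈-x _))) ⟩
        conv (binomial n) (coeff p) (k ℤ.+ n)
          ≈⟨ coeff-* (binomial n) p (k ℤ.+ n) ⟨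
        coeff (binomial n *ᴸ p) (k ℤ.+ n)
          ≈⟨ np≈0 .coeff-≈ (k ℤ.+ n) ⟩
        0#
          ≈⟨ R.-‿inverseʳ _ ⟨
        coeff p (k ℤ.+ n ℤ.- (ℤ.- n)) R.+ R.- coeff p (k ℤ.+ n ℤ.- (ℤ.- n)) ∎

    periodic : ∀ m k → coeff p k ≈ coeff p (k ℤ.+ + m ℤ.* s)
    periodic zero    k = R.reflexive (≡.cong (coeff p)
      (≡.sym (≡.trans (≡.cong (ℤ._+_ k) (ℤ.*-zeroˡ s)) (ℤ.+-identityʳ k))))
    periodic (suc m) k = begin
      coeff p k                               ≈⟨ step k ⟩
      coeff p (k ℤ.+ s)                       ≈⟨ periodic m (k ℤ.+ s) ⟩
      coeff p (k ℤ.+ s ℤ.+ + m ℤ.* s)         ≡⟨ ≡.cong (coeff p) (next k s (+ m)) ⟩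
      coeff p (k ℤ.+ + suc m ℤ.* s)           ∎

    s-nonZero : 0 ℕ.< ℤ.∣ s ∣
    s-nonZero = ℕ.n≢0⇒n>0 λ eq → 2n≢0 n n≢0 (ℤ.∣i∣≡0⇒i≡0 eq)

    m≤ : m ℕ.≤ ℤ.∣ + m ℤ.* s ∣
    m≤ = ℕ.≤-trans (ℕ.m≤m*n m ℤ.∣ s ∣ {{ℕ.>-nonZero s-nonZero}})
           (ℕ.≤-reflexive (≡.sym (ℤ.∣i*j∣≡∣i∣*∣j∣ (+ m) s)))

    triangle : ℤ.∣ + m ℤ.* s ∣ ℕ.≤ ℤ.∣ k ∣ ℕ.+ ℤ.∣ k ℤ.+ + m ℤ.* s ∣
    triangle = ℕ.≤-trans
      (ℕ.≤-reflexive (≡.cong ℤ.∣_∣ (undo k (+ m ℤ.* s))))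
      (ℕ.≤-trans (ℤ.∣i-j∣≤∣i∣+∣j∣ (k ℤ.+ + m ℤ.* s) k)
        (ℕ.≤-reflexive (ℕ.+-comm ℤ.∣ k ℤ.+ + m ℤ.* s ∣ ℤ.∣ k ∣)))

    far : bound p ℕ.< ℤ.∣ k ℤ.+ + m ℤ.* s ∣
    far = ℕ.+-cancelˡ-≤ ℤ.∣ k ∣ _ _
      (ℕ.≤-trans (ℕ.≤-reflexive (ℕ.+-suc ℤ.∣ k ∣ (bound p)))
        (ℕ.≤-trans m≤ triangle))

  private
    parity-⊖ : ∀ m n → parity ℤ.∣ m ℤ.⊖ n ∣ ≡ parity m ℙ.+ parity n
    parity-⊖ zero    zero    = ≡.refl
    parity-⊖ zero    (suc n) = ≡.refl
    parity-⊖ (suc m) zero    = ≡.sym (ℙ.+-identityʳ _)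
    parity-⊖ (suc m) (suc n) = ≡.trans
      (≡.cong (λ i → parity ℤ.∣ i ∣) (ℤ.[1+m]⊖[1+n]≡m⊖n m n))
      (≡.trans (parity-⊖ m n) (≡.sym (suc-suc m n)))
      where
      cancel⁻¹ : ∀ p q → (p ℙ.⁻¹) ℙ.+ (q ℙ.⁻¹) ≡ p ℙ.+ q
      cancel⁻¹ 0ℙ 0ℙ = ≡.refl
      cancel⁻¹ 0ℙ 1ℙ = ≡.refl
      cancel⁻¹ 1ℙ 0ℙ = ≡.refl
      cancel⁻¹ 1ℙ 1ℙ = ≡.refl

      parity-suc : ∀ n → parity (suc n) ≡ parity n ℙ.⁻¹
      parity-suc n = ≡.trans (≡.sym (ℙ.⁻¹-involutive _))
        (≡.cong ℙ._⁻¹ (ℙ.suc-homo-⁻¹ n))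

      suc-suc : ∀ m n → parity (suc m) ℙ.+ parity (suc n) ≡ parity m ℙ.+ parity n
      suc-suc m n = ≡.trans (≡.cong₂ ℙ._+_ (parity-suc m) (parity-suc n))
        (cancel⁻¹ (parity m) (parity n))

    parity-+ : ∀ i j → parity ℤ.∣ i ℤ.+ j ∣ ≡ parity ℤ.∣ i ∣ ℙ.+ parity ℤ.∣ j ∣
    parity-+ (+ m)    (+ n)    = ℙ.+-homo-+ m n
    parity-+ (+ m)    -[1+ n ] = parity-⊖ m (suc n)
    parity-+ -[1+ m ] (+ n)    =
      ≡.trans (parity-⊖ n (suc m)) (ℙ.+-comm (parity n) (parity (suc m)))
    parity-+ -[1+ m ] -[1+ n ] = ≡.trans
      (≡.cong (λ k → parity (suc k)) (≡.sym (ℕ.+-suc m n)))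
      (ℙ.+-homo-+ (suc m) (suc n))

    sg : ℤ → Carrier → Carrier
    sg i = signed (-1^ ℤ.∣ i ∣)

    signed-0 : ∀ s → signed s 0# ≈ 0#
    signed-0 Sign.+ = R.refl
    signed-0 Sign.- = RP.-0#≈0#

    signed-+ : ∀ s a b → signed s (a R.+ b) ≈ signed s a R.+ signed s b
    signed-+ Sign.+ a b = R.refl
    signed-+ Sign.- a b = R.sym (RP.-‿+-comm a b)

    signed-cong : ∀ s {a b} → a ≈ b → signed s a ≈ signed s b
    signed-cong Sign.+ e = e
    signed-cong Sign.- e = R.-‿cong e

    signed-invol : ∀ s a → signed s (signed s a) ≈ a
    signed-invol Sign.+ a = R.refl
    signed-invol Sign.- a = RP.-‿involutive a

    signed-* : ∀ p q a b → signed (toSign (p ℙ.+ q)) (a R.* b) ≈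
               signed (toSign p) a R.* signed (toSign q) b
    signed-* 0ℙ 0ℙ a b = R.refl
    signed-* 0ℙ 1ℙ a b = RP.-‿distribʳ-* a b
    signed-* 1ℙ 0ℙ a b = RP.-‿distribˡ-* a b
    signed-* 1ℙ 1ℙ a b = R.sym (R.trans (R.sym (RP.-‿distribˡ-* a (R.- b)))
      (R.trans (R.-‿cong (R.sym (RP.-‿distribʳ-* a b))) (RP.-‿involutive _)))

    sg-+ : ∀ i j a b → sg (i ℤ.+ j) (a R.* b) ≈ sg i a R.* sg j b
    sg-+ i j a b = R.trans
      (R.reflexive (≡.cong (λ p → signed (toSign p) (a R.* b)) (parity-+ i j)))
      (signed-* (parity ℤ.∣ i ∣) (parity ℤ.∣ j ∣) a b)

    term-sg : ∀ a i n → term (sg i a) i n ≈ sg n (term a i n)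
    term-sg a i n with i ℤ.≟ n
    ... | yes ≡.refl = R.refl
    ... | no  _      = R.sym (signed-0 (-1^ ℤ.∣ n ∣))

    coeff-flip : ∀ p n → coeff (flip p) n ≈ sg n (coeff p n)
    coeff-flip []            n = R.sym (signed-0 (-1^ ℤ.∣ n ∣))
    coeff-flip ((a , i) ∷ p) n = begin
      term (sg i a) i n R.+ coeff (flip p) n
        ≈⟨ R.+-cong (term-sg a i n) (coeff-flip p n) ⟩
      sg n (term a i n) R.+ sg n (coeff p n)
        ≈⟨ signed-+ (-1^ ℤ.∣ n ∣) _ _ ⟨
      sg n (term a i n R.+ coeff p n) ∎

    flip-conv : ∀ p q n → conv (flip p) (coeff (flip q)) n ≈ sg n (conv p (coeff q) n)
    flip-conv []            q n = R.sym (signed-0 (-1^ ℤ.∣ n ∣))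
    flip-conv ((a , i) ∷ p) q n = begin
      sg i a R.* coeff (flip q) (n ℤ.- i) R.+ conv (flip p) (coeff (flip q)) n
        ≈⟨ R.+-cong (R.*-congˡ (coeff-flip q (n ℤ.- i))) (flip-conv p q n) ⟩
      sg i a R.* sg (n ℤ.- i) (coeff q (n ℤ.- i)) R.+ sg n (conv p (coeff q) n)
        ≈⟨ R.+-congʳ (sg-+ i (n ℤ.- i) a _) ⟨
      sg (i ℤ.+ (n ℤ.- i)) (a R.* coeff q (n ℤ.- i)) R.+ sg n (conv p (coeff q) n)
        ≡⟨ ≡.cong (λ k → sg k (a R.* coeff q (n ℤ.- i)) R.+ sg n (conv p (coeff q) n))
                  (cancelʳ i n) ⟩
      sg n (a R.* coeff q (n ℤ.- i)) R.+ sg n (conv p (coeff q) n)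
        ≈⟨ signed-+ (-1^ ℤ.∣ n ∣) _ _ ⟨
      sg n (conv ((a , i) ∷ p) (coeff q) n) ∎

  flip-regular : ∀ {d} → Regular d → Regular (flip d)
  flip-regular {d} rd .cancel p dp≈0 .coeff-≈ n = begin
    coeff p n                  ≈⟨ signed-invol (-1^ ℤ.∣ n ∣) _ ⟨
    sg n (sg n (coeff p n))    ≈⟨ signed-cong (-1^ ℤ.∣ n ∣) (coeff-flip p n) ⟨
    sg n (coeff (flip p) n)    ≈⟨ signed-cong (-1^ ℤ.∣ n ∣) (flip-p≈0 .coeff-≈ n) ⟩
    sg n 0#                    ≈⟨ signed-0 (-1^ ℤ.∣ n ∣) ⟩
    0#                         ∎
    where
    flip-flip : ∀ n → coeff d n ≈ coeff (flip (flip d)) n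
    flip-flip n = R.sym (begin
      coeff (flip (flip d)) n  ≈⟨ coeff-flip (flip d) n ⟩
      sg n (coeff (flip d) n)  ≈⟨ signed-cong (-1^ ℤ.∣ n ∣) (coeff-flip d n) ⟩
      sg n (sg n (coeff d n))  ≈⟨ signed-invol (-1^ ℤ.∣ n ∣) _ ⟩
      coeff d n                ∎)

    flip-p≈0 : flip p ≈ᴸ []
    flip-p≈0 = rd .cancel (flip p) (transᴸ
      (*-congᴸ {d} {flip (flip d)} {flip p} {flip p} (coeffwise flip-flip) reflᴸ)
      (coeffwise λ n → begin
        coeff (flip (flip d) *ᴸ flip p) n        ≈⟨ coeff-* (flip (flip d)) (flip p) n ⟩
        conv (flip (flip d)) (coeff (flip p)) n  ≈⟨ flip-conv (flip d) p n ⟩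
        sg n (conv (flip d) (coeff p) n)
          ≈⟨ signed-cong (-1^ ℤ.∣ n ∣) (coeff-* (flip d) p n) ⟨
        sg n (coeff (flip d *ᴸ p) n)
          ≈⟨ signed-cong (-1^ ℤ.∣ n ∣) (dp≈0 .coeff-≈ n) ⟩
        sg n 0#                                  ≈⟨ signed-0 (-1^ ℤ.∣ n ∣) ⟩
        0#                                       ∎))

  const-regular : ∀ {a b} → b R.* a ≈ 1# → Regular (const a)
  const-regular {a} {b} ba≈1 .cancel p ap≈0 .coeff-≈ n = begin
    coeff p n                           ≈⟨ R.*-identityˡ _ ⟨
    1# R.* coeff p n                    ≈⟨ R.*-congʳ ba≈1 ⟨
    b R.* a R.* coeff p n               ≈⟨ R.*-assoc b a _ ⟩
    b R.* (a R.* coeff p n)             ≡⟨ ≡.cong (λ k → b R.* (a R.* coeff p k)) (sub-0 n) ⟨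
    b R.* (a R.* coeff p (n ℤ.- + 0))   ≈⟨ R.*-congˡ (R.+-identityʳ _) ⟨
    b R.* conv (const a) (coeff p) n    ≈⟨ R.*-congˡ (coeff-* (const a) p n) ⟨
    b R.* coeff (const a *ᴸ p) n        ≈⟨ R.*-congˡ (ap≈0 .coeff-≈ n) ⟩
    b R.* 0#                            ≈⟨ R.zeroʳ b ⟩
    0#                                  ∎

  flipᶠ : Frac → Frac
  flipᶠ (a / d ⟨ rd ⟩) = flip a / flip d ⟨ flip-regular rd ⟩

module _ (K : HeytingField c ℓ₁ ℓ₂) where

  open HeytingField K
  private
    module KR = CommutativeRing (HeytingCommutativeRing.commutativeRing heytingCommutativeRing)
  open RawMonoidOps KR.+-rawMonoid using () renaming (_×_ to _×̇_)
  open SemiringExp KR.semiring using (_^_)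

  CharacteristicZero : Set ℓ₂
  CharacteristicZero = ∀ n → (suc n ×̇ 1#) # 0#

  IsPrimitiveRoot : ℕ → Carrier → Set (ℓ₁ ⊔ ℓ₂)
  IsPrimitiveRoot t ζ =
    ζ ^ t ≈ 1# × (∀ k → 0 ℕ.< k → k ℕ.< t → (ζ ^ k) # 1#)

-- Finite-dimensional sl₂-modules, given by matrices in a basis of weight
-- vectors

module Sl₂ (K : HeytingField c ℓ₁ ℓ₂) where

  open HeytingField K
  private
    R : CommutativeRing c ℓ₁
    R = HeytingCommutativeRing.commutativeRing heytingCommutativeRing
    module KR = CommutativeRing R
  open RawMonoidOps KR.+-rawMonoid using (sum) renaming (_×_ to _×̇_)
  open LaurentPolynomials R using (Laurent)

  Matrix : ℕ → Set c
  Matrix n = Fin n → Fin n → Carrier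

  fromℤ : ℤ → Carrier
  fromℤ (+ n)    = n ×̇ 1#
  fromℤ -[1+ n ] = - (suc n ×̇ 1#)

  infixl 7 _⊗_

  _⊗_ : ∀ {n} → Matrix n → Matrix n → Matrix n
  (M ⊗ N) i j = sum λ k → M i k * N k j

  apply : ∀ {n} → Matrix n → Vector Carrier n → Vector Carrier n
  apply M v i = sum λ j → M i j * v j

  [_,_] : ∀ {n} → Matrix n → Matrix n → Matrix n
  [ M , N ] i j = (M ⊗ N) i j - (N ⊗ M) i j

  diagonal : ∀ {n} → Vector ℤ n → Matrix n
  diagonal w i j = if does (i Fin.≟ j) then fromℤ (w i) else 0#

  record Sl₂Module (n : ℕ) : Set (c ⊔ ℓ₁) where
    field
      weight : Vector ℤ n
      E F    : Matrix n

    H : Matrix n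
    H = diagonal weight

    field
      [H,E]≈2E  : ∀ i j → [ H , E ] i j ≈ fromℤ (+ 2) * E i j
      [H,F]≈-2F : ∀ i j → [ H , F ] i j ≈ fromℤ (ℤ.- + 2) * F i j
      [E,F]≈H   : ∀ i j → [ E , F ] i j ≈ H i j

  module _ {n} (V : Sl₂Module n) where

    open Sl₂Module V

    record IsSubmodule {p} (W : Pred (Vector Carrier n) p) :
                       Set (c ⊔ ℓ₁ ⊔ p) where
      field
        respects : ∀ {v w} → (∀ i → v i ≈ w i) → v ∈ W → w ∈ W
        0-closed : (λ _ → 0#) ∈ W
        +-closed : ∀ {v w} → v ∈ W → w ∈ W → (λ i → v i + w i) ∈ W
        *-closed : ∀ a {v} → v ∈ W → (λ i → a * v i) ∈ W
        E-closed : ∀ {v} → v ∈ W → apply E v ∈ W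
        F-closed : ∀ {v} → v ∈ W → apply F v ∈ W
        H-closed : ∀ {v} → v ∈ W → apply H v ∈ W

    Irreducible : Set (Level.suc (c ⊔ ℓ₁ ⊔ ℓ₂))
    Irreducible = n ≢ 0 ×
      (∀ (W : Pred (Vector Carrier n) (c ⊔ ℓ₁ ⊔ ℓ₂)) → IsSubmodule W →
       ∀ v → v ∈ W → (∃ λ i → v i # 0#) → ∀ w → w ∈ W)

    -- The sum of z^w over the weights w, as a Laurent polynomial in z.
    character : Laurent
    character = List.tabulate λ i → (1# , weight i)

module Residues (t : ℕ) (2≤t : 2 ℕ.≤ t) (lam : Vector ℕ (t ℕ.+ 2)) where

  N : ℕ
  N = t ℕ.+ 2

  instance
    t-nonZero : NonZero t
    t-nonZero = ℕ.>-nonZero (ℕ.<-≤-trans (s≤s z≤n) 2≤t)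

  residue : Fin N → Fin t
  residue j = β lam j mod t

  -- The columns are listed in increasing order, so the βⱼ in decreasing order.
  class : Fin t → List (Fin N)
  class i = filter (λ j → residue j Fin.≟ i) (allFin N)

  data Configuration : Set where
    twoPairs : (r-A r-B : Fin t) (j-A₁ j-A₂ j-B₁ j-B₂ : Fin N) → r-A Fin.< r-B →
               class r-A ≡ j-A₁ ∷ j-A₂ ∷ [] → class r-B ≡ j-B₁ ∷ j-B₂ ∷ [] →
               (∀ i → i ≢ r-A → i ≢ r-B → length (class i) ≡ 1) →
               Configuration
    triple   : (r : Fin t) (j-p j-q j-r : Fin N) →
               class r ≡ j-p ∷ j-q ∷ j-r ∷ [] →
               (∀ i → i ≢ r → length (class i) ≡ 1) →
               Configuration

  columnsOfA columnsOfB : Configuration → Fin N × Fin N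
  columnsOfA (twoPairs _ _ j-A₁ j-A₂ _ _ _ _ _ _) = j-A₁ , j-A₂
  columnsOfA (triple _ j-p j-q _ _ _)             = j-p , j-q
  columnsOfB (twoPairs _ _ _ _ j-B₁ j-B₂ _ _ _ _) = j-B₁ , j-B₂
  columnsOfB (triple _ _ j-q j-r _ _)             = j-q , j-r

  module _ (cfg : Configuration) where

    jA₁ jA₂ jB₁ jB₂ : Fin N
    jA₁ = proj₁ (columnsOfA cfg)
    jA₂ = proj₂ (columnsOfA cfg)
    jB₁ = proj₁ (columnsOfB cfg)
    jB₂ = proj₂ (columnsOfB cfg)

    a₁ a₂ b₁ b₂ d₁ d₂ d̃₃ d₃ : ℤ
    a₁ = + β lam jA₁
    a₂ = + β lam jA₂
    b₁ = + β lam jB₁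
    b₂ = + β lam jB₂
    d₁ = a₁ ℤ.- a₂
    d₂ = b₁ ℤ.- b₂
    d̃₃ = a₁ ℤ.+ a₂ ℤ.- b₁ ℤ.- b₂
    d₃ = + ℤ.∣ d̃₃ ∣

    S : List (Fin N)
    S = filter (λ j → ¬? (j Fin.≟ jA₁) ×-dec ¬? (j Fin.≟ jB₁)) (allFin N)

    inv : List (Fin t) → ℕ
    inv []      = 0
    inv (x ∷ w) = length (filter (Fin._<? x) w) ℕ.+ inv w

    -- ℤ.sign sends 0 to +, but it is applied here to integers that are
    -- nonzero: a₁ ≠ b₁ always, and d̃₃ ≠ 0 by hypothesis.
    ε : Sign
    ε = -1^ (t ℕ.+ ((N ℕ.+ 1) C 2))
      Sign.* -1^ (suc (toℕ jA₁) ℕ.+ suc (toℕ jB₁) ℕ.+ inv (map residue S))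
      Sign.* ℤ.sign (a₁ ℤ.- b₁)
      Sign.* ℤ.sign d̃₃

-- u is the variable of the Laurent polynomials; identities in K(z) are read in K(u) with z = u².

module Specialisation
  (K : HeytingField c ℓ₁ ℓ₂) (char0 : CharacteristicZero K)
  (t : ℕ) (2≤t : 2 ℕ.≤ t) (ζ : HeytingField.Carrier K)
  where

  open HeytingField K using (heytingCommutativeRing; #⇒invertible)

  coefficients : CommutativeRing c ℓ₁
  coefficients = HeytingCommutativeRing.commutativeRing heytingCommutativeRing

  private
    module K = CommutativeRing coefficients

  open SemiringExp K.semiring using (_^_)
  open LaurentPolynomials coefficients public
  open Schur laurentRing public using (vandermonde; schur)
  open Sl₂ K public using (Sl₂Module; Irreducible; character)

  points : Vector Laurent (t ℕ.+ 2)
  points = Vector._++_ {m = t} (λ i → const (ζ ^ toℕ i))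
                               (Vector.fromList (mono (+ 2) ∷ mono (ℤ.- + 2) ∷ []))

  IsLaurentInZ : Frac → Set (c ⊔ ℓ₁)
  IsLaurentInZ x = ∃ λ p → x ≃ ι (square p)

  ReversesSign : Frac → Set ℓ₁
  ReversesSign x = flipᶠ x ≃ neg x

  infix 9 χ[_/2] sinh[_θ/2]

  -- χ_{m/2} = (u^(m+2) - u^(-m-2)) / (u² - u⁻²), for an arbitrary integer m.
  χ[_/2] : ℤ → Frac
  χ[ m /2] = binomial (m ℤ.+ + 2) / binomial (+ 2) ⟨ binomial-regular (+ 2) (λ ()) ⟩

  -- The index m/2 is not an integer.
  HalfIntegral : ℤ → Set
  HalfIntegral m = ¬ (+ 2 ℤ.∣ m)

  private
    2-regular : Regular (const (K.1# K.+ K.1#))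
    2-regular = const-regular {b = proj₁ inverse}
      (K.trans (K.*-congˡ 2≈) (proj₁ (proj₂ inverse)))
      where
      inverse = #⇒invertible (char0 1)

      2≈ : K.1# K.+ K.1# K.≈ (K.1# K.+ (K.1# K.+ K.0#)) K.- K.0#
      2≈ = K.sym (K.trans (K.+-congˡ (RingProperties.-0#≈0# K.ring))
        (K.trans (K.+-identityʳ _) (K.+-congˡ (K.+-identityʳ _))))

  -- sinh(nθ/2) = (uⁿ - u⁻ⁿ)/2, with u standing for exp(θ/2).
  sinh[_θ/2] : ℤ → Frac
  sinh[ n θ/2] = binomial n / const (K.1# K.+ K.1#) ⟨ 2-regular ⟩

  private
    cancel₂ : ∀ m → m ℤ.- + 2 ℤ.+ + 2 ≡ m
    cancel₂ = solve-∀

    t≢0 : + t ≢ + 0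
    t≢0 t≡0 = ℕ.<⇒≢ (ℕ.<-≤-trans (s≤s z≤n) 2≤t) (≡.sym (ℤ.+-injective t≡0))

    t-regular : Regular (binomial (+ t))
    t-regular = binomial-regular (+ t) t≢0

    χ-regular : Regular (num χ[ + t ℤ.- + 2 /2])
    χ-regular = binomial-regular _ λ eq → t≢0 (≡.trans (≡.sym (cancel₂ (+ t))) eq)

  sinhRatio χRatio : ℤ → ℤ → ℤ → Frac
  sinhRatio d₁ d₂ d₃ =
    sinh[ d₁ θ/2] · sinh[ d₂ θ/2] · sinh[ d₃ θ/2]
      ÷ sinh[ + t θ/2] · sinh[ + t θ/2] · sinh[ + 2 θ/2]
        ⟨ *-regular (*-regular t-regular t-regular)
                    (binomial-regular (+ 2) λ ()) ⟩
  χRatio d₁ d₂ d₃ =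
    χ[ d₁ ℤ.- + 2 /2] · χ[ d₂ ℤ.- + 2 /2] · χ[ d₃ ℤ.- + 2 /2]
      ÷ χ[ + t ℤ.- + 2 /2] · χ[ + t ℤ.- + 2 /2]
        ⟨ *-regular χ-regular χ-regular ⟩

{-# OPTIONS --safe #-}
module Submission where

-- Both alternants are computed by column operations.  If α₁ ≡ α₂ (mod t), the
-- difference of the columns of exponents α₁ and α₂ vanishes in the first t rows,
-- where the variables are powers of ζ.  Subtracting the column of a₂ from that of
-- a₁ and the column of b₂ from that of b₁ therefore makes the matrix block
-- triangular: the block of the rows z and z⁻¹ has determinant
-- -(u^d₁ - u^-d₁)(u^d₂ - u^-d₂)(u^d̃₃ - u^-d̃₃) with z = u², and the other block
-- consists of the columns (ζ^i)^r for r in the word b_S, so its determinant is the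
-- Vandermonde determinant of the powers of ζ up to the sign of the permutation b_S.
-- The denominator is the case of the exponents t+1, t, ..., 0, where
-- d₁ = d₂ = t and d̃₃ = ±2, and the Vandermonde determinant cancels.
--
-- The ratio is a Laurent polynomial in u because t divides d₁ and d₂: when d₃ is
-- odd, t is odd and 2t divides one of d₁, d₂, and (u^2t - u^-2t)(u^d₃ - u^-d₃) is a
-- multiple of (u^t - u^-t)(u² - u⁻²).  It is invariant under u ↦ -u, hence even.

open import Defs
open import Level using (Level)
open import Algebra.Apartness.Bundles using (HeytingField; HeytingCommutativeRing)
open import Algebra.Bundles using (CommutativeRing)
import Algebra.Definitions.RawMonoid as RawMonoidOps
import Algebra.Properties.CommutativeMonoid.Sum as CommutativeMonoidSum
import Algebra.Properties.Ring as RingProperties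
import Algebra.Properties.Semiring.Exp as SemiringExp
import Algebra.Properties.Semiring.Mult as SemiringMult
import Algebra.Solver.CommutativeMonoid as CommutativeMonoidSolver
import Algebra.Solver.Ring as RingSolver
import Algebra.Solver.Ring.AlmostCommutativeRing as ACR
open import Data.Bool.Base using (if_then_else_; true; false)
open import Data.Fin.Base as Fin
  using (Fin; zero; suc; toℕ; fromℕ; fromℕ<; inject₁; opposite; punchIn; _↑ˡ_; _↑ʳ_)
open import Data.Fin.Induction using (<-weakInduction)
import Data.Fin.Properties as Fin
open import Data.Integer.Base as ℤ using (ℤ; +_; -[1+_])
import Data.Integer.Divisibility as ℤ using (_∣_)
import Data.Integer.Properties as ℤ
open import Data.Integer.Tactic.RingSolver using (solve-∀)
open import Data.List.Base as List
  using (List; []; _∷_; _++_; map; filter; length; tabulate; allFin)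
open import Data.List.Membership.Propositional using (_∈_)
open import Data.List.Membership.Propositional.Properties
  using (∈-allFin; ∈-map⁺; ∈-filter⁺; ∈-filter⁻; ∈-tabulate⁺)
open import Data.List.Membership.Propositional.Properties.WithK using (unique∧set⇒bag)
import Data.List.Properties as List
open import Data.List.Relation.Binary.BagAndSetEquality using (∼bag⇒↭)
open import Data.List.Relation.Binary.Permutation.Propositional
  using (_↭_; ↭-refl; ↭-prep; ↭-swap; ↭-trans; ↭-sym)
open import Data.List.Relation.Binary.Permutation.Propositional.Properties
  using (↭-length; filter-↭; All-resp-↭; ∈-resp-↭; drop-∷)
open import Data.List.Relation.Binary.Pointwise as Pointwise using (Pointwise; []; _∷_)
open import Data.List.Relation.Unary.All as All using (All; []; _∷_)
import Data.List.Relation.Unary.All.Properties as All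
open import Data.List.Relation.Unary.AllPairs using (AllPairs; []; _∷_)
import Data.List.Relation.Unary.AllPairs.Properties as AllPairs
open import Data.List.Relation.Unary.Any using (here; there)
open import Data.List.Relation.Unary.Unique.Propositional using (Unique)
import Data.List.Relation.Unary.Unique.Propositional.Properties as Unique
open import Data.Maybe.Base using (Maybe; just; nothing)
open import Data.Nat.Base as ℕ using (ℕ; zero; suc; parity; NonZero)
open import Data.Nat.Combinatorics using (_C_; nC1≡n; nCk+nC[k+1]≡[n+1]C[k+1])
open import Data.Nat.Divisibility using (divides)
open import Data.Nat.DivMod
  using (_%_; _/_; _mod_; m≡m%n+[m/n]*n; m%n<n; m<n⇒m%n≡m; [m+n]%n≡m%n)
import Data.Nat.Properties as ℕ
open import Data.Parity.Base as ℙ using (Parity; 0ℙ; 1ℙ; toSign)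
import Data.Parity.Properties as ℙ
open import Data.Product.Base using (Σ; ∃; ∃₂; _×_; _,_; proj₁; proj₂)
open import Data.Sign.Base as Sign using (Sign)
import Data.Sign.Properties as Sign
open import Data.Sum.Base using (_⊎_; inj₁; inj₂)
open import Data.Vec.Functional as Vector using (Vector; removeAt)
import Data.Vec.Functional.Properties as Vector
open import Function.Base using (_∘_; id)
open import Function.Bundles using (_⇔_; mk⇔; Equivalence)
open import Relation.Binary.Definitions using (tri<; tri≈; tri>)
open import Relation.Binary.PropositionalEquality as ≡ using (_≡_; _≢_)
open import Relation.Nullary using (¬_; yes; no; contradiction; does)
open import Relation.Nullary.Decidable using (¬?; _×-dec_; dec-true; dec-false)
open import Relation.Unary using (Pred; Decidable) renaming (_∈_ to _∈ᵁ_)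

open CommutativeMonoidSum ℕ.+-0-commutativeMonoid
  using (sum-cong-≗; sum-replicate-zero; ∑-distrib-+) renaming (sum to sumℕ)

-- The determinant in the powers of ζ is never evaluated. Both alternants produce the same factor
-- `D₀`, and it may be cancelled as soon as it is regular, which holds because differences of
-- distinct powers of a primitive root are invertible. What must be exact is the sign, and it is
-- obtained by counting inversions of two words: the order of the columns and the residues.
-- Determinants are therefore expanded over lists of columns, where an exchange, a common prefix or
-- a combination of columns is an operation on lists. In a class of three the pairs A and B share
-- the column a₂ = b₁. The subtraction of a₂ has to happen while the column of b₁ is still intact;
-- with that order one argument covers both configurations. Fractions are compared by cross
-- multiplication over regular denominators, since a Heyting field offers no decision whether an
-- element is zero. The variable u with z = u² is forced by odd d₁, d₂, d₃ and t, for which the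
-- powers of z would have half-integral exponents.

private variable
  c ℓ ℓ₁ ℓ₂ ℓᵃ ℓᵇ : Level
  A : Set ℓᵃ
  A′ : Set ℓᵇ
  n : ℕ

-- Ring identities with integer coefficients

module IntegerSolver (R : CommutativeRing c ℓ) where

  open CommutativeRing R hiding (zero)
  open RingProperties ring
  open SemiringMult semiring using (×-homo-+; ×1-homo-*) renaming (_×_ to _×̇_)
  open import Relation.Binary.Reasoning.Setoid setoid

  ⟦_⟧ : ℤ → Carrier
  ⟦ + n ⟧      = n ×̇ 1#
  ⟦ -[1+ n ] ⟧ = - (suc n ×̇ 1#)

  private
    shift : ∀ a x y → x - y ≈ (a + x) - (a + y)
    shift a x y = sym (begin
      (a + x) - (a + y)        ≈⟨ +-congˡ (-‿+-comm a y) ⟨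
      (a + x) + (- a - y)      ≈⟨ +-congʳ (+-comm a x) ⟩
      (x + a) + (- a - y)      ≈⟨ +-assoc x a _ ⟩
      x + (a + (- a - y))      ≈⟨ +-congˡ (+-assoc a (- a) (- y)) ⟨
      x + ((a - a) - y)        ≈⟨ +-congˡ (+-congʳ (-‿inverseʳ a)) ⟩
      x + (0# - y)             ≈⟨ +-congˡ (+-identityˡ _) ⟩
      x - y                    ∎)

  ⊖-homo : ∀ m n → ⟦ m ℤ.⊖ n ⟧ ≈ m ×̇ 1# - n ×̇ 1#
  ⊖-homo zero    zero    = sym (-‿inverseʳ 0#)
  ⊖-homo zero    (suc n) = sym (+-identityˡ _)
  ⊖-homo (suc m) zero    = sym (trans (+-congˡ -0#≈0#) (+-identityʳ _))
  ⊖-homo (suc m) (suc n) = begin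
    ⟦ suc m ℤ.⊖ suc n ⟧        ≡⟨ ≡.cong ⟦_⟧ (ℤ.[1+m]⊖[1+n]≡m⊖n m n) ⟩
    ⟦ m ℤ.⊖ n ⟧                ≈⟨ ⊖-homo m n ⟩
    m ×̇ 1# - n ×̇ 1#            ≈⟨ shift 1# _ _ ⟩
    suc m ×̇ 1# - suc n ×̇ 1#    ∎

  +-homo : ∀ i j → ⟦ i ℤ.+ j ⟧ ≈ ⟦ i ⟧ + ⟦ j ⟧
  +-homo (+ m)    (+ n)    = ×-homo-+ 1# m n
  +-homo (+ m)    -[1+ n ] = ⊖-homo m (suc n)
  +-homo -[1+ m ] (+ n)    = trans (⊖-homo n (suc m)) (+-comm _ _)
  +-homo -[1+ m ] -[1+ n ] = begin
    - (suc (suc (m ℕ.+ n)) ×̇ 1#)      ≡⟨ ≡.cong (λ k → - (suc k ×̇ 1#)) (ℕ.+-suc m n) ⟨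
    - ((suc m ℕ.+ suc n) ×̇ 1#)        ≈⟨ -‿cong (×-homo-+ 1# (suc m) (suc n)) ⟩
    - (suc m ×̇ 1# + suc n ×̇ 1#)       ≈⟨ -‿+-comm _ _ ⟨
    - (suc m ×̇ 1#) - (suc n ×̇ 1#)     ∎

  -‿homo : ∀ i → ⟦ ℤ.- i ⟧ ≈ - ⟦ i ⟧
  -‿homo (+ zero)  = sym -0#≈0#
  -‿homo (+ suc n) = refl
  -‿homo -[1+ n ]  = sym (-‿involutive _)

  ◃-homo⁻ : ∀ n → ⟦ Sign.- ℤ.◃ n ⟧ ≈ - (n ×̇ 1#)
  ◃-homo⁻ zero    = sym -0#≈0#
  ◃-homo⁻ (suc n) = refl

  *-homo : ∀ i j → ⟦ i ℤ.* j ⟧ ≈ ⟦ i ⟧ * ⟦ j ⟧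
  *-homo (+ m)    (+ n)    =
    trans (reflexive (≡.cong ⟦_⟧ (ℤ.+◃n≡+n (m ℕ.* n)))) (×1-homo-* m n)
  *-homo (+ m)    -[1+ n ] = trans (◃-homo⁻ (m ℕ.* suc n))
    (trans (-‿cong (×1-homo-* m (suc n))) (-‿distribʳ-* _ _))
  *-homo -[1+ m ] (+ n)    = trans (◃-homo⁻ (suc m ℕ.* n))
    (trans (-‿cong (×1-homo-* (suc m) n)) (-‿distribˡ-* _ _))
  *-homo -[1+ m ] -[1+ n ] = begin
    (suc m ℕ.* suc n) ×̇ 1#               ≈⟨ ×1-homo-* (suc m) (suc n) ⟩
    suc m ×̇ 1# * (suc n ×̇ 1#)            ≈⟨ -‿involutive _ ⟨
    - - (suc m ×̇ 1# * (suc n ×̇ 1#))      ≈⟨ -‿cong (-‿distribˡ-* _ _) ⟩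
    - (- (suc m ×̇ 1#) * (suc n ×̇ 1#))    ≈⟨ -‿distribʳ-* _ _ ⟩
    - (suc m ×̇ 1#) * - (suc n ×̇ 1#)      ∎

  private
    target : ACR.AlmostCommutativeRing _ _
    target = ACR.fromCommutativeRing R

    morphism : ℤ.+-*-rawRing ACR.-Raw-AlmostCommutative⟶ target
    morphism = record
      { ⟦_⟧    = ⟦_⟧
      ; +-homo = +-homo
      ; *-homo = *-homo
      ; -‿homo = -‿homo
      ; 0-homo = refl
      ; 1-homo = +-identityʳ 1#
      }

    -- Equality in `R` need not be decidable, so normal forms are computed over ℤ. Distinct integers
    -- may still agree in `R`; such pairs are left undecided.
    ≟-coefficient : ∀ i j → Maybe (⟦ i ⟧ ≈ ⟦ j ⟧)
    ≟-coefficient i j with i ℤ.≟ j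
    ... | yes ≡.refl = just refl
    ... | no _       = nothing

  open RingSolver ℤ.+-*-rawRing target morphism ≟-coefficient public
    using (solve; _:=_; _:+_; _:*_; _:-_; :-_)

-- Signs, fractions and determinants

-1^-+ : ∀ m n → -1^ (m ℕ.+ n) ≡ -1^ m Sign.* -1^ n
-1^-+ m n = ≡.trans (≡.cong toSign (ℙ.+-homo-+ m n)) (ℙ.+-homo-* (parity m) (parity n))

-1^-suc : ∀ n → -1^ suc n ≡ Sign.opposite (-1^ n)
-1^-suc = -1^-+ 1

module SignActionProperties (R : CommutativeRing c ℓ) where

  open CommutativeRing R
  open RingProperties ring
  open SignAction R

  signed-cong : ∀ s {x y} → x ≈ y → signed s x ≈ signed s y
  signed-cong Sign.+ e = e
  signed-cong Sign.- e = -‿cong e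

  signed-≡ : ∀ {s s′} x → s ≡ s′ → signed s x ≈ signed s′ x
  signed-≡ x ≡.refl = refl

  signed-0 : ∀ s → signed s 0# ≈ 0#
  signed-0 Sign.+ = refl
  signed-0 Sign.- = -0#≈0#

  signed-+ : ∀ s x y → signed s (x + y) ≈ signed s x + signed s y
  signed-+ Sign.+ x y = refl
  signed-+ Sign.- x y = sym (-‿+-comm x y)

  signed-opposite : ∀ s x → signed (Sign.opposite s) x ≈ - signed s x
  signed-opposite Sign.+ x = refl
  signed-opposite Sign.- x = sym (-‿involutive x)

  signed-* : ∀ s s′ x → signed (s Sign.* s′) x ≈ signed s (signed s′ x)
  signed-* Sign.+ s′ x = refl
  signed-* Sign.- s′ x = signed-opposite s′ x

  signed-involutive : ∀ s x → signed s (signed s x) ≈ x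
  signed-involutive Sign.+ x = refl
  signed-involutive Sign.- x = -‿involutive x

  signed-*ˡ : ∀ s x y → signed s x * y ≈ signed s (x * y)
  signed-*ˡ Sign.+ x y = refl
  signed-*ˡ Sign.- x y = sym (-‿distribˡ-* x y)

  signed-*ʳ : ∀ s x y → x * signed s y ≈ signed s (x * y)
  signed-*ʳ Sign.+ x y = refl
  signed-*ʳ Sign.- x y = sym (-‿distribʳ-* x y)

  signed-*-* : ∀ s s′ x y → signed (s Sign.* s′) (x * y) ≈ signed s x * signed s′ y
  signed-*-* s s′ x y = trans (signed-* s s′ (x * y))
    (sym (trans (signed-*ˡ s x _) (signed-cong s (signed-*ʳ s′ x y))))

module FractionProperties (R : CommutativeRing c ℓ) where

  open CommutativeRing R hiding (zero)
  open RingProperties ring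
  open SignAction R
  open IntegerSolver R
  open Fractions R
  open RawMonoidOps *-rawMonoid using () renaming (sum to product)

  regular-resp-≈ : ∀ {d e} → d ≈ e → Regular d → Regular e
  regular-resp-≈ d≈e rd .cancel x ex≈0 = rd .cancel x (trans (*-congʳ d≈e) ex≈0)

  regular-signed : ∀ s {d} → Regular d → Regular (signed s d)
  regular-signed Sign.+ rd = rd
  regular-signed Sign.- {d} rd .cancel x -dx≈0 = rd .cancel x (trans
    (trans (sym (-‿involutive _)) (-‿cong (trans (-‿distribˡ-* d x) -dx≈0))) -0#≈0#)

  regular-product : ∀ {n} (x : Vector Carrier n) → (∀ i → Regular (x i)) → Regular (product x)
  regular-product {ℕ.zero}  x rx = 1-regular
  regular-product {ℕ.suc n} x rx =
    *-regular (rx Fin.zero) (regular-product (x ∘ Fin.suc) (rx ∘ Fin.suc))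

  regular-cancel : ∀ {d} → Regular d → ∀ x y → d * x ≈ d * y → x ≈ y
  regular-cancel {d} rd x y dx≈dy = trans
    (solve 2 (λ x y → x := (x :- y) :+ y) refl x y)
    (trans (+-congʳ (rd .cancel (x - y) (trans
      (solve 3 (λ d x y → d :* (x :- y) := d :* x :- d :* y) refl d x y)
      (trans (+-congʳ dx≈dy) (-‿inverseʳ _)))))
    (+-identityˡ y))

  -- After multiplying the two equations the middle denominator `e` is a common factor; its
  -- regularity is what removes it.
  ≃-trans : ∀ {x y z} → x ≃ y → y ≃ z → x ≃ z
  ≃-trans {a / d ⟨ _ ⟩} {b / e ⟨ re ⟩} {c / f ⟨ _ ⟩} ae≈bd bf≈ce =
    regular-cancel re (a * f) (c * d) (trans
      (solve 3 (λ e a f → e :* (a :* f) := a :* e :* f) refl e a f)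
      (trans (*-congʳ ae≈bd) (trans
        (solve 3 (λ b d f → b :* d :* f := b :* f :* d) refl b d f)
        (trans (*-congʳ bf≈ce)
          (solve 3 (λ c e d → c :* e :* d := e :* (c :* d)) refl c e d)))))

  ≃-sym : ∀ {x y} → x ≃ y → y ≃ x
  ≃-sym = sym

  •-cong : ∀ s {x y} → x ≃ y → s • x ≃ s • y
  •-cong Sign.+ e = e
  •-cong Sign.- e = trans (sym (-‿distribˡ-* _ _)) (trans (-‿cong e) (-‿distribˡ-* _ _))

-- Determinants over lists of columns

module Determinant (R : CommutativeRing c ℓ) where

  open CommutativeRing R hiding (zero)
  open RingProperties ring
  open IntegerSolver R
  open SignAction R
  open SignActionProperties R
  open Schur R using (det)
  open Fractions R using (Regular; *-regular)
  open FractionProperties R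
  open RawMonoidOps +-rawMonoid using (sum)
  open RawMonoidOps *-rawMonoid using () renaming (sum to product)
  open SemiringExp semiring using (_^_)
  open import Relation.Binary.Reasoning.Setoid setoid

  -- The Laplace expansion along the row r of a matrix with columns xs, where g evaluates minors.
  laplace : (List A → Carrier) → (A → Carrier) → List A → Carrier
  laplace g r []       = 0#
  laplace g r (x ∷ xs) = r x * g xs - laplace (g ∘ (x ∷_)) r xs

  -- The determinant with the columns in a list, which is 0 when there are too few or too many.
  detᶜ : ∀ {n} → (Fin n → A → Carrier) → List A → Carrier
  detᶜ {n = zero}  M []      = 1#
  detᶜ {n = zero}  M (_ ∷ _) = 0#
  detᶜ {n = suc n} M xs      = laplace (detᶜ (M ∘ suc)) (M zero) xs

  -- The expansion evaluates minors only on lists with one column fewer. The length is recorded for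
  -- `detᶜ-block`, whose induction hypothesis holds only for lists of the right length.
  laplace-cong-length : ∀ {g h : List A → Carrier} {r q : A → Carrier} xs →
    (∀ ys → suc (length ys) ≡ length xs → g ys ≈ h ys) → (∀ x → r x ≈ q x) →
    laplace g r xs ≈ laplace h q xs
  laplace-cong-length []       g≈h r≈q = refl
  laplace-cong-length (x ∷ xs) g≈h r≈q = +-cong
    (*-cong (r≈q x) (g≈h xs ≡.refl))
    (-‿cong (laplace-cong-length xs (λ ys e → g≈h (x ∷ ys) (≡.cong suc e)) r≈q))

  laplace-cong : ∀ {g h : List A → Carrier} {r q : A → Carrier} →
    (∀ ys → g ys ≈ h ys) → (∀ x → r x ≈ q x) → ∀ xs → laplace g r xs ≈ laplace h q xs
  laplace-cong g≈h r≈q xs = laplace-cong-length xs (λ ys _ → g≈h ys) r≈q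

  laplace-0ᵍ : ∀ {g : List A → Carrier} {r : A → Carrier} xs →
    (∀ ys → g ys ≈ 0#) → laplace g r xs ≈ 0#
  laplace-0ᵍ []       g≈0 = refl
  laplace-0ᵍ (x ∷ xs) g≈0 = trans
    (+-cong (trans (*-congˡ (g≈0 xs)) (zeroʳ _)) (-‿cong (laplace-0ᵍ xs (g≈0 ∘ (x ∷_)))))
    (-‿inverseʳ 0#)

  laplace-0ʳ : ∀ {g : List A → Carrier} {r : A → Carrier} {xs} →
    All (λ x → r x ≈ 0#) xs → laplace g r xs ≈ 0#
  laplace-0ʳ []             = refl
  laplace-0ʳ (rx≈0 ∷ rxs≈0) = trans
    (+-cong (trans (*-congʳ rx≈0) (zeroˡ _)) (-‿cong (laplace-0ʳ rxs≈0)))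
    (-‿inverseʳ 0#)

  laplace-neg : ∀ (g : List A → Carrier) r xs → laplace (-_ ∘ g) r xs ≈ - laplace g r xs
  laplace-neg g r []       = sym -0#≈0#
  laplace-neg g r (x ∷ xs) = trans
    (+-congˡ (-‿cong (laplace-neg (g ∘ (x ∷_)) r xs)))
    (solve 3 (λ r g l → r :* (:- g) :- (:- l) := :- (r :* g :- l)) refl _ _ _)

  laplace-*ʳ : ∀ (g : List A → Carrier) r k xs →
    laplace (λ ys → g ys * k) r xs ≈ laplace g r xs * k
  laplace-*ʳ g r k []       = sym (zeroˡ k)
  laplace-*ʳ g r k (x ∷ xs) = trans
    (+-congˡ (-‿cong (laplace-*ʳ (g ∘ (x ∷_)) r k xs)))
    (solve 4 (λ r g l k → r :* (g :* k) :- l :* k := (r :* g :- l) :* k) refl _ _ _ k)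

  laplace-combine : ∀ (g h : List A → Carrier) r k xs →
    laplace (λ ys → g ys - k * h ys) r xs ≈ laplace g r xs - k * laplace h r xs
  laplace-combine g h r k []       = sym (trans (+-congˡ (-‿cong (zeroʳ k))) (-‿inverseʳ 0#))
  laplace-combine g h r k (x ∷ xs) = trans
    (+-congˡ (-‿cong (laplace-combine (g ∘ (x ∷_)) (h ∘ (x ∷_)) r k xs)))
    (solve 6 (λ r g h k l m → r :* (g :- k :* h) :- (l :- k :* m) :=
                              (r :* g :- l) :- k :* (r :* h :- m)) refl _ _ _ k _ _)

  laplace-map : ∀ (f : A → A′) (g : List A′ → Carrier) r xs →
    laplace g r (map f xs) ≈ laplace (g ∘ map f) (r ∘ f) xs
  laplace-map f g r []       = refl
  laplace-map f g r (x ∷ xs) = +-congˡ (-‿cong (laplace-map f (g ∘ (f x ∷_)) r xs))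

  detᶜ-cong : ∀ {n} {M N : Fin n → A → Carrier} → (∀ i x → M i x ≈ N i x) →
              ∀ xs → detᶜ M xs ≈ detᶜ N xs
  detᶜ-cong {n = zero}  M≈N []       = refl
  detᶜ-cong {n = zero}  M≈N (x ∷ xs) = refl
  detᶜ-cong {n = suc n} M≈N xs       = laplace-cong (detᶜ-cong (M≈N ∘ suc)) (M≈N zero) xs

  detᶜ-map : ∀ {n} (f : A → A′) (M : Fin n → A′ → Carrier) xs →
             detᶜ M (map f xs) ≈ detᶜ (λ i → M i ∘ f) xs
  detᶜ-map {n = zero}  f M []       = refl
  detᶜ-map {n = zero}  f M (x ∷ xs) = refl
  detᶜ-map {n = suc n} f M xs       = trans (laplace-map f (detᶜ (M ∘ suc)) (M zero) xs)
    (laplace-cong (detᶜ-map f (M ∘ suc)) (λ _ → refl) xs)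

  detᶜ-scale : ∀ {n} (s : Fin n → Carrier) (M : Fin n → A → Carrier) xs →
    detᶜ (λ i x → s i * M i x) xs ≈ detᶜ M xs * product s
  detᶜ-scale {n = zero}  s M []       = sym (*-identityʳ 1#)
  detᶜ-scale {n = zero}  s M (x ∷ xs) = sym (zeroˡ _)
  detᶜ-scale {n = suc n} s M xs       = begin
    laplace (detᶜ λ i x → s (suc i) * M (suc i) x) (λ x → s zero * M zero x) xs
      ≈⟨ laplace-cong (detᶜ-scale (s ∘ suc) (M ∘ suc)) (λ _ → refl) xs ⟩
    laplace (λ ys → detᶜ (M ∘ suc) ys * p) (λ x → s zero * M zero x) xs
      ≈⟨ scaleʳ _ xs ⟩
    s zero * laplace (λ ys → detᶜ (M ∘ suc) ys * p) (M zero) xs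
      ≈⟨ *-congˡ (laplace-*ʳ _ (M zero) p xs) ⟩
    s zero * (detᶜ M xs * p)
      ≈⟨ solve 3 (λ s d p → s :* (d :* p) := d :* (s :* p)) refl _ _ p ⟩
    detᶜ M xs * (s zero * p) ∎
    where
    p : Carrier
    p = product (s ∘ suc)

    scaleʳ : ∀ g xs → laplace g (λ x → s zero * M zero x) xs ≈ s zero * laplace g (M zero) xs
    scaleʳ g []       = sym (zeroʳ _)
    scaleʳ g (x ∷ xs) = trans (+-congˡ (-‿cong (scaleʳ (g ∘ (x ∷_)) xs)))
      (solve 4 (λ s r g l → s :* r :* g :- s :* l := s :* (r :* g :- l)) refl _ _ _ _)

  -- `repeat` is a separate field because `exchange` alone gives only that twice the value is 0.
  -- Abstracting from determinants lets inductions absorb a prefix of columns into `g`.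
  record Alternating {A : Set ℓᵃ} (g : List A → Carrier) : Set (ℓᵃ Level.⊔ ℓ) where
    field
      exchange : ∀ l x y r → g (l ++ x ∷ y ∷ r) ≈ - g (l ++ y ∷ x ∷ r)
      repeat   : ∀ l x r → g (l ++ x ∷ x ∷ r) ≈ 0#

  open Alternating

  alternating-∷ : ∀ {g : List A → Carrier} x → Alternating g → Alternating (g ∘ (x ∷_))
  alternating-∷ x alt .exchange l = alt .exchange (x ∷ l)
  alternating-∷ x alt .repeat   l = alt .repeat (x ∷ l)

  alternating-++ : ∀ {g : List A → Carrier} l → Alternating g → Alternating (g ∘ (l ++_))
  alternating-++ []      alt = alt
  alternating-++ (x ∷ l) alt = alternating-++ l (alternating-∷ x alt)

  -- Each exchange carries the leading column one place closer to its copy and costs only a sign.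
  alternating-∈ : ∀ {g : List A → Carrier} {x xs} → Alternating g → x ∈ xs → g (x ∷ xs) ≈ 0#
  alternating-∈ alt (here ≡.refl) = alt .repeat [] _ _
  alternating-∈ alt (there {x = y} x∈xs) = trans (alt .exchange [] _ _ _)
    (trans (-‿cong (alternating-∈ (alternating-∷ y alt) x∈xs)) -0#≈0#)

  -- The two terms that delete one of the adjacent columns trade places, with opposite signs because
  -- the positions differ by one. All other terms keep both columns in the minor, where `g`
  -- alternates.
  laplace-alternating : ∀ {g : List A → Carrier} r → Alternating g → Alternating (laplace g r)
  laplace-alternating {g = g} r alt .exchange [] x y xs = begin
    r x * g (y ∷ xs) - (r y * g (x ∷ xs) - laplace (g ∘ (x ∷_) ∘ (y ∷_)) r xs)
      ≈⟨ +-congˡ (-‿cong (+-congˡ (-‿cong (laplace-cong (alt .exchange [] x y) (λ _ → refl) xs)))) ⟩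
    r x * g (y ∷ xs) - (r y * g (x ∷ xs) - laplace (-_ ∘ g ∘ (y ∷_) ∘ (x ∷_)) r xs)
      ≈⟨ +-congˡ (-‿cong (+-congˡ (-‿cong (laplace-neg _ r xs)))) ⟩
    r x * g (y ∷ xs) - (r y * g (x ∷ xs) - - laplace (g ∘ (y ∷_) ∘ (x ∷_)) r xs)
      ≈⟨ solve 3 (λ s t l → s :- (t :- (:- l)) := :- (t :- (s :- l))) refl _ _ _ ⟩
    - laplace g r (y ∷ x ∷ xs) ∎
  laplace-alternating {g = g} r alt .exchange (z ∷ l) x y xs = begin
    r z * g (l ++ x ∷ y ∷ xs) - laplace (g ∘ (z ∷_)) r (l ++ x ∷ y ∷ xs)
      ≈⟨ +-cong (*-congˡ (alt .exchange l x y xs))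
                (-‿cong (laplace-alternating r (alternating-∷ z alt) .exchange l x y xs)) ⟩
    r z * (- g (l ++ y ∷ x ∷ xs)) - - laplace (g ∘ (z ∷_)) r (l ++ y ∷ x ∷ xs)
      ≈⟨ solve 3 (λ r g l → r :* (:- g) :- (:- l) := :- (r :* g :- l)) refl _ _ _ ⟩
    - laplace g r (z ∷ l ++ y ∷ x ∷ xs) ∎
  laplace-alternating {g = g} r alt .repeat [] x xs = trans
    (solve 2 (λ s l → s :- (s :- l) := l) refl _ _) (laplace-0ᵍ xs (alt .repeat [] x))
  laplace-alternating {g = g} r alt .repeat (z ∷ l) x xs = trans
    (+-cong (trans (*-congˡ (alt .repeat l x xs)) (zeroʳ _))
            (-‿cong (laplace-alternating r (alternating-∷ z alt) .repeat l x xs)))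
    (-‿inverseʳ 0#)

  detᶜ-alternating : ∀ {n} (M : Fin n → A → Carrier) → Alternating (detᶜ M)
  detᶜ-alternating {n = zero}  M .exchange []      x y r = sym -0#≈0#
  detᶜ-alternating {n = zero}  M .exchange (_ ∷ l) x y r = sym -0#≈0#
  detᶜ-alternating {n = zero}  M .repeat   []      x r = refl
  detᶜ-alternating {n = zero}  M .repeat   (_ ∷ l) x r = refl
  detᶜ-alternating {n = suc n} M = laplace-alternating (M zero) (detᶜ-alternating (M ∘ suc))

  -- In each term of the expansion the marked column enters exactly once, as the entry of the row or
  -- inside the minor, so linearity of both passes to the sum.
  laplace-linear : ∀ {g : List A → Carrier} {r : A → Carrier} {x y z k} →
    (∀ l xs → g (l ++ z ∷ xs) ≈ g (l ++ x ∷ xs) - k * g (l ++ y ∷ xs)) →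
    r z ≈ r x - k * r y → ∀ l xs →
    laplace g r (l ++ z ∷ xs) ≈ laplace g r (l ++ x ∷ xs) - k * laplace g r (l ++ y ∷ xs)
  laplace-linear {g = g} {r} {x} {y} {z} {k} lin rz [] xs = begin
    r z * g xs - laplace (g ∘ (z ∷_)) r xs
      ≈⟨ +-cong (*-congʳ rz) (-‿cong (trans (laplace-cong (lin []) (λ _ → refl) xs)
                                           (laplace-combine _ _ r k xs))) ⟩
    (r x - k * r y) * g xs - (laplace (g ∘ (x ∷_)) r xs - k * laplace (g ∘ (y ∷_)) r xs)
      ≈⟨ solve 6 (λ s t g k l m → (s :- k :* t) :* g :- (l :- k :* m) :=
                                  (s :* g :- l) :- k :* (t :* g :- m)) refl _ _ _ k _ _ ⟩
    laplace g r (x ∷ xs) - k * laplace g r (y ∷ xs) ∎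
  laplace-linear {g = g} {r} {x} {y} {z} {k} lin rz (w ∷ l) xs = begin
    r w * g (l ++ z ∷ xs) - laplace (g ∘ (w ∷_)) r (l ++ z ∷ xs)
      ≈⟨ +-cong (*-congˡ (lin l xs)) (-‿cong (laplace-linear (lin ∘ (w ∷_)) rz l xs)) ⟩
    r w * (g (l ++ x ∷ xs) - k * g (l ++ y ∷ xs)) -
      (laplace (g ∘ (w ∷_)) r (l ++ x ∷ xs) - k * laplace (g ∘ (w ∷_)) r (l ++ y ∷ xs))
      ≈⟨ solve 6 (λ r g h k l m → r :* (g :- k :* h) :- (l :- k :* m) :=
                                  (r :* g :- l) :- k :* (r :* h :- m)) refl _ _ _ k _ _ ⟩
    laplace g r (w ∷ l ++ x ∷ xs) - k * laplace g r (w ∷ l ++ y ∷ xs) ∎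

  detᶜ-linear : ∀ {n} {M : Fin n → A → Carrier} {x y z k} →
    (∀ i → M i z ≈ M i x - k * M i y) → ∀ l xs →
    detᶜ M (l ++ z ∷ xs) ≈ detᶜ M (l ++ x ∷ xs) - k * detᶜ M (l ++ y ∷ xs)
  detᶜ-linear {n = zero}  {k = k} Mz []      xs =
    sym (trans (+-congˡ (-‿cong (zeroʳ k))) (-‿inverseʳ 0#))
  detᶜ-linear {n = zero}  {k = k} Mz (_ ∷ l) xs =
    sym (trans (+-congˡ (-‿cong (zeroʳ k))) (-‿inverseʳ 0#))
  detᶜ-linear {n = suc n} Mz = laplace-linear (detᶜ-linear (Mz ∘ suc)) (Mz zero)

  -- The correction term has the column `y` twice and vanishes. The index `z` must itself name the
  -- combined column, which is why the applications index matrices by the columns themselves.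
  detᶜ-subtract : ∀ {n} {M : Fin n → A → Carrier} {x y z k} →
    (∀ i → M i z ≈ M i x - k * M i y) → ∀ l {xs} → y ∈ xs →
    detᶜ M (l ++ z ∷ xs) ≈ detᶜ M (l ++ x ∷ xs)
  detᶜ-subtract {M = M} {x} {y} {z} {k} Mz l {xs} y∈xs = begin
    detᶜ M (l ++ z ∷ xs)
      ≈⟨ detᶜ-linear Mz l xs ⟩
    detᶜ M (l ++ x ∷ xs) - k * detᶜ M (l ++ y ∷ xs)
      ≈⟨ +-congˡ (-‿cong (trans (*-congˡ (alternating-∈ (alternating-++ l (detᶜ-alternating M)) y∈xs)) (zeroʳ k))) ⟩
    detᶜ M (l ++ x ∷ xs) - 0#
      ≈⟨ trans (+-congˡ -0#≈0#) (+-identityʳ _) ⟩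
    detᶜ M (l ++ x ∷ xs) ∎

  -- Expand along the top row: deleting one of the two leading columns costs a zero entry, and the
  -- remaining columns are reached after two sign changes, that is with sign +. So the pair `x`, `y`
  -- descends unchanged to the last two rows.
  detᶜ-block : ∀ n (M : Fin (n ℕ.+ 2) → A → Carrier) {x y} →
    (∀ i → M (i ↑ˡ 2) x ≈ 0#) → (∀ i → M (i ↑ˡ 2) y ≈ 0#) → ∀ xs → length xs ≡ n →
    detᶜ M (x ∷ y ∷ xs) ≈
    detᶜ (λ i → M (i ↑ˡ 2)) xs *
      (M (n ↑ʳ zero) x * M (n ↑ʳ suc zero) y - M (n ↑ʳ zero) y * M (n ↑ʳ suc zero) x)
  detᶜ-block zero M {x} {y} _ _ [] _ = begin
    p * (s * 1# - 0#) - (q * (r * 1# - 0#) - 0#)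
      ≈⟨ +-cong (drop _ _) (-‿cong (trans (+-congˡ -0#≈0#) (trans (+-identityʳ _) (drop _ _)))) ⟩
    p * s - q * r
      ≈⟨ *-identityˡ _ ⟨
    1# * (p * s - q * r) ∎
    where
    p q r s : Carrier
    p = M zero x
    q = M zero y
    r = M (suc zero) x
    s = M (suc zero) y

    drop : ∀ p s → p * (s * 1# - 0#) ≈ p * s
    drop p s = *-congˡ (trans (+-congˡ -0#≈0#) (trans (+-identityʳ _) (*-identityʳ s)))
  detᶜ-block (suc n) M {x} {y} Mx≈0 My≈0 xs len = begin
    r x * g (y ∷ xs) - (r y * g (x ∷ xs) - laplace (g ∘ (x ∷_) ∘ (y ∷_)) r xs)
      ≈⟨ +-cong (trans (*-congʳ (Mx≈0 zero)) (zeroˡ _))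
           (-‿cong (+-congʳ (trans (*-congʳ (My≈0 zero)) (zeroˡ _)))) ⟩
    0# - (0# - laplace (g ∘ (x ∷_) ∘ (y ∷_)) r xs)
      ≈⟨ solve 2 (λ z l → z :- (z :- l) := l) refl 0# _ ⟩
    laplace (g ∘ (x ∷_) ∘ (y ∷_)) r xs
      ≈⟨ laplace-cong-length xs (λ ys e → detᶜ-block n (M ∘ suc) (Mx≈0 ∘ suc) (My≈0 ∘ suc) ys
           (ℕ.suc-injective (≡.trans e len))) (λ _ → refl) ⟩
    laplace (λ ys → detᶜ (λ i → M (suc i ↑ˡ 2)) ys * k) r xs
      ≈⟨ laplace-*ʳ (detᶜ (λ i → M (suc i ↑ˡ 2))) r k xs ⟩
    detᶜ {n = suc n} (λ i → M (i ↑ˡ 2)) xs * k ∎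
    where
    r = M zero
    g = detᶜ (M ∘ suc)
    k = M (suc n ↑ʳ zero) x * M (suc n ↑ʳ suc zero) y - M (suc n ↑ʳ zero) y * M (suc n ↑ʳ suc zero) x

  sum-neg : ∀ {n} (f : Vector Carrier n) → sum (-_ ∘ f) ≈ - sum f
  sum-neg {zero}  f = sym -0#≈0#
  sum-neg {suc n} f = trans (+-congˡ (sum-neg (f ∘ suc))) (-‿+-comm _ _)

  sum-cong : ∀ {n} {f g : Vector Carrier n} → (∀ i → f i ≈ g i) → sum f ≈ sum g
  sum-cong {zero}  f≈g = refl
  sum-cong {suc n} f≈g = +-cong (f≈g zero) (sum-cong (f≈g ∘ suc))

  laplace-sum : ∀ {n} (g : List A → Carrier) r (v : Fin (suc n) → A) →
    sum (λ j → signed (-1^ toℕ j) (r (v j) * g (tabulate (removeAt v j)))) ≈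
    laplace g r (tabulate v)
  laplace-sum {n = zero}  g r v = +-congˡ (sym -0#≈0#)
  laplace-sum {n = suc n} g r v = +-congˡ (begin
    sum (λ j → signed (-1^ suc (toℕ j)) (w j))
      ≈⟨ sum-cong (λ j → trans (signed-≡ (w j) (-1^-suc (toℕ j))) (signed-opposite (-1^ toℕ j) (w j))) ⟩
    sum (λ j → - signed (-1^ toℕ j) (w j))
      ≈⟨ sum-neg (λ j → signed (-1^ toℕ j) (w j)) ⟩
    - sum (λ j → signed (-1^ toℕ j) (w j))
      ≈⟨ -‿cong (laplace-sum (g ∘ (v zero ∷_)) r (v ∘ suc)) ⟩
    - laplace (g ∘ (v zero ∷_)) r (tabulate (v ∘ suc)) ∎)
    where
    w : Fin (suc n) → Carrier
    w j = r (v (suc j)) * g (v zero ∷ tabulate (removeAt (v ∘ suc) j))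

  det≈detᶜ : ∀ {n} (M : Fin n → Fin n → Carrier) → det M ≈ detᶜ M (allFin n)
  det≈detᶜ {zero}  M = refl
  det≈detᶜ {suc n} M = trans
    (sum-cong λ j → signed-cong (-1^ toℕ j) (*-congˡ {M zero j} (minor j)))
    (laplace-sum (detᶜ (M ∘ suc)) (M zero) id)
    where
    minor : ∀ j → det (λ i → removeAt (M (suc i)) j) ≈ detᶜ (M ∘ suc) (tabulate (removeAt id j))
    minor j = begin
      det (λ i → removeAt (M (suc i)) j)
        ≈⟨ det≈detᶜ (λ i → removeAt (M (suc i)) j) ⟩
      detᶜ (λ i → M (suc i) ∘ punchIn j) (allFin n)
        ≈⟨ detᶜ-map (punchIn j) (M ∘ suc) (allFin n) ⟨
      detᶜ (M ∘ suc) (map (punchIn j) (allFin n))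
        ≡⟨ ≡.cong (detᶜ (M ∘ suc)) (List.map-tabulate id (punchIn j)) ⟩
      detᶜ (M ∘ suc) (tabulate (punchIn j)) ∎

  -- Subtracting `x zero` times each column from the next clears the first row behind its leading 1,
  -- and every other row then gives up the factor `x (suc i) - x zero`. Regularity passes through
  -- this recursion, so the full product of differences is never formed.
  vandermonde-regular : ∀ {n} (x : Vector Carrier n) →
    (∀ i j → i Fin.< j → Regular (x j - x i)) →
    Regular (detᶜ (λ i k → x i ^ k) (tabulate {n = n} toℕ))
  vandermonde-regular {zero}  x reg = Fractions.1-regular R
  vandermonde-regular {suc n} x reg = regular-resp-≈ (sym reduction)
    (*-regular (vandermonde-regular (x ∘ suc) λ i j i<j → reg (suc i) (suc j) (ℕ.s<s i<j))
               (regular-product _ λ i → reg zero (suc i) ℕ.z<s))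
    where
    -- With the columns themselves as indices, every linear combination of columns is available as a
    -- list entry.
    Column : Set _
    Column = Fin (suc n) → Carrier

    entry : Fin (suc n) → Column → Carrier
    entry i z = z i

    Linear : (List Column → Carrier) → Set _
    Linear g = ∀ {x y z k} → (∀ i → entry i z ≈ entry i x - k * entry i y) → ∀ l xs →
               g (l ++ z ∷ xs) ≈ g (l ++ x ∷ xs) - k * g (l ++ y ∷ xs)

    step : (ℕ → Column) → ℕ → Column
    step p k i = p (suc k) i - x zero * p k i

    -- The columns are treated from right to left, so that each subtraction still finds its left
    -- neighbour unmodified.
    reduce : ∀ m (p : ℕ → Column) {g} → Alternating g → Linear g →
             g (p 0 ∷ tabulate {n = m} (p ∘ suc ∘ toℕ)) ≈ g (p 0 ∷ tabulate {n = m} (step p ∘ toℕ))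
    reduce zero    p         alt lin = refl
    reduce (suc m) p {g = g} alt lin = begin
      g (p 0 ∷ p 1 ∷ tabulate {n = m} (λ i → p (2 ℕ.+ toℕ i)))
        ≈⟨ reduce m (p ∘ suc) (alternating-∷ (p 0) alt) (λ lc l → lin lc (p 0 ∷ l)) ⟩
      g (p 0 ∷ p 1 ∷ rest)
        ≈⟨ trans (+-congˡ (-‿cong (trans (*-congˡ (alt .repeat [] (p 0) rest)) (zeroʳ _))))
                 (trans (+-congˡ -0#≈0#) (+-identityʳ _)) ⟨
      g (p 0 ∷ p 1 ∷ rest) - x zero * g (p 0 ∷ p 0 ∷ rest)
        ≈⟨ lin (λ _ → refl) (p 0 ∷ []) rest ⟨
      g (p 0 ∷ step p 0 ∷ rest) ∎
      where
      rest : List Column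
      rest = tabulate {n = m} (step (p ∘ suc) ∘ toℕ)

    power reduced : ℕ → Column
    power   k i = x i ^ k
    reduced     = step power

    reduction : detᶜ (λ i k → x i ^ k) (tabulate {n = suc n} toℕ) ≈
                detᶜ (λ i k → x (suc i) ^ k) (tabulate {n = n} toℕ) * product (λ i → x (suc i) - x zero)
    reduction = begin
      detᶜ (λ i k → x i ^ k) (tabulate {n = suc n} toℕ)
        ≈⟨ detᶜ-map power entry (tabulate {n = suc n} toℕ) ⟨
      detᶜ entry (map power (tabulate {n = suc n} toℕ))
        ≡⟨ ≡.cong (detᶜ entry) (List.map-tabulate {n = suc n} toℕ power) ⟩
      detᶜ entry (power 0 ∷ tabulate {n = n} (power ∘ suc ∘ toℕ))
        ≈⟨ reduce n power (detᶜ-alternating entry) detᶜ-linear ⟩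
      1# * detᶜ (entry ∘ suc) (tabulate {n = n} (reduced ∘ toℕ)) -
        laplace (detᶜ (entry ∘ suc) ∘ (power 0 ∷_)) (entry zero) (tabulate {n = n} (reduced ∘ toℕ))
        ≈⟨ +-cong (*-identityˡ _) (-‿cong (laplace-0ʳ
             (All.tabulate⁺ {n = n} λ i → -‿inverseʳ (x zero ^ suc (toℕ i))))) ⟩
      detᶜ (entry ∘ suc) (tabulate {n = n} (reduced ∘ toℕ)) - 0#
        ≈⟨ trans (+-congˡ -0#≈0#) (+-identityʳ _) ⟩
      detᶜ (entry ∘ suc) (tabulate {n = n} (reduced ∘ toℕ))
        ≡⟨ ≡.cong (detᶜ (entry ∘ suc)) (List.map-tabulate {n = n} toℕ reduced) ⟨
      detᶜ (entry ∘ suc) (map reduced (tabulate {n = n} toℕ))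
        ≈⟨ detᶜ-map reduced (entry ∘ suc) (tabulate {n = n} toℕ) ⟩
      detᶜ (λ i k → reduced k (suc i)) (tabulate {n = n} toℕ)
        ≈⟨ detᶜ-cong (λ i k → solve 3 (λ x y p → x :* p :- y :* p := (x :- y) :* p) refl
             (x (suc i)) (x zero) (x (suc i) ^ k)) (tabulate {n = n} toℕ) ⟩
      detᶜ (λ i k → (x (suc i) - x zero) * x (suc i) ^ k) (tabulate {n = n} toℕ)
        ≈⟨ detᶜ-scale (λ i → x (suc i) - x zero) (λ i k → x (suc i) ^ k) (tabulate {n = n} toℕ) ⟩
      detᶜ (λ i k → x (suc i) ^ k) (tabulate {n = n} toℕ) * product (λ i → x (suc i) - x zero) ∎

-- Inversions

inversions : List (Fin n) → ℕ
inversions []      = 0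
inversions (x ∷ w) = length (filter (Fin._<? x) w) ℕ.+ inversions w

Sorted : List (Fin n) → Set
Sorted = AllPairs Fin._<_

allFin-sorted : ∀ n → Sorted (allFin n)
allFin-sorted n = AllPairs.tabulate⁺-< id

sorted-↭⇒≡ : {xs ys : List (Fin n)} → Sorted xs → Sorted ys → xs ↭ ys → xs ≡ ys
sorted-↭⇒≡ {xs = []}     {[]}     _ _ _ = ≡.refl
sorted-↭⇒≡ {xs = []}     {y ∷ ys} _ _ e = contradiction (↭-length e) λ ()
sorted-↭⇒≡ {xs = x ∷ xs} {[]}     _ _ e = contradiction (↭-length e) λ ()
sorted-↭⇒≡ {xs = x ∷ xs} {y ∷ ys} (x< ∷ sx) (y< ∷ sy) e with Fin.<-cmp x y
... | tri≈ _ ≡.refl _ = ≡.cong (x ∷_) (sorted-↭⇒≡ sx sy (drop-∷ e))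
... | tri< x<y x≢y _ with ∈-resp-↭ e (here ≡.refl)
...   | here x≡y   = contradiction x≡y x≢y
...   | there x∈ys = contradiction (All.lookup y< x∈ys) (Fin.<-asym x<y)
sorted-↭⇒≡ {xs = x ∷ xs} {y ∷ ys} (x< ∷ sx) (y< ∷ sy) e | tri> _ x≢y y<x
  with ∈-resp-↭ (↭-sym e) (here ≡.refl)
...   | here y≡x   = contradiction (≡.sym y≡x) x≢y
...   | there y∈xs = contradiction (All.lookup x< y∈xs) (Fin.<-asym y<x)

unique∧complete⇒↭ : {w : List (Fin n)} → Unique w → (∀ i → i ∈ w) → w ↭ allFin n
unique∧complete⇒↭ {n} unique complete = ∼bag⇒↭ (unique∧set⇒bag unique (Unique.allFin⁺ n)
  (mk⇔ (λ _ → ∈-allFin _) (λ _ → complete _)))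

length-filter-map : ∀ {P : Pred A′ ℓ₁} {Q : Pred A ℓ₂} (P? : Decidable P) (Q? : Decidable Q) (f : A → A′) →
  (∀ x → P (f x) ⇔ Q x) → ∀ xs → length (filter P? (map f xs)) ≡ length (filter Q? xs)
length-filter-map P? Q? f P⇔Q []       = ≡.refl
length-filter-map P? Q? f P⇔Q (x ∷ xs) with P? (f x) | Q? x
... | yes _   | yes _   = ≡.cong suc (length-filter-map P? Q? f P⇔Q xs)
... | no _    | no _    = length-filter-map P? Q? f P⇔Q xs
... | yes pfx | no ¬qx  = contradiction (Equivalence.to (P⇔Q x) pfx) ¬qx
... | no ¬pfx | yes qx  = contradiction (Equivalence.from (P⇔Q x) qx) ¬pfx

inversions-map : ∀ {m n} (f : Fin m → Fin n) → (∀ {i j} → i Fin.< j ⇔ f i Fin.< f j) →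
                 ∀ w → inversions (map f w) ≡ inversions w
inversions-map f mono []      = ≡.refl
inversions-map f mono (x ∷ w) = ≡.cong₂ ℕ._+_
  (length-filter-map (Fin._<? f x) (Fin._<? x) f
    (λ y → mk⇔ (Equivalence.from mono) (Equivalence.to mono)) w)
  (inversions-map f mono w)

count-below : (i : Fin n) → length (filter (Fin._<? i) (allFin n)) ≡ toℕ i
count-below {suc n} zero = ≡.cong length
  (List.filter-none (Fin._<? zero {n}) {xs = allFin (suc n)} (All.tabulate⁺ {f = id} λ _ ()))
count-below {suc n} (suc i) = ≡.cong suc (≡.trans
  (≡.cong (length ∘ filter (Fin._<? suc i)) (≡.sym (List.map-tabulate {n = n} id suc)))
  (≡.trans (length-filter-map (Fin._<? suc i) (Fin._<? i) suc (λ _ → mk⇔ ℕ.s<s⁻¹ ℕ.s<s) (allFin n))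
           (count-below i)))

inversions-sorted : {w : List (Fin n)} → Sorted w → inversions w ≡ 0
inversions-sorted []         = ≡.refl
inversions-sorted (x< ∷ sw) = ≡.cong₂ ℕ._+_
  (≡.cong length (List.filter-none (Fin._<? _) (All.map (λ x<y y<x → Fin.<-asym x<y y<x) x<)))
  (inversions-sorted sw)

module _ {n} {i j : Fin n} {S : List (Fin n)} (sorted : Sorted S) (perm : i ∷ j ∷ S ↭ allFin n) where

  private
    -- The number of entries below `i` is invariant under permutation, and `i` does not count
    -- itself, so its own position in the list is irrelevant.
    countᵢ : length (filter (Fin._<? i) (j ∷ S)) ≡ toℕ i
    countᵢ = begin
      length (filter (Fin._<? i) (j ∷ S))      
        ≡⟨ ≡.cong length (List.filter-reject (Fin._<? i) {x = i} (Fin.<-irrefl ≡.refl)) ⟨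
      length (filter (Fin._<? i) (i ∷ j ∷ S))  ≡⟨ ↭-length (filter-↭ (Fin._<? i) perm) ⟩
      length (filter (Fin._<? i) (allFin n))   ≡⟨ count-below i ⟩
      toℕ i                                    ∎
      where open ≡.≡-Reasoning

    countⱼ : length (filter (Fin._<? j) (i ∷ S)) ≡ toℕ j
    countⱼ = begin
      length (filter (Fin._<? j) (i ∷ S))      
        ≡⟨ ≡.cong length (List.filter-reject (Fin._<? j) {x = j} (Fin.<-irrefl ≡.refl)) ⟨
      length (filter (Fin._<? j) (j ∷ i ∷ S))  
        ≡⟨ ↭-length (filter-↭ (Fin._<? j) (↭-trans (↭-swap j i ↭-refl) perm)) ⟩
      length (filter (Fin._<? j) (allFin n))   ≡⟨ count-below j ⟩
      toℕ j                                    ∎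
      where open ≡.≡-Reasoning

  -- Here `i` is among the entries below `j` but stands in front of `j`, so `j` has only `toℕ j`
  -- minus 1 inversions with `S`. The missing one is the extra sign; when `j` is smaller than `i`
  -- there is none.
  -1^-inversions-< : i Fin.< j → -1^ inversions (i ∷ j ∷ S) ≡ Sign.opposite (-1^ (toℕ i ℕ.+ toℕ j))
  -1^-inversions-< i<j = begin
    -1^ inversions (i ∷ j ∷ S)
      ≡⟨ ≡.cong₂ (λ k l → -1^ (k ℕ.+ (m ℕ.+ l))) countᵢ (inversions-sorted sorted) ⟩
    -1^ (toℕ i ℕ.+ (m ℕ.+ 0))                     ≡⟨ ≡.cong (λ k → -1^ (toℕ i ℕ.+ k)) (ℕ.+-identityʳ m) ⟩
    -1^ (toℕ i ℕ.+ m)                             ≡⟨ Sign.opposite-involutive _ ⟨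
    Sign.opposite (Sign.opposite (-1^ (toℕ i ℕ.+ m))) ≡⟨ ≡.cong Sign.opposite (-1^-suc (toℕ i ℕ.+ m)) ⟨
    Sign.opposite (-1^ suc (toℕ i ℕ.+ m))         ≡⟨ ≡.cong (λ k → Sign.opposite (-1^ k)) (ℕ.+-suc (toℕ i) m) ⟨
    Sign.opposite (-1^ (toℕ i ℕ.+ suc m))
      ≡⟨ ≡.cong (λ k → Sign.opposite (-1^ (toℕ i ℕ.+ k)))
           (≡.trans (≡.sym (≡.cong length (List.filter-accept (Fin._<? j) i<j))) countⱼ) ⟩
    Sign.opposite (-1^ (toℕ i ℕ.+ toℕ j))         ∎
    where
    open ≡.≡-Reasoning
    m : ℕ
    m = length (filter (Fin._<? j) S)

  -1^-inversions-> : j Fin.< i → -1^ inversions (i ∷ j ∷ S) ≡ -1^ (toℕ i ℕ.+ toℕ j)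
  -1^-inversions-> j<i = ≡.cong₂ (λ k l → -1^ (k ℕ.+ l)) countᵢ (≡.trans
    (≡.cong₂ ℕ._+_
      (≡.trans (≡.sym (≡.cong length (List.filter-reject (Fin._<? j) (Fin.<-asym j<i)))) countⱼ)
      (inversions-sorted sorted))
    (ℕ.+-identityʳ _))

1+nC2 : ∀ n → suc n C 2 ≡ n ℕ.+ n C 2
1+nC2 n = ≡.trans (≡.sym (nCk+nC[k+1]≡[n+1]C[k+1] n 1)) (≡.cong (ℕ._+ n C 2) (nC1≡n n))

-- In a decreasing word every pair is inverted. This word is the one formed by the residues of the
-- denominator.
inversions-opposite : ∀ n → inversions (tabulate (opposite {n})) ≡ n C 2
inversions-opposite zero    = ≡.refl
inversions-opposite (suc n) = begin
  length (filter (Fin._<? fromℕ n) (tabulate (inject₁ ∘ opposite {n}))) ℕ.+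
    inversions (tabulate (inject₁ ∘ opposite {n}))
    ≡⟨ ≡.cong₂ ℕ._+_ all-smaller
         (≡.trans (≡.cong inversions (≡.sym (List.map-tabulate {n = n} opposite inject₁)))
                  (inversions-map inject₁ inject₁-mono (tabulate (opposite {n})))) ⟩
  n ℕ.+ inversions (tabulate (opposite {n}))
    ≡⟨ ≡.cong (n ℕ.+_) (inversions-opposite n) ⟩
  n ℕ.+ n C 2
    ≡⟨ 1+nC2 n ⟨
  suc n C 2 ∎
  where
  open ≡.≡-Reasoning

  inject₁-mono : ∀ {i j : Fin n} → i Fin.< j ⇔ inject₁ i Fin.< inject₁ j
  inject₁-mono {i} {j} = mk⇔
    (≡.subst₂ ℕ._<_ (≡.sym (Fin.toℕ-inject₁ i)) (≡.sym (Fin.toℕ-inject₁ j)))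
    (≡.subst₂ ℕ._<_ (Fin.toℕ-inject₁ i) (Fin.toℕ-inject₁ j))

  all-smaller : length (filter (Fin._<? fromℕ n) (tabulate (inject₁ ∘ opposite {n}))) ≡ n
  all-smaller = ≡.trans
    (≡.cong length (List.filter-all (Fin._<? fromℕ n) (All.tabulate⁺ {n = n} λ i →
      ≡.subst₂ ℕ._<_ (≡.sym (Fin.toℕ-inject₁ (opposite i))) (≡.sym (Fin.toℕ-fromℕ n)) (Fin.toℕ<n (opposite i)))))
    (List.length-tabulate (inject₁ ∘ opposite {n}))

-- The constant sign in ε is, up to a minus, the sign that the denominator contributes: C(t+3,2) =
-- (t+2) + (t+1) + t + C(t,2), and together with the summand t this has the parity of 1 + C(t,2).
-1^-triangular : ∀ t → -1^ (t ℕ.+ ((t ℕ.+ 2 ℕ.+ 1) C 2)) ≡ Sign.opposite (-1^ (t C 2))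
-1^-triangular t = begin
  -1^ (t ℕ.+ ((t ℕ.+ 2 ℕ.+ 1) C 2))
    ≡⟨ ≡.cong (λ k → -1^ (t ℕ.+ k C 2)) (≡.trans (ℕ.+-assoc t 2 1) (ℕ.+-comm t 3)) ⟩
  -1^ (t ℕ.+ (3 ℕ.+ t) C 2)
    ≡⟨ ≡.cong (λ k → -1^ (t ℕ.+ k)) (≡.trans (1+nC2 (2 ℕ.+ t)) (≡.cong (2 ℕ.+ t ℕ.+_)
         (≡.trans (1+nC2 (suc t)) (≡.cong (suc t ℕ.+_) (1+nC2 t))))) ⟩
  -1^ (t ℕ.+ (2 ℕ.+ t ℕ.+ (suc t ℕ.+ (t ℕ.+ t C 2))))
    ≡⟨ ≡.cong -1^_ (≡.trans (ℕ.+-suc t _) (≡.cong suc (ℕ.+-suc t _))) ⟩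
  -1^ (t ℕ.+ (t ℕ.+ (suc t ℕ.+ (t ℕ.+ t C 2))))
    ≡⟨ double t _ ⟩
  -1^ (suc t ℕ.+ (t ℕ.+ t C 2))
    ≡⟨ -1^-suc (t ℕ.+ (t ℕ.+ t C 2)) ⟩
  Sign.opposite (-1^ (t ℕ.+ (t ℕ.+ t C 2)))
    ≡⟨ ≡.cong Sign.opposite (double t (t C 2)) ⟩
  Sign.opposite (-1^ (t C 2)) ∎
  where
  open ≡.≡-Reasoning

  double : ∀ m k → -1^ (m ℕ.+ (m ℕ.+ k)) ≡ -1^ k
  double m k = begin
    -1^ (m ℕ.+ (m ℕ.+ k))             ≡⟨ ≡.cong -1^_ (ℕ.+-assoc m m k) ⟨
    -1^ (m ℕ.+ m ℕ.+ k)               ≡⟨ -1^-+ (m ℕ.+ m) k ⟩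
    -1^ (m ℕ.+ m) Sign.* -1^ k        ≡⟨ ≡.cong (Sign._* -1^ k) (≡.trans (-1^-+ m m) (Sign.s*s≡+ (-1^ m))) ⟩
    -1^ k                             ∎

-- The sign of a word by insertion sort

module AlternatingOnFin (R : CommutativeRing c ℓ) where

  open CommutativeRing R hiding (zero)
  open SignAction R
  open SignActionProperties R
  open Determinant R using (Alternating; alternating-∷)
  open Alternating

  -- The sign is claimed for all alternating `g` at once, because the recursion applies it to `g`
  -- with letters already prefixed.
  SortsWithSign : List (Fin n) → ℕ → Set _
  SortsWithSign w k = ∃ λ s → s ↭ w × Sorted s ×
    (∀ {g} → Alternating g → g w ≈ signed (-1^ k) (g s))

  -- As `s` is sorted, `x` is exchanged with exactly the letters below it, so the exchanges count
  -- the inversions that start at `x`.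
  insert : ∀ (x : Fin n) s → Sorted s → All (x ≢_) s →
           SortsWithSign (x ∷ s) (length (filter (Fin._<? x) s))
  insert x []      _         _          = x ∷ [] , ↭-refl , [] ∷ [] , λ _ → refl
  insert x (y ∷ s) (y< ∷ ss) (x≢y ∷ x≢s) with Fin.<-cmp x y
  ... | tri≈ _ x≡y _ = contradiction x≡y x≢y
  ... | tri< x<y _ _ = x ∷ y ∷ s , ↭-refl , (x< ∷ y< ∷ ss) , λ {g} _ →
    signed-≡ (g (x ∷ y ∷ s)) (≡.sym (≡.cong (λ l → -1^ length l)
      (List.filter-none (Fin._<? x) (All.map (λ x<z z<x → Fin.<-asym x<z z<x) x<))))
    where
    x< : All (x Fin.<_) (y ∷ s)
    x< = x<y ∷ All.map (Fin.<-trans x<y) y<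
  ... | tri> _ _ y<x with insert x s ss x≢s
  ...   | s′ , s′↭x∷s , sorted , sign = y ∷ s′
    , ↭-trans (↭-prep y s′↭x∷s) (↭-swap y x ↭-refl)
    , All-resp-↭ (↭-sym s′↭x∷s) (y<x ∷ y<) ∷ sorted
    , λ {g} alt → trans (alt .exchange [] x y s) (trans
        (-‿cong (sign (alternating-∷ y alt)))
        (trans (sym (signed-opposite (-1^ length (filter (Fin._<? x) s)) (g (y ∷ s′))))
          (signed-≡ (g (y ∷ s′)) (≡.trans (≡.sym (-1^-suc (length (filter (Fin._<? x) s))))
            (≡.cong (λ l → -1^ length l) (≡.sym (List.filter-accept (Fin._<? x) y<x)))))))

  sort : ∀ (w : List (Fin n)) → Unique w → SortsWithSign w (inversions w)
  sort []      _          = [] , ↭-refl , [] , λ _ → refl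
  sort (x ∷ w) (x≢w ∷ uw) with sort w uw
  ... | s , s↭w , sorted , sign with insert x s sorted (All-resp-↭ (↭-sym s↭w) x≢w)
  ...   | s′ , s′↭x∷s , sorted′ , sign′ = s′ , ↭-trans s′↭x∷s (↭-prep x s↭w) , sorted′ ,
    λ {g} alt → trans (sign (alternating-∷ x alt)) (trans
      (signed-cong (-1^ inversions w) (sign′ alt))
      (trans (sym (signed-* (-1^ inversions w) (-1^ length (filter (Fin._<? x) s)) (g s′)))
        (signed-≡ (g s′) (≡.trans (Sign.*-comm (-1^ inversions w) (-1^ length (filter (Fin._<? x) s))) (≡.trans
          (≡.cong (λ k → -1^ k Sign.* -1^ inversions w) (↭-length (filter-↭ (Fin._<? x) s↭w)))
          (≡.sym (-1^-+ (length (filter (Fin._<? x) w)) (inversions w))))))))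

  alternating-word : ∀ {g : List (Fin n) → Carrier} → Alternating g → ∀ {w} → w ↭ allFin n → Unique w →
                     g w ≈ signed (-1^ inversions w) (g (allFin n))
  alternating-word {n} {g} alt {w} w↭ unique with sort w unique
  ... | s , s↭w , sorted , sign = trans (sign alt) (signed-cong (-1^ inversions w)
    (reflexive (≡.cong g (sorted-↭⇒≡ sorted (allFin-sorted n) (↭-trans s↭w w↭)))))

module PowerProperties (R : CommutativeRing c ℓ) where

  open CommutativeRing R hiding (zero)
  open SemiringExp semiring using (_^_)

  1^n≈1 : ∀ n → 1# ^ n ≈ 1#
  1^n≈1 zero    = refl
  1^n≈1 (suc n) = trans (*-identityˡ _) (1^n≈1 n)

-- e i stands for the power uⁱ of the variable u of a ring of Laurent polynomials.
module Exponential (R : CommutativeRing c ℓ)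
  (e : ℤ → CommutativeRing.Carrier R)
  (e-+ : ∀ i j → CommutativeRing._≈_ R (e (i ℤ.+ j)) (CommutativeRing._*_ R (e i) (e j)))
  (e-0 : CommutativeRing._≈_ R (e (+ 0)) (CommutativeRing.1# R))
  where

  open CommutativeRing R hiding (zero)
  open RingProperties ring
  open SemiringExp semiring using (_^_)
  open IntegerSolver R
  open SignAction R
  open SignActionProperties R
  open import Relation.Binary.Reasoning.Setoid setoid

  e-≡ : ∀ {i j} → i ≡ j → e i ≈ e j
  e-≡ ≡.refl = refl

  -- For `e = mono` this is `binomial n` by definition; with u = exp(θ/2) it is 2 sinh(nθ/2).
  B : ℤ → Carrier
  B n = e n - e (ℤ.- n)

  B-≡ : ∀ {m n} → m ≡ n → B m ≈ B n
  B-≡ ≡.refl = refl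

  B-neg : ∀ n → B (ℤ.- n) ≈ - B n
  B-neg n = trans (+-congˡ (-‿cong (e-≡ (ℤ.neg-involutive n))))
    (solve 2 (λ p q → q :- p := :- (p :- q)) refl (e n) (e (ℤ.- n)))

  -- `B` is odd. This trades d̃₃ for its absolute value d₃ and is the source of the factor sgn(d̃₃)
  -- in ε.
  B-∣∣ : ∀ n → B n ≈ signed (ℤ.sign n) (B (+ ℤ.∣ n ∣))
  B-∣∣ (+ n)    = refl
  B-∣∣ -[1+ n ] = B-neg (+ suc n)

  e-^ : ∀ i n → e i ^ n ≈ e (i ℤ.* + n)
  e-^ i zero    = sym (trans (e-≡ (ℤ.*-zeroʳ i)) e-0)
  e-^ i (suc n) = begin
    e i * e i ^ n            ≈⟨ *-congˡ (e-^ i n) ⟩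
    e i * e (i ℤ.* + n)      ≈⟨ e-+ _ _ ⟨
    e (i ℤ.+ i ℤ.* + n)      ≈⟨ e-≡ (ℤ.*-suc i (+ n)) ⟨
    e (i ℤ.* + suc n)        ∎

  e-*-B : ∀ i j → e i * B j ≈ e (i ℤ.+ j) - e (i ℤ.- j)
  e-*-B i j = trans (solve 3 (λ p q r → p :* (q :- r) := p :* q :- p :* r) refl (e i) (e j) (e (ℤ.- j)))
    (sym (+-cong (e-+ i j) (-‿cong (e-+ i (ℤ.- j)))))

  -- With z = u², the geometric mean of zⁱ and zʲ is the power of u with exponent i + j; factoring
  -- it out leaves a difference symmetric about 0.
  e-difference : ∀ i j → e (+ 2 ℤ.* i) - e (+ 2 ℤ.* j) ≈ e (i ℤ.+ j) * B (i ℤ.- j)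
  e-difference i j = sym (trans (e-*-B (i ℤ.+ j) (i ℤ.- j))
    (+-cong (e-≡ (sum≡ i j)) (-‿cong (e-≡ (difference≡ i j)))))
    where
    sum≡ : ∀ i j → i ℤ.+ j ℤ.+ (i ℤ.- j) ≡ + 2 ℤ.* i
    sum≡ = solve-∀

    difference≡ : ∀ i j → i ℤ.+ j ℤ.- (i ℤ.- j) ≡ + 2 ℤ.* j
    difference≡ = solve-∀

  e-difference⁻ : ∀ i j → e (ℤ.- + 2 ℤ.* i) - e (ℤ.- + 2 ℤ.* j) ≈ - (e (ℤ.- (i ℤ.+ j)) * B (i ℤ.- j))
  e-difference⁻ i j = begin
    e (ℤ.- + 2 ℤ.* i) - e (ℤ.- + 2 ℤ.* j)
      ≈⟨ +-cong (e-≡ (double i)) (-‿cong (e-≡ (double j))) ⟩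
    e (+ 2 ℤ.* (ℤ.- i)) - e (+ 2 ℤ.* (ℤ.- j))
      ≈⟨ e-difference (ℤ.- i) (ℤ.- j) ⟩
    e (ℤ.- i ℤ.+ ℤ.- j) * B (ℤ.- i ℤ.- ℤ.- j)
      ≈⟨ *-cong (e-≡ (≡.sym (ℤ.neg-distrib-+ i j)))
           (trans (B-≡ (≡.sym (ℤ.neg-distrib-+ i (ℤ.- j)))) (B-neg (i ℤ.- j))) ⟩
    e (ℤ.- (i ℤ.+ j)) * (- B (i ℤ.- j))
      ≈⟨ -‿distribʳ-* _ _ ⟨
    - (e (ℤ.- (i ℤ.+ j)) * B (i ℤ.- j)) ∎
    where
    double : ∀ i → ℤ.- + 2 ℤ.* i ≡ + 2 ℤ.* (ℤ.- i)
    double = solve-∀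

  B³ : (i j k l : ℤ) → Carrier
  B³ i j k l = B (i ℤ.- j) * B (k ℤ.- l) * B (i ℤ.+ j ℤ.- k ℤ.- l)

  -- The row of z and the row of z⁻¹ yield the same two factors `B (i - j)` and `B (k - l)`. What
  -- remains is a power of u with exponent (i + j) - (k + l) minus its inverse: this is where d̃₃
  -- appears.
  minor₂ : ∀ i j k l →
    (e (+ 2 ℤ.* i) - e (+ 2 ℤ.* j)) * (e (ℤ.- + 2 ℤ.* k) - e (ℤ.- + 2 ℤ.* l)) -
    (e (+ 2 ℤ.* k) - e (+ 2 ℤ.* l)) * (e (ℤ.- + 2 ℤ.* i) - e (ℤ.- + 2 ℤ.* j)) ≈
    - B³ i j k l
  minor₂ i j k l = begin
    _ ≈⟨ +-cong (*-cong (e-difference i j) (e-difference⁻ k l))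
                (-‿cong (*-cong (e-difference k l) (e-difference⁻ i j))) ⟩
    e (i ℤ.+ j) * X * - (e (ℤ.- (k ℤ.+ l)) * Y) - e (k ℤ.+ l) * Y * - (e (ℤ.- (i ℤ.+ j)) * X)
      ≈⟨ solve 6 (λ p p′ q q′ x y → p :* x :* (:- (q′ :* y)) :- q :* y :* (:- (p′ :* x)) :=
                                    :- (x :* y :* (p :* q′ :- p′ :* q))) refl
           (e (i ℤ.+ j)) (e (ℤ.- (i ℤ.+ j))) (e (k ℤ.+ l)) (e (ℤ.- (k ℤ.+ l))) X Y ⟩
    - (X * Y * (e (i ℤ.+ j) * e (ℤ.- (k ℤ.+ l)) - e (ℤ.- (i ℤ.+ j)) * e (k ℤ.+ l)))
      ≈⟨ -‿cong (*-congˡ (sym (+-cong (trans (e-≡ (plus i j k l)) (e-+ _ _))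
                                      (-‿cong (trans (e-≡ (minus i j k l)) (e-+ _ _)))))) ⟩
    - B³ i j k l ∎
    where
    X Y : Carrier
    X = B (i ℤ.- j)
    Y = B (k ℤ.- l)

    plus : ∀ i j k l → i ℤ.+ j ℤ.- k ℤ.- l ≡ i ℤ.+ j ℤ.+ ℤ.- (k ℤ.+ l)
    plus = solve-∀

    minus : ∀ i j k l → ℤ.- (i ℤ.+ j ℤ.- k ℤ.- l) ≡ ℤ.- (i ℤ.+ j) ℤ.+ (k ℤ.+ l)
    minus = solve-∀

  module Alternants (t : ℕ) .{{_ : NonZero t}} (y : Vector Carrier t) (y^t≈1 : ∀ i → y i ^ t ≈ 1#)
    (x : Vector Carrier (t ℕ.+ 2)) (x-top : ∀ i → x (i ↑ˡ 2) ≡ y i)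
    (x-u² : x (t ↑ʳ zero) ≡ e (+ 2)) (x-u⁻² : x (t ↑ʳ suc zero) ≡ e (ℤ.- + 2))
    where

    open SemiringExp semiring using (^-homo-*; ^-assocʳ; ^-congˡ; ^-congʳ)
    open PowerProperties R
    open Determinant R
    open AlternatingOnFin R
    open Schur R using (alternant; vandermonde)

    y-^-mod : ∀ i n → y i ^ n ≈ y i ^ (n % t)
    y-^-mod i n = begin
      y i ^ n                                 ≡⟨ ≡.cong (y i ^_) (m≡m%n+[m/n]*n n t) ⟩
      y i ^ (n % t ℕ.+ n / t ℕ.* t)           ≈⟨ ^-homo-* (y i) (n % t) _ ⟩
      y i ^ (n % t) * y i ^ (n / t ℕ.* t)     ≡⟨ ≡.cong (λ k → y i ^ (n % t) * y i ^ k) (ℕ.*-comm (n / t) t) ⟩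
      y i ^ (n % t) * y i ^ (t ℕ.* (n / t))   ≈⟨ *-congˡ (^-assocʳ (y i) t (n / t)) ⟨
      y i ^ (n % t) * (y i ^ t) ^ (n / t)     ≈⟨ *-congˡ (trans (^-congˡ (n / t) (y^t≈1 i)) (1^n≈1 (n / t))) ⟩
      y i ^ (n % t) * 1#                      ≈⟨ *-identityʳ _ ⟩
      y i ^ (n % t)                           ∎

    toℕ-mod : ∀ n → toℕ (n mod t) ≡ n % t
    toℕ-mod n = Fin.toℕ-fromℕ< (m%n<n n t)

    mod-toℕ : ∀ (r : Fin t) → toℕ r mod t ≡ r
    mod-toℕ r = Fin.toℕ-injective (≡.trans (toℕ-mod (toℕ r)) (m<n⇒m%n≡m (Fin.toℕ<n r)))

    power : Fin (t ℕ.+ 2) → ℕ → Carrier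
    power i n = x i ^ n

    W : Fin t → Fin t → Carrier
    W i r = y i ^ toℕ r

    -- The weak hypothesis `a₂ ∈ b₁ ∷ αs` admits a₂ = b₁, as in a class of three. For this reason a₁
    -- is reduced first, against the untouched column of b₁, and b₁ only afterwards against a column
    -- of the tail.
    alternating-columns : ∀ a₁ a₂ b₁ b₂ αs → a₂ ∈ b₁ ∷ αs → b₂ ∈ αs →
      a₁ % t ≡ a₂ % t → b₁ % t ≡ b₂ % t → length αs ≡ t →
      detᶜ power (a₁ ∷ b₁ ∷ αs) ≈ detᶜ W (map (_mod t) αs) * - B³ (+ a₁) (+ a₂) (+ b₁) (+ b₂)
    alternating-columns a₁ a₂ b₁ b₂ αs a₂∈ b₂∈ a₁≡a₂ b₁≡b₂ len = begin
      detᶜ power (a₁ ∷ b₁ ∷ αs)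
        ≈⟨ detᶜ-map col entry (a₁ ∷ b₁ ∷ αs) ⟨
      detᶜ entry (col a₁ ∷ col b₁ ∷ map col αs)
        ≈⟨ detᶜ-subtract {M = entry} {col a₁} {z = v} (λ i → +-congˡ (-‿cong (sym (*-identityˡ (col a₂ i)))))
             [] (∈-map⁺ col a₂∈) ⟨
      detᶜ entry (v ∷ col b₁ ∷ map col αs)
        ≈⟨ detᶜ-subtract {M = entry} {col b₁} {z = w} (λ i → +-congˡ (-‿cong (sym (*-identityˡ (col b₂ i)))))
             (v ∷ []) (∈-map⁺ col b₂∈) ⟨
      detᶜ entry (v ∷ w ∷ map col αs)
        ≈⟨ detᶜ-block t entry (vanishes a₁≡a₂) (vanishes b₁≡b₂) (map col αs) (≡.trans (List.length-map col αs) len) ⟩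
      detᶜ (λ i z → z (i ↑ˡ 2)) (map col αs) *
        (v (t ↑ʳ zero) * w (t ↑ʳ suc zero) - w (t ↑ʳ zero) * v (t ↑ʳ suc zero))
        ≈⟨ *-cong top bottom ⟩
      detᶜ W (map (_mod t) αs) * - B³ (+ a₁) (+ a₂) (+ b₁) (+ b₂) ∎
      where
      Column : Set _
      Column = Fin (t ℕ.+ 2) → Carrier

      entry : Fin (t ℕ.+ 2) → Column → Carrier
      entry i z = z i

      col : ℕ → Column
      col n i = power i n

      v w : Column
      v i = col a₁ i - col a₂ i
      w i = col b₁ i - col b₂ i

      top-entry : ∀ i n → x (i ↑ˡ 2) ^ n ≈ y i ^ (n % t)
      top-entry i n = trans (reflexive (≡.cong (_^ n) (x-top i))) (y-^-mod i n)

      vanishes : ∀ {m n} → m % t ≡ n % t → ∀ i → col m (i ↑ˡ 2) - col n (i ↑ˡ 2) ≈ 0#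
      vanishes {m} {n} m≡n i = trans
        (+-congʳ (trans (top-entry i m) (trans (^-congʳ (y i) m≡n) (sym (top-entry i n)))))
        (-‿inverseʳ _)

      top : detᶜ (λ i z → z (i ↑ˡ 2)) (map col αs) ≈ detᶜ W (map (_mod t) αs)
      top = begin
        detᶜ (λ i z → z (i ↑ˡ 2)) (map col αs)       ≈⟨ detᶜ-map col (λ i z → z (i ↑ˡ 2)) αs ⟩
        detᶜ (λ i n → x (i ↑ˡ 2) ^ n) αs
          ≈⟨ detᶜ-cong (λ i n → trans (top-entry i n) (^-congʳ (y i) (≡.sym (toℕ-mod n)))) αs ⟩
        detᶜ (λ i n → W i (n mod t)) αs              ≈⟨ detᶜ-map (_mod t) W αs ⟨
        detᶜ W (map (_mod t) αs)                     ∎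

      u² : ∀ n → col n (t ↑ʳ zero) ≈ e (+ 2 ℤ.* + n)
      u² n = trans (reflexive (≡.cong (_^ n) x-u²)) (e-^ (+ 2) n)

      u⁻² : ∀ n → col n (t ↑ʳ suc zero) ≈ e (ℤ.- + 2 ℤ.* + n)
      u⁻² n = trans (reflexive (≡.cong (_^ n) x-u⁻²)) (e-^ (ℤ.- + 2) n)

      bottom : v (t ↑ʳ zero) * w (t ↑ʳ suc zero) - w (t ↑ʳ zero) * v (t ↑ʳ suc zero) ≈
               - B³ (+ a₁) (+ a₂) (+ b₁) (+ b₂)
      bottom = trans
        (+-cong (*-cong (+-cong (u² a₁) (-‿cong (u² a₂))) (+-cong (u⁻² b₁) (-‿cong (u⁻² b₂))))
                (-‿cong (*-cong (+-cong (u² b₁) (-‿cong (u² b₂))) (+-cong (u⁻² a₁) (-‿cong (u⁻² a₂))))))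
        (minor₂ (+ a₁) (+ a₂) (+ b₁) (+ b₂))

    -- Two sorting signs occur, one for moving the columns of a₁ and b₁ to the front and one for
    -- ordering the residues of the rest. Since those residues are all of 0, ..., t-1, the
    -- determinant left over does not depend on α and is shared with the denominator.
    alternant-formula : ∀ (α : Vector ℕ (t ℕ.+ 2)) jA₁ jA₂ jB₁ jB₂ S →
      jA₁ ∷ jB₁ ∷ S ↭ allFin (t ℕ.+ 2) → Unique (jA₁ ∷ jB₁ ∷ S) →
      jA₂ ∈ jB₁ ∷ S → jB₂ ∈ S → α jA₁ % t ≡ α jA₂ % t → α jB₁ % t ≡ α jB₂ % t →
      let word = map (λ j → α j mod t) S in
      word ↭ allFin t → Unique word →
      alternant α x ≈ signed (-1^ inversions (jA₁ ∷ jB₁ ∷ S) Sign.* -1^ inversions word)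
        (detᶜ W (allFin t) * - B³ (+ α jA₁) (+ α jA₂) (+ α jB₁) (+ α jB₂))
    alternant-formula α jA₁ jA₂ jB₁ jB₂ S perm unique jA₂∈ jB₂∈ A≡ B≡ permʷ uniqueʷ = begin
      alternant α x
        ≈⟨ det≈detᶜ M ⟩
      detᶜ M (allFin (t ℕ.+ 2))
        ≈⟨ signed-involutive s _ ⟨
      signed s (signed s (detᶜ M (allFin (t ℕ.+ 2))))
        ≈⟨ signed-cong s (alternating-word (detᶜ-alternating M) perm unique) ⟨
      signed s (detᶜ M (jA₁ ∷ jB₁ ∷ S))
        ≈⟨ signed-cong s (sym (detᶜ-map α power (jA₁ ∷ jB₁ ∷ S))) ⟩
      signed s (detᶜ power (α jA₁ ∷ α jB₁ ∷ map α S))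
        ≈⟨ signed-cong s (alternating-columns (α jA₁) (α jA₂) (α jB₁) (α jB₂) (map α S)
             (∈-map⁺ α jA₂∈) (∈-map⁺ α jB₂∈) A≡ B≡ len) ⟩
      signed s (detᶜ W (map (_mod t) (map α S)) * k)
        ≡⟨ ≡.cong (λ l → signed s (detᶜ W l * k)) (List.map-∘ S) ⟨
      signed s (detᶜ W word * k)
        ≈⟨ signed-cong s (trans (*-congʳ (alternating-word (detᶜ-alternating W) permʷ uniqueʷ)) (signed-*ˡ s′ _ k)) ⟩
      signed s (signed s′ (detᶜ W (allFin t) * k))
        ≈⟨ signed-* s s′ _ ⟨
      signed (s Sign.* s′) (detᶜ W (allFin t) * k) ∎
      where
      M : Fin (t ℕ.+ 2) → Fin (t ℕ.+ 2) → Carrier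
      M i j = x i ^ α j

      word : List (Fin t)
      word = map (λ j → α j mod t) S

      k : Carrier
      k = - B³ (+ α jA₁) (+ α jA₂) (+ α jB₁) (+ α jB₂)

      s s′ : Sign
      s  = -1^ inversions (jA₁ ∷ jB₁ ∷ S)
      s′ = -1^ inversions word

      len : length (map α S) ≡ t
      len = ≡.trans (List.length-map α S) (≡.trans (≡.sym (List.length-map (λ j → α j mod t) S))
        (≡.trans (↭-length permʷ) (List.length-tabulate {n = t} id)))

    down : ∀ n → List ℕ
    down n = tabulate {n = n} (toℕ ∘ opposite)

    down-suc : ∀ n → down (suc n) ≡ n ∷ down n
    down-suc n = ≡.cong₂ _∷_ (Fin.toℕ-fromℕ n)
      (List.tabulate-cong {n = n} λ i → Fin.toℕ-inject₁ (opposite i))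

    ∈-down : ∀ {m n} → m ℕ.< n → m ∈ down n
    ∈-down {m} {suc n} m<1+n with m ℕ.≟ n
    ... | yes ≡.refl = ≡.subst (m ∈_) (≡.sym (down-suc n)) (here ≡.refl)
    ... | no m≢n     = ≡.subst (m ∈_) (≡.sym (down-suc n))
      (there (∈-down (ℕ.≤∧≢⇒< (ℕ.s≤s⁻¹ m<1+n) m≢n)))

    vandermonde-formula : 2 ℕ.≤ t → vandermonde x ≈
      signed (-1^ (t C 2)) (detᶜ W (allFin t) * - (B (+ t) * B (+ t) * B (+ 2)))
    vandermonde-formula 2≤t = begin
      vandermonde x
        ≈⟨ det≈detᶜ (λ i j → power i (toℕ (opposite j))) ⟩
      detᶜ (λ i j → power i (toℕ (opposite j))) (allFin (t ℕ.+ 2))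
        ≈⟨ detᶜ-map (toℕ ∘ opposite) power (allFin (t ℕ.+ 2)) ⟨
      detᶜ power (map (toℕ ∘ opposite) (allFin (t ℕ.+ 2)))
        ≡⟨ ≡.cong (detᶜ power) columns ⟩
      detᶜ power (suc t ∷ t ∷ down t)
        -- The congruent pairs are t+1 with 1 and t with 0; `2≤t` places both 1 and 0 in the tail
        -- `down t`.
        ≈⟨ alternating-columns (suc t) 1 t 0 (down t) (there (∈-down 2≤t)) (∈-down (ℕ.<-≤-trans ℕ.z<s 2≤t))
             ([m+n]%n≡m%n 1 t) ([m+n]%n≡m%n 0 t) (List.length-tabulate {n = t} (toℕ ∘ opposite)) ⟩
      detᶜ W (map (_mod t) (down t)) * - B³ (+ suc t) (+ 1) (+ t) (+ 0)
        ≈⟨ *-cong (trans (reflexive (≡.cong (detᶜ W) word≡)) word) (-‿cong (*-cong (*-cong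
             (B-≡ (cancel₁ (+ t))) (B-≡ (ℤ.+-identityʳ (+ t)))) (B-≡ (cancel₂ (+ t))))) ⟩
      signed s (detᶜ W (allFin t)) * - (B (+ t) * B (+ t) * B (+ 2))
        ≈⟨ signed-*ˡ s _ _ ⟩
      signed s (detᶜ W (allFin t) * - (B (+ t) * B (+ t) * B (+ 2))) ∎
      where
      s : Sign
      s = -1^ (t C 2)

      columns : map (toℕ ∘ opposite) (allFin (t ℕ.+ 2)) ≡ suc t ∷ t ∷ down t
      columns = ≡.trans (List.map-tabulate {n = t ℕ.+ 2} id (toℕ ∘ opposite))
        (≡.trans (≡.cong down (ℕ.+-comm t 2))
          (≡.trans (down-suc (suc t)) (≡.cong (suc t ∷_) (down-suc t))))

      word≡ : map (_mod t) (down t) ≡ tabulate opposite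
      word≡ = ≡.trans (List.map-tabulate {n = t} (toℕ ∘ opposite) (_mod t))
        (List.tabulate-cong {n = t} λ i → mod-toℕ (opposite i))

      opposite-unique : Unique (tabulate (opposite {t}))
      opposite-unique = Unique.tabulate⁺ λ {i} {j} eq →
        ≡.trans (≡.sym (Fin.opposite-involutive i)) (≡.trans (≡.cong opposite eq) (Fin.opposite-involutive j))

      word : detᶜ W (tabulate opposite) ≈ signed s (detᶜ W (allFin t))
      word = trans
        (alternating-word (detᶜ-alternating W)
          (unique∧complete⇒↭ opposite-unique λ i →
            ≡.subst (_∈ _) (Fin.opposite-involutive i) (∈-tabulate⁺ (opposite i)))
          opposite-unique)
        (signed-≡ _ (≡.cong -1^_ (inversions-opposite t)))

      cancel₁ : ∀ n → + 1 ℤ.+ n ℤ.- + 1 ≡ n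
      cancel₁ = solve-∀

      cancel₂ : ∀ n → + 1 ℤ.+ n ℤ.+ + 1 ℤ.- n ℤ.- + 0 ≡ + 2
      cancel₂ = solve-∀

-- Residue classes


β-decreasing : ∀ {n} {lam : Vector ℕ n} → IsPartition lam → ∀ {i j} → i Fin.< j → β lam j ℕ.< β lam i
β-decreasing partition {i} {j} i<j = ℕ.+-mono-≤-< (partition i j (ℕ.<⇒≤ i<j))
  (≡.subst₂ ℕ._<_ (≡.sym (Fin.opposite-prop j)) (≡.sym (Fin.opposite-prop i))
    (ℕ.∸-monoʳ-< (ℕ.s<s i<j) (Fin.toℕ<n j)))

sum≡0 : ∀ {n} (m : Vector ℕ n) → sumℕ m ≡ 0 → ∀ i → m i ≡ 0
sum≡0 m eq zero    = ℕ.m+n≡0⇒m≡0 (m zero) eq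
sum≡0 m eq (suc i) = sum≡0 (m ∘ suc) (ℕ.m+n≡0⇒n≡0 (m zero) eq) i

sum≡1 : ∀ {n} (m : Vector ℕ n) → sumℕ m ≡ 1 → ∃ λ i → m i ≡ 1 × (∀ k → k ≢ i → m k ≡ 0)
sum≡1 {suc n} m eq with m zero in m₀
... | 1 = zero , m₀ , λ where
  zero    k≢0 → contradiction ≡.refl k≢0
  (suc k) _   → sum≡0 (m ∘ suc) (ℕ.suc-injective eq) k
... | 0 with sum≡1 (m ∘ suc) eq
...   | i , mᵢ , others = suc i , mᵢ , λ where
  zero    _   → m₀
  (suc k) k≢i → others k (k≢i ∘ ≡.cong suc)

-- Applied to class sizes minus one, the two alternatives are the two configurations; the order
-- `i < j` supplies r_A < r_B.
sum≡2 : ∀ {n} (m : Vector ℕ n) → sumℕ m ≡ 2 →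
  (∃ λ i → m i ≡ 2 × (∀ k → k ≢ i → m k ≡ 0)) ⊎
  (∃₂ λ i j → i Fin.< j × m i ≡ 1 × m j ≡ 1 × (∀ k → k ≢ i → k ≢ j → m k ≡ 0))
sum≡2 {suc n} m eq with m zero in m₀
... | 2 = inj₁ (zero , m₀ , λ where
  zero    k≢0 → contradiction ≡.refl k≢0
  (suc k) _   → sum≡0 (m ∘ suc) (ℕ.suc-injective (ℕ.suc-injective eq)) k)
... | 1 with sum≡1 (m ∘ suc) (ℕ.suc-injective eq)
...   | j , mⱼ , others = inj₂ (zero , suc j , ℕ.z<s , m₀ , mⱼ , λ where
  zero    k≢0 _   → contradiction ≡.refl k≢0
  (suc k) _   k≢j → others k (k≢j ∘ ≡.cong suc))
sum≡2 {suc n} m eq | 0 with sum≡2 (m ∘ suc) eq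
...   | inj₁ (i , mᵢ , others) = inj₁ (suc i , mᵢ , λ where
  zero    _   → m₀
  (suc k) k≢i → others k (k≢i ∘ ≡.cong suc))
...   | inj₂ (i , j , i<j , mᵢ , mⱼ , others) = inj₂ (suc i , suc j , ℕ.s<s i<j , mᵢ , mⱼ , λ where
  zero    _   _   → m₀
  (suc k) k≢i k≢j → others k (k≢i ∘ ≡.cong suc) (k≢j ∘ ≡.cong suc))

sum-ones : ∀ n → sumℕ {n} (λ _ → 1) ≡ n
sum-ones zero    = ≡.refl
sum-ones (suc n) = ≡.cong suc (sum-ones n)

sum-indicator : ∀ {n} (r : Fin n) → sumℕ (λ i → if does (r Fin.≟ i) then 1 else 0) ≡ 1
sum-indicator {suc n} zero    = ≡.cong suc (sum-replicate-zero n)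
sum-indicator {suc n} (suc r) = sum-indicator r

sum-fibres : ∀ {A : Set} {n} (f : A → Fin n) xs →
             sumℕ (λ i → length (filter (λ x → f x Fin.≟ i) xs)) ≡ length xs
sum-fibres {n = n} f []       = sum-replicate-zero n
sum-fibres {n = n} f (x ∷ xs) = begin
  sumℕ (λ i → length (filter (λ x → f x Fin.≟ i) (x ∷ xs)))
    ≡⟨ sum-cong-≗ split ⟩
  sumℕ (λ i → (if does (f x Fin.≟ i) then 1 else 0) ℕ.+ length (filter (λ x → f x Fin.≟ i) xs))
    ≡⟨ ∑-distrib-+ (λ i → if does (f x Fin.≟ i) then 1 else 0) _ ⟩
  sumℕ (λ i → if does (f x Fin.≟ i) then 1 else 0) ℕ.+ sumℕ (λ i → length (filter (λ x → f x Fin.≟ i) xs))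
    ≡⟨ ≡.cong₂ ℕ._+_ (sum-indicator (f x)) (sum-fibres f xs) ⟩
  suc (length xs) ∎
  where
  open ≡.≡-Reasoning

  split : ∀ i → length (filter (λ x → f x Fin.≟ i) (x ∷ xs)) ≡
          (if does (f x Fin.≟ i) then 1 else 0) ℕ.+ length (filter (λ x → f x Fin.≟ i) xs)
  split i with f x Fin.≟ i
  ... | yes _ = ≡.refl
  ... | no  _ = ≡.refl

module ResidueProperties (t : ℕ) (2≤t : 2 ℕ.≤ t) (lam : Vector ℕ (t ℕ.+ 2)) where

  open Residues t 2≤t lam

  ∈-class⁺ : ∀ {i j} → residue j ≡ i → j ∈ class i
  ∈-class⁺ {i} {j} e = ∈-filter⁺ (λ j → residue j Fin.≟ i) (∈-allFin j) e

  ∈-class⁻ : ∀ {i j} → j ∈ class i → residue j ≡ i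
  ∈-class⁻ {i} j∈ = proj₂ (∈-filter⁻ (λ j → residue j Fin.≟ i) {xs = allFin N} j∈)

  class-sorted : ∀ i → Sorted (class i)
  class-sorted i = AllPairs.filter⁺ (λ j → residue j Fin.≟ i) (allFin-sorted N)

  residue-% : ∀ {j k} → residue j ≡ residue k → β lam j % t ≡ β lam k % t
  residue-% {j} {k} e = ≡.trans (≡.sym (Fin.toℕ-fromℕ< (m%n<n (β lam j) t)))
    (≡.trans (≡.cong toℕ e) (Fin.toℕ-fromℕ< (m%n<n (β lam k) t)))

  -- One column in each of the t classes uses up t of the t + 2 columns, so the excess over one per
  -- class sums to 2.
  configuration : (∀ i → ∃ λ j → residue j ≡ i) → Configuration
  configuration surjective = from-excess (sum≡2 excess sum-excess)
    where
    excess : Vector ℕ t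
    excess i = ℕ.pred (length (class i))

    size≡1+excess : ∀ i → length (class i) ≡ suc (excess i)
    size≡1+excess i with class i | ∈-class⁺ (proj₂ (surjective i))
    ... | _ ∷ _ | _ = ≡.refl

    sum-excess : sumℕ excess ≡ 2
    sum-excess = ℕ.+-cancelˡ-≡ t _ _ (begin
      t ℕ.+ sumℕ excess                       ≡⟨ ≡.cong (ℕ._+ sumℕ excess) (sum-ones t) ⟨
      sumℕ {t} (λ _ → 1) ℕ.+ sumℕ excess       ≡⟨ ∑-distrib-+ {t} (λ _ → 1) excess ⟨
      sumℕ (λ i → suc (excess i))             ≡⟨ sum-cong-≗ size≡1+excess ⟨
      sumℕ (λ i → length (class i))           ≡⟨ sum-fibres residue (allFin N) ⟩
      length (allFin N)                      ≡⟨ List.length-tabulate {n = N} id ⟩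
      t ℕ.+ 2                                ∎)
      where open ≡.≡-Reasoning

    size : ∀ i {k} → excess i ≡ k → length (class i) ≡ suc k
    size i e = ≡.trans (size≡1+excess i) (≡.cong suc e)

    two : ∀ {xs : List (Fin N)} → length xs ≡ 2 → ∃₂ λ j k → xs ≡ j ∷ k ∷ []
    two {j ∷ k ∷ []} _ = j , k , ≡.refl

    three : ∀ {xs : List (Fin N)} → length xs ≡ 3 → ∃ λ j → ∃₂ λ k l → xs ≡ j ∷ k ∷ l ∷ []
    three {j ∷ k ∷ l ∷ []} _ = j , k , l , ≡.refl

    from-excess : _ → Configuration
    from-excess (inj₁ (r , excessʳ , others)) with three (size r excessʳ)
    ... | j-p , j-q , j-r , class≡ = triple r j-p j-q j-r class≡ λ i i≢r → size i (others i i≢r)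
    from-excess (inj₂ (r-A , r-B , r-A<r-B , excessᴬ , excessᴮ , others))
      with two (size r-A excessᴬ) | two (size r-B excessᴮ)
    ... | j-A₁ , j-A₂ , class-A | j-B₁ , j-B₂ , class-B =
      twoPairs r-A r-B j-A₁ j-A₂ j-B₁ j-B₂ r-A<r-B class-A class-B
        λ i i≢r-A i≢r-B → size i (others i i≢r-A i≢r-B)

  module _ (cfg : Configuration) where

    -- The properties common to both configurations, so that the case distinction is made once.
    -- Inequality of `jA₂` and `jB₁` is not among them: for a class of three these columns coincide.
    record Separated : Set where
      field
        A₁<A₂      : jA₁ cfg Fin.< jA₂ cfg
        B₁<B₂      : jB₁ cfg Fin.< jB₂ cfg
        A₁≢B₁      : jA₁ cfg ≢ jB₁ cfg
        A₁≢B₂      : jA₁ cfg ≢ jB₂ cfg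
        residue-A  : residue (jA₁ cfg) ≡ residue (jA₂ cfg)
        residue-B  : residue (jB₁ cfg) ≡ residue (jB₂ cfg)
        separates  : ∀ {j k} → j ≢ jA₁ cfg → j ≢ jB₁ cfg → k ≢ jA₁ cfg → k ≢ jB₁ cfg →
                     residue j ≡ residue k → j ≡ k
        covers     : ∀ i → ∃ λ j → j ≢ jA₁ cfg × j ≢ jB₁ cfg × residue j ≡ i

  private
    class≡⁻ : ∀ {i j js} → class i ≡ js → j ∈ js → residue j ≡ i
    class≡⁻ ≡.refl = ∈-class⁻

    class≡⁺ : ∀ {i j js} → class i ≡ js → residue j ≡ i → j ∈ js
    class≡⁺ ≡.refl = ∈-class⁺

    class≡-sorted : ∀ {i js} → class i ≡ js → Sorted js
    class≡-sorted {i} ≡.refl = class-sorted i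

    singleton : ∀ {js : List (Fin N)} {j k} → length js ≡ 1 → j ∈ js → k ∈ js → j ≡ k
    singleton {_ ∷ []} _ (here e) (here e′) = ≡.trans e (≡.sym e′)

    inhabited : ∀ {js : List (Fin N)} → length js ≡ 1 → ∃ (_∈ js)
    inhabited {j ∷ []} _ = j , here ≡.refl

    same-class : ∀ {i j k} → length (class i) ≡ 1 → residue j ≡ residue k → residue k ≡ i → j ≡ k
    same-class len j≡k k≡i = singleton len (∈-class⁺ (≡.trans j≡k k≡i)) (∈-class⁺ k≡i)

    select : ∀ {j k l : Fin N} → l ∈ j ∷ k ∷ [] → l ≢ j → l ≡ k
    select (here e)         l≢j = contradiction e l≢j
    select (there (here e)) _   = e

    select₃ : ∀ {j k l m : Fin N} → m ∈ j ∷ k ∷ l ∷ [] → m ≢ j → m ≢ k → m ≡ l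
    select₃ (here e)  m≢j _   = contradiction e m≢j
    select₃ (there m∈) _  m≢k = select m∈ m≢k

  -- Removing `jA₁` and `jB₁` leaves exactly one column in every class: uniqueness is `separates`,
  -- existence is `covers`.
  separated : ∀ cfg → Separated cfg
  separated (twoPairs r-A r-B j-A₁ j-A₂ j-B₁ j-B₂ r-A<r-B class-A class-B others)
    with class≡-sorted class-A | class≡-sorted class-B
  ... | (A₁<A₂ ∷ []) ∷ _ | (B₁<B₂ ∷ []) ∷ _ = record
    { A₁<A₂     = A₁<A₂
    ; B₁<B₂     = B₁<B₂
    ; A₁≢B₁     = λ e → apart (≡.trans (≡.sym A₁) (≡.trans (≡.cong residue e) B₁))
    ; A₁≢B₂     = λ e → apart (≡.trans (≡.sym A₁) (≡.trans (≡.cong residue e) B₂))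
    ; residue-A = ≡.trans A₁ (≡.sym A₂)
    ; residue-B = ≡.trans B₁ (≡.sym B₂)
    ; separates = sep
    ; covers    = cov
    }
    where
    apart : r-A ≢ r-B
    apart = Fin.<⇒≢ r-A<r-B

    A₁ : residue j-A₁ ≡ r-A
    A₁ = class≡⁻ class-A (here ≡.refl)
    A₂ : residue j-A₂ ≡ r-A
    A₂ = class≡⁻ class-A (there (here ≡.refl))
    B₁ : residue j-B₁ ≡ r-B
    B₁ = class≡⁻ class-B (here ≡.refl)
    B₂ : residue j-B₂ ≡ r-B
    B₂ = class≡⁻ class-B (there (here ≡.refl))

    sep : ∀ {j k} → j ≢ j-A₁ → j ≢ j-B₁ → k ≢ j-A₁ → k ≢ j-B₁ → residue j ≡ residue k → j ≡ k
    sep {j} {k} j≢A₁ j≢B₁ k≢A₁ k≢B₁ j≡k with residue k Fin.≟ r-A | residue k Fin.≟ r-B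
    ... | yes k≡A | _ = ≡.trans (select (class≡⁺ class-A (≡.trans j≡k k≡A)) j≢A₁)
                                (≡.sym (select (class≡⁺ class-A k≡A) k≢A₁))
    ... | no _ | yes k≡B = ≡.trans (select (class≡⁺ class-B (≡.trans j≡k k≡B)) j≢B₁)
                                   (≡.sym (select (class≡⁺ class-B k≡B) k≢B₁))
    ... | no k≢A | no k≢B = same-class (others _ k≢A k≢B) j≡k ≡.refl

    cov : ∀ i → ∃ λ j → j ≢ j-A₁ × j ≢ j-B₁ × residue j ≡ i
    cov i with i Fin.≟ r-A | i Fin.≟ r-B
    ... | yes ≡.refl | _ = j-A₂ , Fin.<⇒≢ A₁<A₂ ∘ ≡.sym ,
      (λ e → apart (≡.trans (≡.sym A₂) (≡.trans (≡.cong residue e) B₁))) , A₂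
    ... | no _ | yes ≡.refl = j-B₂ ,
      (λ e → apart (≡.trans (≡.sym A₁) (≡.trans (≡.cong residue (≡.sym e)) B₂))) ,
      Fin.<⇒≢ B₁<B₂ ∘ ≡.sym , B₂
    ... | no i≢A | no i≢B with inhabited (others i i≢A i≢B)
    ...   | j , j∈ = j , (λ { ≡.refl → i≢A (≡.trans (≡.sym (∈-class⁻ j∈)) A₁) })
                       , (λ { ≡.refl → i≢B (≡.trans (≡.sym (∈-class⁻ j∈)) B₁) }) , ∈-class⁻ j∈
  separated (triple r j-p j-q j-r class-r others) with class≡-sorted class-r
  ... | (p<q ∷ p<r ∷ []) ∷ (q<r ∷ []) ∷ _ = record
    { A₁<A₂     = p<q
    ; B₁<B₂     = q<r
    ; A₁≢B₁     = Fin.<⇒≢ p<q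
    ; A₁≢B₂     = Fin.<⇒≢ p<r
    ; residue-A = ≡.trans P (≡.sym Q)
    ; residue-B = ≡.trans Q (≡.sym R)
    ; separates = sep
    ; covers    = cov
    }
    where
    P : residue j-p ≡ r
    P = class≡⁻ class-r (here ≡.refl)
    Q : residue j-q ≡ r
    Q = class≡⁻ class-r (there (here ≡.refl))
    R : residue j-r ≡ r
    R = class≡⁻ class-r (there (there (here ≡.refl)))

    sep : ∀ {j k} → j ≢ j-p → j ≢ j-q → k ≢ j-p → k ≢ j-q → residue j ≡ residue k → j ≡ k
    sep {j} {k} j≢p j≢q k≢p k≢q j≡k with residue k Fin.≟ r
    ... | yes k≡r = ≡.trans (select₃ (class≡⁺ class-r (≡.trans j≡k k≡r)) j≢p j≢q)
                            (≡.sym (select₃ (class≡⁺ class-r k≡r) k≢p k≢q))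
    ... | no k≢r = same-class (others _ k≢r) j≡k ≡.refl

    cov : ∀ i → ∃ λ j → j ≢ j-p × j ≢ j-q × residue j ≡ i
    cov i with i Fin.≟ r
    ... | yes ≡.refl = j-r , Fin.<⇒≢ p<r ∘ ≡.sym , Fin.<⇒≢ q<r ∘ ≡.sym , R
    ... | no i≢r with inhabited (others i i≢r)
    ...   | j , j∈ = j , (λ { ≡.refl → i≢r (≡.trans (≡.sym (∈-class⁻ j∈)) P) })
                       , (λ { ≡.refl → i≢r (≡.trans (≡.sym (∈-class⁻ j∈)) Q) }) , ∈-class⁻ j∈

  module _ (cfg : Configuration) where

    open Separated (separated cfg)

    private
      outside? = λ j → ¬? (j Fin.≟ jA₁ cfg) ×-dec ¬? (j Fin.≟ jB₁ cfg)

    ∈-S⁺ : ∀ {j} → j ≢ jA₁ cfg → j ≢ jB₁ cfg → j ∈ S cfg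
    ∈-S⁺ {j} ≢A ≢B = ∈-filter⁺ outside? (∈-allFin j) (≢A , ≢B)

    ∈-S⁻ : ∀ {j} → j ∈ S cfg → j ≢ jA₁ cfg × j ≢ jB₁ cfg
    ∈-S⁻ j∈ = proj₂ (∈-filter⁻ outside? {xs = allFin N} j∈)

    S-sorted : Sorted (S cfg)
    S-sorted = AllPairs.filter⁺ outside? (allFin-sorted N)

    S-unique : Unique (S cfg)
    S-unique = AllPairs.filter⁺ outside? (Unique.allFin⁺ N)

    columns-unique : Unique (jA₁ cfg ∷ jB₁ cfg ∷ S cfg)
    columns-unique = (A₁≢B₁ ∷ All.tabulate (λ j∈ e → proj₁ (∈-S⁻ j∈) (≡.sym e)))
      ∷ All.tabulate (λ j∈ e → proj₂ (∈-S⁻ j∈) (≡.sym e)) ∷ S-unique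

    columns-↭ : jA₁ cfg ∷ jB₁ cfg ∷ S cfg ↭ allFin N
    columns-↭ = unique∧complete⇒↭ columns-unique complete
      where
      complete : ∀ j → j ∈ jA₁ cfg ∷ jB₁ cfg ∷ S cfg
      complete j with j Fin.≟ jA₁ cfg | j Fin.≟ jB₁ cfg
      ... | yes e | _     = here e
      ... | no _  | yes e = there (here e)
      ... | no ≢A | no ≢B = there (there (∈-S⁺ ≢A ≢B))

    jA₂∈ : jA₂ cfg ∈ jB₁ cfg ∷ S cfg
    jA₂∈ with jA₂ cfg Fin.≟ jB₁ cfg
    ... | yes e = here e
    ... | no ≢B = there (∈-S⁺ (Fin.<⇒≢ A₁<A₂ ∘ ≡.sym) ≢B)

    jB₂∈ : jB₂ cfg ∈ S cfg
    jB₂∈ = ∈-S⁺ (A₁≢B₂ ∘ ≡.sym) (Fin.<⇒≢ B₁<B₂ ∘ ≡.sym)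

    word-unique : Unique (map residue (S cfg))
    word-unique = unique-map S-unique (λ j∈ → j∈)
      where
      unique-map : ∀ {js} → Unique js → (∀ {j} → j ∈ js → j ∈ S cfg) → Unique (map residue js)
      unique-map []            _  = []
      unique-map (j≢js ∷ ujs) ⊆S = All.map⁺ (All.tabulate λ k∈ e → All.lookup j≢js k∈
        (let ≢A , ≢B = ∈-S⁻ (⊆S (here ≡.refl)) ; ≢A′ , ≢B′ = ∈-S⁻ (⊆S (there k∈))
         in separates ≢A ≢B ≢A′ ≢B′ e)) ∷ unique-map ujs (⊆S ∘ there)

    word-↭ : map residue (S cfg) ↭ allFin t
    word-↭ = unique∧complete⇒↭ word-unique λ i →
      let j , ≢A , ≢B , e = covers i in ≡.subst (_∈ _) e (∈-map⁺ residue (∈-S⁺ ≢A ≢B))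

    inv≡inversions : ∀ w → inv cfg w ≡ inversions w
    inv≡inversions []      = ≡.refl
    inv≡inversions (x ∷ w) = ≡.cong (length (filter (Fin._<? x) w) ℕ.+_) (inv≡inversions w)

-- Irreducible sl₂-modules

module SumProperties (R : CommutativeRing c ℓ) where

  open CommutativeRing R hiding (zero)
  open RawMonoidOps +-rawMonoid using (sum)

  sum-0 : ∀ {n} {f : Vector Carrier n} → (∀ k → f k ≈ 0#) → sum f ≈ 0#
  sum-0 {zero}  f≈0 = refl
  sum-0 {suc n} f≈0 = trans (+-cong (f≈0 zero) (sum-0 (f≈0 ∘ suc))) (+-identityˡ 0#)

  sum-single : ∀ {n} {f : Vector Carrier n} i → (∀ k → k ≢ i → f k ≈ 0#) → sum f ≈ f i
  sum-single zero    f≈0 = trans (+-congˡ (sum-0 λ k → f≈0 (suc k) λ ())) (+-identityʳ _)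
  sum-single (suc i) f≈0 = trans (+-cong (f≈0 zero λ ())
    (sum-single i λ k k≢i → f≈0 (suc k) (k≢i ∘ Fin.suc-injective))) (+-identityˡ _)

  sum-singleˡ : ∀ {n} (f g : Vector Carrier n) i → (∀ k → k ≢ i → f k ≈ 0#) →
                sum (λ k → f k * g k) ≈ f i * g i
  sum-singleˡ f g i f≈0 = sum-single i λ k k≢i → trans (*-congʳ (f≈0 k k≢i)) (zeroˡ _)

  sum-singleʳ : ∀ {n} (f g : Vector Carrier n) i → (∀ k → k ≢ i → g k ≈ 0#) →
                sum (λ k → f k * g k) ≈ f i * g i
  sum-singleʳ f g i g≈0 = sum-single i λ k k≢i → trans (*-congˡ (g≈0 k k≢i)) (zeroʳ _)

module FieldUnits (K : HeytingField c ℓ₁ ℓ₂) where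

  open HeytingField K using (heytingCommutativeRing; #⇒invertible; #-irrefl; _#_)

  R : CommutativeRing c ℓ₁
  R = HeytingCommutativeRing.commutativeRing heytingCommutativeRing

  open CommutativeRing R hiding (zero)
  open RingProperties ring
  open SemiringExp semiring using (_^_; ^-homo-*)
  open IntegerSolver R

  -- An explicit inverse is carried along in place of apartness from 0, so that later cancellations
  -- are plain multiplications.
  Unit : Carrier → Set _
  Unit x = ∃ λ y → y * x ≈ 1#

  unit-resp-≈ : ∀ {x y} → x ≈ y → Unit x → Unit y
  unit-resp-≈ x≈y (z , zx≈1) = z , trans (*-congˡ (sym x≈y)) zx≈1

  unit-* : ∀ {x y} → Unit x → Unit y → Unit (x * y)
  unit-* {x} {y} (x⁻¹ , ex) (y⁻¹ , ey) = x⁻¹ * y⁻¹ , trans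
    (solve 4 (λ p q x y → p :* q :* (x :* y) := p :* x :* (q :* y)) refl x⁻¹ y⁻¹ x y)
    (trans (*-cong ex ey) (*-identityˡ 1#))

  #0⇒unit : ∀ {x} → x # 0# → Unit x
  #0⇒unit x#0 = unit-resp-≈ (trans (+-congˡ -0#≈0#) (+-identityʳ _))
    (let y , yx≈1 , _ = #⇒invertible x#0 in y , yx≈1)

  #⇒unit : ∀ {x y} → x # y → Unit (x - y)
  #⇒unit x#y = let z , z[x-y]≈1 , _ = #⇒invertible x#y in z , z[x-y]≈1

  unit-cancel : ∀ {x} → Unit x → ∀ y → x * y ≈ 0# → y ≈ 0#
  unit-cancel {x} (z , zx≈1) y xy≈0 = trans (sym (*-identityˡ y)) (trans (*-congʳ (sym zx≈1))
    (trans (*-assoc z x y) (trans (*-congˡ xy≈0) (zeroʳ z))))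

  2-cancel : CharacteristicZero K → ∀ x → x + x ≈ 0# → x ≈ 0#
  2-cancel char0 x 2x≈0 = unit-cancel (#0⇒unit (char0 1)) x (trans
    -- `char0 1` is about the literal unfolding 1 + (1 + 0); the variables `o` and `z` stand for 1
    -- and 0.
    (solve 3 (λ o z x → (o :+ (o :+ z)) :* x := o :* x :+ o :* x :+ z :* x) refl 1# 0# x)
    (trans (+-cong (+-cong (*-identityˡ x) (*-identityˡ x)) (zeroˡ x)) (trans (+-identityʳ _) 2x≈0)))

  1≉0 : CharacteristicZero K → ¬ (1# ≈ 0#)
  1≉0 char0 1≈0 = #-irrefl (trans (+-identityʳ 1#) 1≈0) (char0 0)

  -- Factor out `ζ ^ i`, whose inverse is `ζ ^ (t - i)`. The other factor `ζ ^ (j - i) - 1` is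
  -- invertible because 0 < j - i < t and ζ is primitive.
  root-difference-unit : ∀ {t ζ} → IsPrimitiveRoot K t ζ → ∀ {i j} → i ℕ.< j → j ℕ.< t →
                         Unit (ζ ^ j - ζ ^ i)
  root-difference-unit {t} {ζ} (ζ^t≈1 , ζ^k#1) {i} {j} i<j j<t = unit-resp-≈ factor
    (unit-* (ζ ^ (t ℕ.∸ i) , trans (sym (^-homo-* ζ (t ℕ.∸ i) i))
               (trans (reflexive (≡.cong (ζ ^_) (ℕ.m∸n+n≡m (ℕ.<⇒≤ (ℕ.<-trans i<j j<t))))) ζ^t≈1))
            (#⇒unit (ζ^k#1 (j ℕ.∸ i) (ℕ.m<n⇒0<n∸m i<j) (ℕ.≤-<-trans (ℕ.m∸n≤m j i) j<t))))
    where
    factor : ζ ^ i * (ζ ^ (j ℕ.∸ i) - 1#) ≈ ζ ^ j - ζ ^ i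
    factor = trans
      (solve 3 (λ x y o → x :* (y :- o) := x :* y :- x :* o) refl (ζ ^ i) (ζ ^ (j ℕ.∸ i)) 1#)
      (+-cong (trans (sym (^-homo-* ζ i (j ℕ.∸ i)))
                     (reflexive (≡.cong (ζ ^_) (ℕ.m+[n∸m]≡n (ℕ.<⇒≤ i<j)))))
              (-‿cong (*-identityʳ _)))

module IrreducibleModules (K : HeytingField c ℓ₁ ℓ₂) (char0 : CharacteristicZero K) where

  open HeytingField K using (_#_)
  open FieldUnits K
  open Sl₂ K
  open CommutativeRing R hiding (zero)
  open SemiringMult semiring using () renaming (_×_ to _×̇_)
  open RawMonoidOps +-rawMonoid using (sum)
  open IntegerSolver R
  open SumProperties R
  open import Relation.Binary.Reasoning.Setoid setoid

  fromℤ≡⟦⟧ : ∀ i → fromℤ i ≡ ⟦ i ⟧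
  fromℤ≡⟦⟧ (+ n)    = ≡.refl
  fromℤ≡⟦⟧ -[1+ n ] = ≡.refl

  fromℤ-+ : ∀ i j → fromℤ (i ℤ.+ j) ≈ fromℤ i + fromℤ j
  fromℤ-+ i j rewrite fromℤ≡⟦⟧ (i ℤ.+ j) | fromℤ≡⟦⟧ i | fromℤ≡⟦⟧ j = +-homo i j

  fromℤ-neg : ∀ i → fromℤ (ℤ.- i) ≈ - fromℤ i
  fromℤ-neg i rewrite fromℤ≡⟦⟧ (ℤ.- i) | fromℤ≡⟦⟧ i = -‿homo i

  fromℤ-- : ∀ i j → fromℤ (i ℤ.- j) ≈ fromℤ i - fromℤ j
  fromℤ-- i j = trans (fromℤ-+ i (ℤ.- j)) (+-congˡ (fromℤ-neg j))

  unit-ℕ : ∀ n → n ≢ 0 → Unit (n ×̇ 1#)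
  unit-ℕ zero    n≢0 = contradiction ≡.refl n≢0
  unit-ℕ (suc n) n≢0 = #0⇒unit (char0 n)

  unit-ℤ : ∀ i → i ≢ + 0 → Unit (fromℤ i)
  unit-ℤ (+ n)    i≢0 = unit-ℕ n (λ e → i≢0 (≡.cong (λ m → + m) e))
  unit-ℤ -[1+ n ] i≢0 = let y , e = unit-ℕ (suc n) (λ ()) in
    - y , trans (solve 2 (λ y x → (:- y) :* (:- x) := y :* x) refl y (suc n ×̇ 1#)) e

  private
    when-true : ∀ {b} {x : Carrier} → b ≡ true → (if b then x else 0#) ≈ x
    when-true ≡.refl = refl

    when-false : ∀ {b} {x : Carrier} → b ≡ false → (if b then x else 0#) ≈ 0#
    when-false ≡.refl = refl

  sum-diagonal : ∀ {n} (w : Vector ℤ n) i (f : Vector Carrier n) →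
                 sum (λ k → diagonal w i k * f k) ≈ fromℤ (w i) * f i
  sum-diagonal w i f = trans
    (sum-singleˡ (diagonal w i) f i λ k k≢i → when-false (dec-false (i Fin.≟ k) (k≢i ∘ ≡.sym)))
    (*-congʳ (when-true (dec-true (i Fin.≟ i) ≡.refl)))

  sum-diagonalʳ : ∀ {n} (w : Vector ℤ n) j (f : Vector Carrier n) →
                  sum (λ k → f k * diagonal w k j) ≈ f j * fromℤ (w j)
  sum-diagonalʳ w j f = trans
    (sum-singleʳ f (λ k → diagonal w k j) j λ k k≢j → when-false (dec-false (k Fin.≟ j) k≢j))
    (*-congˡ (when-true (dec-true (j Fin.≟ j) ≡.refl)))

  module _ (k : ℕ) where

    weight : Vector ℤ (suc k)
    weight i = + k ℤ.- + 2 ℤ.* + toℕ i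

    -- The basis is vⱼ = Fʲ v₀ / j! for a highest weight vector v₀ of weight k: F sends vⱼ to (j+1)
    -- times the next vector, E sends it to (k-j+1) times the previous one. Columns index the
    -- source.
    E F : Matrix (suc k)
    E i j = if does (toℕ j ℕ.≟ suc (toℕ i)) then (k ℕ.∸ toℕ i) ×̇ 1# else 0#
    F i j = if does (toℕ i ℕ.≟ suc (toℕ j)) then toℕ i ×̇ 1# else 0#

    E-on : ∀ {i j} → toℕ j ≡ suc (toℕ i) → E i j ≈ (k ℕ.∸ toℕ i) ×̇ 1#
    E-on {i} {j} e = when-true (dec-true (toℕ j ℕ.≟ suc (toℕ i)) e)

    E-off : ∀ {i j} → toℕ j ≢ suc (toℕ i) → E i j ≈ 0#
    E-off {i} {j} ≢ = when-false (dec-false (toℕ j ℕ.≟ suc (toℕ i)) ≢)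

    F-on : ∀ {i j} → toℕ i ≡ suc (toℕ j) → F i j ≈ toℕ i ×̇ 1#
    F-on {i} {j} e = when-true (dec-true (toℕ i ℕ.≟ suc (toℕ j)) e)

    F-off : ∀ {i j} → toℕ i ≢ suc (toℕ j) → F i j ≈ 0#
    F-off {i} {j} ≢ = when-false (dec-false (toℕ i ℕ.≟ suc (toℕ j)) ≢)

    weight-difference : ∀ i j → fromℤ (weight i) - fromℤ (weight j) ≈
                        fromℤ (+ 2 ℤ.* (+ toℕ j ℤ.- + toℕ i))
    weight-difference i j = trans (sym (fromℤ-- (weight i) (weight j)))
      (reflexive (≡.cong fromℤ (arith (+ k) (+ toℕ i) (+ toℕ j))))
      where
      arith : ∀ k i j → k ℤ.- + 2 ℤ.* i ℤ.- (k ℤ.- + 2 ℤ.* j) ≡ + 2 ℤ.* (j ℤ.- i)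
      arith = solve-∀

    H : Matrix (suc k)
    H = diagonal weight

    -- Bracketing with a diagonal matrix scales each entry by a difference of weights, here 2(j -
    -- i). On the support j = i + 1 of `E` this is 2, on the support i = j + 1 of `F` it is -2.
    [H,-] : ∀ M i j → [ H , M ] i j ≈ fromℤ (+ 2 ℤ.* (+ toℕ j ℤ.- + toℕ i)) * M i j
    [H,-] M i j = begin
      (H ⊗ M) i j - (M ⊗ H) i j
        ≈⟨ +-cong (sum-diagonal weight i (λ l → M l j)) (-‿cong (sum-diagonalʳ weight j (M i))) ⟩
      fromℤ (weight i) * M i j - M i j * fromℤ (weight j)
        ≈⟨ solve 3 (λ x m y → x :* m :- m :* y := (x :- y) :* m) refl (fromℤ (weight i)) (M i j) (fromℤ (weight j)) ⟩
      (fromℤ (weight i) - fromℤ (weight j)) * M i j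
        ≈⟨ *-congʳ (weight-difference i j) ⟩
      fromℤ (+ 2 ℤ.* (+ toℕ j ℤ.- + toℕ i)) * M i j ∎

    [H,E] : ∀ i j → [ H , E ] i j ≈ fromℤ (+ 2) * E i j
    [H,E] i j = trans ([H,-] E i j) (step (toℕ j ℕ.≟ suc (toℕ i)))
      where
      one : ∀ i → + 2 ℤ.* (+ 1 ℤ.+ i ℤ.- i) ≡ + 2
      one = solve-∀

      step : _ → fromℤ (+ 2 ℤ.* (+ toℕ j ℤ.- + toℕ i)) * E i j ≈ fromℤ (+ 2) * E i j
      step (yes e) = *-congʳ (reflexive (≡.cong fromℤ (≡.trans
        (≡.cong (λ m → + 2 ℤ.* (+ m ℤ.- + toℕ i)) e) (one (+ toℕ i)))))
      step (no ≢) = trans (*-congˡ (E-off ≢)) (trans (zeroʳ _) (sym (trans (*-congˡ (E-off ≢)) (zeroʳ _))))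

    [H,F] : ∀ i j → [ H , F ] i j ≈ fromℤ (ℤ.- + 2) * F i j
    [H,F] i j = trans ([H,-] F i j) (step (toℕ i ℕ.≟ suc (toℕ j)))
      where
      one : ∀ j → + 2 ℤ.* (j ℤ.- (+ 1 ℤ.+ j)) ≡ ℤ.- + 2
      one = solve-∀

      step : _ → fromℤ (+ 2 ℤ.* (+ toℕ j ℤ.- + toℕ i)) * F i j ≈ fromℤ (ℤ.- + 2) * F i j
      step (yes e) = *-congʳ (reflexive (≡.cong fromℤ (≡.trans
        (≡.cong (λ m → + 2 ℤ.* (+ toℕ j ℤ.- + m)) e) (one (+ toℕ j)))))
      step (no ≢) = trans (*-congˡ (F-off ≢)) (trans (zeroʳ _) (sym (trans (*-congˡ (F-off ≢)) (zeroʳ _))))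

    private
      δ : Fin (suc k) → Vector Carrier (suc k)
      δ i j = if does (i Fin.≟ j) then 1# else 0#

      δ-on : ∀ i → δ i i ≈ 1#
      δ-on i = when-true (dec-true (i Fin.≟ i) ≡.refl)

      δ-off : ∀ {i j} → j ≢ i → δ i j ≈ 0#
      δ-off {i} {j} ≢ = when-false (dec-false (i Fin.≟ j) (≢ ∘ ≡.sym))

      toℕ≤k : ∀ (i : Fin (suc k)) → toℕ i ℕ.≤ k
      toℕ≤k i = ℕ.s≤s⁻¹ (Fin.toℕ<n i)

    E⊗F : ∀ i j → (E ⊗ F) i j ≈ ((k ℕ.∸ toℕ i) ×̇ 1#) * (suc (toℕ i) ×̇ 1#) * δ i j
    E⊗F i j with toℕ i ℕ.<? k
    -- In the last row there is no index i + 1, and the factor k - i on the right is 0 as well.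
    ... | no i≮k = trans
      (sum-0 {f = λ l → E i l * F l j} λ l → trans (*-congʳ {F l j} (E-off {i} {l} (beyond l))) (zeroˡ _))
      (sym (trans (*-congʳ (*-congʳ (reflexive (≡.cong (_×̇ 1#) (ℕ.m≤n⇒m∸n≡0 (ℕ.≮⇒≥ i≮k))))))
        (trans (*-congʳ (zeroˡ _)) (zeroˡ _))))
      where
      beyond : ∀ l → toℕ l ≢ suc (toℕ i)
      beyond l e = i≮k (≡.subst (ℕ._≤ k) e (toℕ≤k l))
    ... | yes i<k = trans (sum-singleˡ (E i) (λ l → F l j) i⁺ λ l l≢ →
        E-off {i} {l} λ e → l≢ (Fin.toℕ-injective (≡.trans e (≡.sym toℕ-i⁺))))
      (trans (*-cong (E-on {i} {i⁺} toℕ-i⁺) F-entry) (sym (*-assoc _ _ _)))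
      where
      i⁺ : Fin (suc k)
      i⁺ = fromℕ< (ℕ.s<s i<k)

      toℕ-i⁺ : toℕ i⁺ ≡ suc (toℕ i)
      toℕ-i⁺ = Fin.toℕ-fromℕ< (ℕ.s<s i<k)

      F-entry : F i⁺ j ≈ (suc (toℕ i) ×̇ 1#) * δ i j
      F-entry with j Fin.≟ i
      ... | yes ≡.refl = trans (F-on {i⁺} {j} toℕ-i⁺) (trans (reflexive (≡.cong (_×̇ 1#) toℕ-i⁺))
        (sym (trans (*-congˡ (δ-on i)) (*-identityʳ _))))
      ... | no j≢i     = trans
        (F-off {i⁺} {j} λ e → j≢i (Fin.toℕ-injective (ℕ.suc-injective (≡.trans (≡.sym e) toℕ-i⁺))))
        (sym (trans (*-congˡ (δ-off j≢i)) (zeroʳ _)))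

    F⊗E : ∀ i j → (F ⊗ E) i j ≈ (toℕ i ×̇ 1#) * (suc (k ℕ.∸ toℕ i) ×̇ 1#) * δ i j
    F⊗E zero j = trans (sum-0 {f = λ l → F zero l * E l j} λ l → zeroˡ (E l j))
      (sym (trans (*-congʳ (zeroˡ _)) (zeroˡ _)))
    F⊗E i@(suc i₀) j = trans (sum-singleˡ (F i) (λ l → E l j) i⁻ λ l l≢ →
        F-off {i} {l} λ e → l≢ (Fin.toℕ-injective (≡.trans (≡.sym (ℕ.suc-injective e)) (≡.sym toℕ-i⁻))))
      (trans (*-cong (F-on {i} {i⁻} (≡.cong suc (≡.sym toℕ-i⁻))) E-entry) (sym (*-assoc _ _ _)))
      where
      i⁻ : Fin (suc k)
      i⁻ = inject₁ i₀

      toℕ-i⁻ : toℕ i⁻ ≡ toℕ i₀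
      toℕ-i⁻ = Fin.toℕ-inject₁ i₀

      E-entry : E i⁻ j ≈ (suc (k ℕ.∸ toℕ i) ×̇ 1#) * δ i j
      E-entry with j Fin.≟ i
      ... | yes ≡.refl = trans (E-on {i⁻} {i} (≡.cong suc (≡.sym toℕ-i⁻))) (trans
        (reflexive (≡.cong (_×̇ 1#) (≡.trans (≡.cong (k ℕ.∸_) toℕ-i⁻) (ℕ.+-∸-assoc 1 (toℕ≤k i)))))
        (sym (trans (*-congˡ (δ-on i)) (*-identityʳ _))))
      ... | no j≢i     = trans
        (E-off {i⁻} {j} λ e → j≢i (Fin.toℕ-injective (≡.trans e (≡.cong suc toℕ-i⁻))))
        (sym (trans (*-congˡ (δ-off j≢i)) (zeroʳ _)))

    [E,F] : ∀ i j → [ E , F ] i j ≈ H i j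
    [E,F] i j = begin
      (E ⊗ F) i j - (F ⊗ E) i j
        ≈⟨ +-cong (E⊗F i j) (-‿cong (F⊗E i j)) ⟩
      p * (1# + q) * δ i j - q * (1# + p) * δ i j
        -- `suc n ×̇ 1#` unfolds to `1# + n ×̇ 1#`. With p = k - i and q = i the products pq cancel
        -- and leave p - q = k - 2i.
        ≈⟨ solve 4 (λ p q o d → p :* (o :+ q) :* d :- q :* (o :+ p) :* d := o :* (p :- q) :* d) refl p q 1# (δ i j) ⟩
      1# * (p - q) * δ i j
        ≈⟨ *-congʳ (trans (*-identityˡ _) (trans (sym (fromℤ-- (+ (k ℕ.∸ toℕ i)) (+ toℕ i)))
             (reflexive (≡.cong fromℤ weight≡)))) ⟩
      fromℤ (weight i) * δ i j
        ≈⟨ entry ⟩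
      H i j ∎
      where
      p q : Carrier
      p = (k ℕ.∸ toℕ i) ×̇ 1#
      q = toℕ i ×̇ 1#

      arith : ∀ k i → k ℤ.- i ℤ.- i ≡ k ℤ.- + 2 ℤ.* i
      arith = solve-∀

      weight≡ : + (k ℕ.∸ toℕ i) ℤ.- + toℕ i ≡ weight i
      weight≡ = ≡.trans (≡.cong (ℤ._- + toℕ i) (≡.trans (≡.sym (ℤ.⊖-≥ (toℕ≤k i))) (≡.sym (ℤ.m-n≡m⊖n k (toℕ i)))))
        (arith (+ k) (+ toℕ i))

      entry : fromℤ (weight i) * δ i j ≈ H i j
      entry with i Fin.≟ j
      ... | yes _ = *-identityʳ _
      ... | no _  = zeroʳ _

    irreducible : Sl₂Module (suc k)
    irreducible = record
      { weight = weight ; E = E ; F = F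
      ; [H,E]≈2E = [H,E] ; [H,F]≈-2F = [H,F] ; [E,F]≈H = [E,F] }

    -- Characteristic zero enters here: distinct weights differ by an invertible scalar, so
    -- polynomials in H separate the coordinates.
    weight-unit : ∀ {i j} → i ≢ j → Unit (fromℤ (weight i) - fromℤ (weight j))
    weight-unit {i} {j} i≢j = unit-resp-≈ (sym (weight-difference i j))
      (unit-ℤ _ λ e → i≢j (≡.sym (Fin.toℕ-injective (ℤ.+-injective
        (ℤ.i-j≡0⇒i≡j (+ toℕ j) (+ toℕ i) (ℤ.*-cancelˡ-≡ (+ 2) _ _ (≡.trans e ≡.refl)))))))

    -- A coordinate of `v` apart from 0 yields a basis vector in `W` by means of H; E carries it up
    -- to the highest weight and F down through all others, every coefficient on the way being a
    -- positive integer and so invertible.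
    irreducible-irreducible : Irreducible irreducible
    irreducible-irreducible = (λ ()) , full
      where
      full : ∀ (W : Pred (Vector Carrier (suc k)) _) → IsSubmodule irreducible W →
             ∀ v → v ∈ᵁ W → (∃ λ i → v i # 0#) → ∀ w → w ∈ᵁ W
      full W sub v v∈W (i , vᵢ#0) w = respects expand
        (sum-closed {u = λ j l → w j * δ j l} λ j → *-closed (w j) (δ∈W j))
        where
        open IsSubmodule sub

        -- The factors H - weight j, for j ≠ i, project v to the weight space of i.
        project : ∀ js → ∃ λ u → u ∈ᵁ W × Unit (u i) × (∀ {j} → j ∈ js → j ≢ i → u j ≈ 0#)
        project []       = v , v∈W , #0⇒unit vᵢ#0 , λ ()
        project (j ∷ js) with project js | j Fin.≟ i
        ... | u , u∈W , uᵢ , u≈0 | yes j≡i = u , u∈W , uᵢ , λ where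
          (here e)   l≢i → contradiction (≡.trans e j≡i) l≢i
          (there l∈) l≢i → u≈0 l∈ l≢i
        ... | u , u∈W , uᵢ , u≈0 | no j≢i = u′
          , +-closed (H-closed u∈W) (*-closed (- fromℤ (weight j)) u∈W)
          , unit-resp-≈ (sym (u′≈ i)) (unit-* (weight-unit (j≢i ∘ ≡.sym)) uᵢ)
          , λ where
            (here ≡.refl) _   → trans (u′≈ j) (trans (*-congʳ (-‿inverseʳ _)) (zeroˡ _))
            (there l∈)    l≢i → trans (u′≈ _) (trans (*-congˡ (u≈0 l∈ l≢i)) (zeroʳ _))
          where
          u′ : Vector Carrier (suc k)
          u′ l = apply H u l + (- fromℤ (weight j)) * u l

          u′≈ : ∀ l → u′ l ≈ (fromℤ (weight l) - fromℤ (weight j)) * u l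
          u′≈ l = trans (+-congʳ (sum-diagonal weight l u)) (sym (distribʳ (u l) _ _))

        δᵢ∈W : δ i ∈ᵁ W
        δᵢ∈W with project (allFin (suc k))
        ... | u , u∈W , (y , yuᵢ≈1) , u≈0 = respects scaled (*-closed y u∈W)
          where
          scaled : ∀ l → y * u l ≈ δ i l
          scaled l with i Fin.≟ l
          ... | yes ≡.refl = yuᵢ≈1
          ... | no i≢l     = trans (*-congˡ (u≈0 (∈-allFin l) (i≢l ∘ ≡.sym))) (zeroʳ y)

        apply-δ : ∀ (M : Matrix (suc k)) j l → apply M (δ j) l ≈ M l j
        apply-δ M j l = trans (sum-singleʳ (M l) (δ j) j λ m m≢j → δ-off m≢j)
          (trans (*-congˡ (δ-on j)) (*-identityʳ _))

        transfer : ∀ (M : Matrix (suc k)) {j m} → apply M (δ j) ∈ᵁ W → Unit (M m j) →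
                   (∀ l → l ≢ m → M l j ≈ 0#) → δ m ∈ᵁ W
        transfer M {j} {m} Mδ∈W (y , e) M≈0 = respects scaled (*-closed y Mδ∈W)
          where
          scaled : ∀ l → y * apply M (δ j) l ≈ δ m l
          scaled l with m Fin.≟ l
          ... | yes ≡.refl = trans (*-congˡ (apply-δ M j l)) e
          ... | no m≢l     = trans (*-congˡ (trans (apply-δ M j l) (M≈0 l (m≢l ∘ ≡.sym)))) (zeroʳ y)

        lower : ∀ (j : Fin k) → δ (inject₁ j) ∈ᵁ W → δ (suc j) ∈ᵁ W
        lower j δ∈W = transfer F {inject₁ j} {suc j} (F-closed δ∈W)
          (unit-resp-≈ (sym (F-on {suc j} {inject₁ j} (≡.cong suc (≡.sym (Fin.toℕ-inject₁ j)))))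
            (unit-ℕ (suc (toℕ j)) λ ()))
          λ l l≢ → F-off {l} {inject₁ j} λ e → l≢ (Fin.toℕ-injective (≡.trans e (≡.cong suc (Fin.toℕ-inject₁ j))))

        raise : ∀ (j : Fin k) → δ (suc j) ∈ᵁ W → δ (inject₁ j) ∈ᵁ W
        raise j δ∈W = transfer E {suc j} {inject₁ j} (E-closed δ∈W)
          (unit-resp-≈ (sym (E-on {inject₁ j} {suc j} (≡.cong suc (≡.sym (Fin.toℕ-inject₁ j)))))
            (unit-ℕ _ (≡.subst (λ m → k ℕ.∸ m ≢ 0) (≡.sym (Fin.toℕ-inject₁ j))
              (ℕ.m>n⇒m∸n≢0 (Fin.toℕ<n j)))))
          λ l l≢ → E-off {l} {suc j} λ e → l≢ (Fin.toℕ-injective 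
            (≡.trans (ℕ.suc-injective (≡.sym e)) (≡.sym (Fin.toℕ-inject₁ j))))

        highest : ∀ j → δ j ∈ᵁ W → δ zero ∈ᵁ W
        highest = <-weakInduction (λ j → δ j ∈ᵁ W → δ zero ∈ᵁ W) id λ j f → f ∘ raise j

        δ∈W : ∀ j → δ j ∈ᵁ W
        δ∈W = <-weakInduction (λ j → δ j ∈ᵁ W) (highest i δᵢ∈W) lower

        sum-closed : ∀ {m} {u : Fin m → Vector Carrier (suc k)} → (∀ j → u j ∈ᵁ W) →
                     (λ l → sum λ j → u j l) ∈ᵁ W
        sum-closed {zero}  u∈W = 0-closed
        sum-closed {suc m} u∈W = +-closed (u∈W zero) (sum-closed (u∈W ∘ suc))

        expand : ∀ l → sum (λ j → w j * δ j l) ≈ w l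
        expand l = trans (sum-singleʳ w (λ j → δ j l) l λ j j≢l → δ-off (j≢l ∘ ≡.sym))
          (trans (*-congˡ (δ-on l)) (*-identityʳ _))

-- Parity of integers

parity-⊖ : ∀ m n → parity ℤ.∣ m ℤ.⊖ n ∣ ≡ parity (m ℕ.+ n)
parity-⊖ zero    zero    = ≡.refl
parity-⊖ zero    (suc n) = ≡.refl
parity-⊖ (suc m) zero    = ≡.cong (parity ∘ suc) (≡.sym (ℕ.+-identityʳ m))
parity-⊖ (suc m) (suc n) = ≡.trans
  (≡.cong (λ i → parity ℤ.∣ i ∣) (ℤ.[1+m]⊖[1+n]≡m⊖n m n))
  (≡.trans (parity-⊖ m n) (≡.cong (parity ∘ suc) (≡.sym (ℕ.+-suc m n))))

parity-∣+∣ : ∀ i j → parity ℤ.∣ i ℤ.+ j ∣ ≡ parity ℤ.∣ i ∣ ℙ.+ parity ℤ.∣ j ∣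
parity-∣+∣ (+ m)    (+ n)    = ℙ.+-homo-+ m n
parity-∣+∣ (+ m)    -[1+ n ] = ≡.trans (parity-⊖ m (suc n)) (ℙ.+-homo-+ m (suc n))
parity-∣+∣ -[1+ m ] (+ n)    = ≡.trans (parity-⊖ n (suc m))
  (≡.trans (ℙ.+-homo-+ n (suc m)) (ℙ.+-comm (parity n) (parity (suc m))))
parity-∣+∣ -[1+ m ] -[1+ n ] = ≡.trans
  (≡.cong (parity ∘ suc) (≡.sym (ℕ.+-suc m n))) (ℙ.+-homo-+ (suc m) (suc n))

parity-2* : ∀ i → parity ℤ.∣ + 2 ℤ.* i ∣ ≡ 0ℙ
parity-2* i = ≡.trans (≡.cong parity (ℤ.∣i*j∣≡∣i∣*∣j∣ (+ 2) i)) (ℙ.*-homo-* 2 ℤ.∣ i ∣)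

even⇒2* : ∀ n → parity n ≡ 0ℙ → ∃ λ k → n ≡ 2 ℕ.* k
even⇒2* zero          _ = 0 , ≡.refl
even⇒2* (suc (suc n)) e = let k , n≡ = even⇒2* n e in
  suc k , ≡.trans (≡.cong (2 ℕ.+_) n≡) (≡.sym (ℕ.*-suc 2 k))

odd⇒1+2* : ∀ n → parity n ≡ 1ℙ → ∃ λ k → n ≡ suc (2 ℕ.* k)
odd⇒1+2* (suc n) e = let k , n≡ = even⇒2* n even in k , ≡.cong suc n≡
  where
  even : parity n ≡ 0ℙ
  even = ≡.trans (≡.sym (ℙ.suc-homo-⁻¹ n)) (≡.cong ℙ._⁻¹ e)

-- Divisibility among the differences uⁿ - u⁻ⁿ

module ExponentialQuotient (R : CommutativeRing c ℓ)
  (e : ℤ → CommutativeRing.Carrier R)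
  (e-+ : ∀ i j → CommutativeRing._≈_ R (e (i ℤ.+ j)) (CommutativeRing._*_ R (e i) (e j)))
  (e-0 : CommutativeRing._≈_ R (e (+ 0)) (CommutativeRing.1# R))
  where

  open CommutativeRing R hiding (zero)
  open IntegerSolver R
  open Exponential R e e-+ e-0
  open import Relation.Binary.Reasoning.Setoid setoid

  infix 4 _∣ᴿ_

  _∣ᴿ_ : Carrier → Carrier → Set _
  x ∣ᴿ y = ∃ λ q → q * x ≈ y

  B⁺ : ℤ → Carrier
  B⁺ n = e n + e (ℤ.- n)

  -- The two powers with exponent i - j cancel. In this unsymmetric form of the addition formula,
  -- divisibility of `B (n m)` by `B n` passes from m to m + 1 with an explicit cofactor.
  B-+ : ∀ i j → B (i ℤ.+ j) ≈ e i * B j + e (ℤ.- j) * B i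
  B-+ i j = sym (begin
    e i * B j + e (ℤ.- j) * B i
      ≈⟨ +-cong (e-*-B i j) (e-*-B (ℤ.- j) i) ⟩
    (e (i ℤ.+ j) - e (i ℤ.- j)) + (e (ℤ.- j ℤ.+ i) - e (ℤ.- j ℤ.- i))
      ≈⟨ +-congˡ (+-cong (e-≡ (ℤ.+-comm (ℤ.- j) i)) (-‿cong (e-≡ (negate i j)))) ⟩
    (e (i ℤ.+ j) - e (i ℤ.- j)) + (e (i ℤ.- j) - e (ℤ.- (i ℤ.+ j)))
      ≈⟨ solve 3 (λ x y z → (x :- y) :+ (y :- z) := x :- z) refl _ _ _ ⟩
    B (i ℤ.+ j) ∎)
    where
    negate : ∀ i j → ℤ.- j ℤ.- i ≡ ℤ.- (i ℤ.+ j)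
    negate = solve-∀

  B∣B-* : ∀ n m → B n ∣ᴿ B (n ℤ.* + m)
  B∣B-* n zero    = 0# , trans (zeroˡ _) (sym (trans (B-≡ (ℤ.*-zeroʳ n)) (-‿inverseʳ _)))
  B∣B-* n (suc m) = let q , qB≈ = B∣B-* n m in e (n ℤ.* + m) + e (ℤ.- n) * q , (begin
    (e (n ℤ.* + m) + e (ℤ.- n) * q) * B n
      ≈⟨ solve 4 (λ x y q b → (x :+ y :* q) :* b := x :* b :+ y :* (q :* b)) refl _ _ q (B n) ⟩
    e (n ℤ.* + m) * B n + e (ℤ.- n) * (q * B n)
      ≈⟨ +-congˡ (*-congˡ qB≈) ⟩
    e (n ℤ.* + m) * B n + e (ℤ.- n) * B (n ℤ.* + m)
      ≈⟨ B-+ (n ℤ.* + m) n ⟨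
    B (n ℤ.* + m ℤ.+ n)
      ≈⟨ B-≡ (≡.trans (ℤ.+-comm _ n) (≡.sym (ℤ.*-suc n (+ m)))) ⟩
    B (n ℤ.* + suc m) ∎)

  B⁺*B : ∀ n → B⁺ n * B n ≈ B (+ 2 ℤ.* n)
  B⁺*B n = begin
    B⁺ n * B n
      ≈⟨ solve 2 (λ p q → (p :+ q) :* (p :- q) := p :* p :- q :* q) refl (e n) (e (ℤ.- n)) ⟩
    e n * e n - e (ℤ.- n) * e (ℤ.- n)
      ≈⟨ +-cong (e-+ n n) (-‿cong (e-+ (ℤ.- n) (ℤ.- n))) ⟨
    e (n ℤ.+ n) - e (ℤ.- n ℤ.+ ℤ.- n)
      ≈⟨ +-cong (e-≡ (double n)) (-‿cong (e-≡ (double⁻ n))) ⟩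
    B (+ 2 ℤ.* n) ∎
    where
    double : ∀ n → n ℤ.+ n ≡ + 2 ℤ.* n
    double = solve-∀

    double⁻ : ∀ n → ℤ.- n ℤ.+ ℤ.- n ≡ ℤ.- (+ 2 ℤ.* n)
    double⁻ = solve-∀

  -- The analogue of x + y dividing xⁿ + yⁿ for odd n. The cofactor comes from B⁺(n+2) = u² B⁺(n) -
  -- u⁻ⁿ (u² - u⁻²), where u² - u⁻² is B⁺(1) B(1).
  B⁺1∣B⁺-odd : ∀ k → B⁺ (+ 1) ∣ᴿ B⁺ (+ 1 ℤ.+ + 2 ℤ.* + k)
  B⁺1∣B⁺-odd zero    = 1# , *-identityˡ _
  B⁺1∣B⁺-odd (suc k) = let q , qC≈ = B⁺1∣B⁺-odd k ; n = + 1 ℤ.+ + 2 ℤ.* + k in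
    e (+ 2) * q - e (ℤ.- n) * B (+ 1) , (begin
    (e (+ 2) * q - e (ℤ.- n) * B (+ 1)) * B⁺ (+ 1)
      ≈⟨ solve 5 (λ x q y b c → (x :* q :- y :* b) :* c := x :* (q :* c) :- y :* (c :* b)) refl _ q _ _ _ ⟩
    e (+ 2) * (q * B⁺ (+ 1)) - e (ℤ.- n) * (B⁺ (+ 1) * B (+ 1))
      ≈⟨ +-cong (*-congˡ qC≈) (-‿cong (trans (*-congˡ (B⁺*B (+ 1))) (e-*-B (ℤ.- n) (+ 2)))) ⟩
    e (+ 2) * (e n + e (ℤ.- n)) - (e (ℤ.- n ℤ.+ + 2) - e (ℤ.- n ℤ.- + 2))
      ≈⟨ +-congʳ (trans (distribˡ _ _ _) (sym (+-cong (e-+ (+ 2) n) (e-+ (+ 2) (ℤ.- n))))) ⟩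
    (e (+ 2 ℤ.+ n) + e (+ 2 ℤ.+ ℤ.- n)) - (e (ℤ.- n ℤ.+ + 2) - e (ℤ.- n ℤ.- + 2))
      ≈⟨ +-congʳ (+-congˡ (e-≡ (ℤ.+-comm (+ 2) (ℤ.- n)))) ⟩
    (e (+ 2 ℤ.+ n) + e (ℤ.- n ℤ.+ + 2)) - (e (ℤ.- n ℤ.+ + 2) - e (ℤ.- n ℤ.- + 2))
      ≈⟨ solve 3 (λ x y z → x :+ y :- (y :- z) := x :+ z) refl _ _ _ ⟩
    e (+ 2 ℤ.+ n) + e (ℤ.- n ℤ.- + 2)
      ≈⟨ +-cong (e-≡ (next (+ k))) (e-≡ (next⁻ (+ k))) ⟩
    B⁺ (+ 1 ℤ.+ + 2 ℤ.* + suc k) ∎)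
    where
    next : ∀ k → + 2 ℤ.+ (+ 1 ℤ.+ + 2 ℤ.* k) ≡ + 1 ℤ.+ + 2 ℤ.* (+ 1 ℤ.+ k)
    next = solve-∀

    next⁻ : ∀ k → ℤ.- (+ 1 ℤ.+ + 2 ℤ.* k) ℤ.- + 2 ≡ ℤ.- (+ 1 ℤ.+ + 2 ℤ.* (+ 1 ℤ.+ k))
    next⁻ = solve-∀

  private
    scale : ∀ {x y z} → x ∣ᴿ y → y ≈ z → x ∣ᴿ z
    scale (q , e) y≈z = q , trans e y≈z

    B∣B : ∀ m k → B (+ m) ∣ᴿ B (+ (m ℕ.* k))
    B∣B m k = scale (B∣B-* (+ m) k) (B-≡ (≡.sym (ℤ.pos-* m k)))

    B-2* : ∀ k → B (+ 2) ∣ᴿ B (+ (2 ℕ.* k))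
    B-2* = B∣B 2

    -- For odd t and d: B t * B 2 = B t * B⁺ 1 * B 1 divides B (2t) * B d.
    twice : ∀ t k d → parity t ≡ 1ℙ → parity k ≡ 0ℙ →
            B (+ t) * B (+ 2) ∣ᴿ B (+ (t ℕ.* k)) * B (+ d)
    twice t k d odd even =
      let k′ , k≡ = even⇒2* k even
          s , t≡ = odd⇒1+2* t odd
          q₁ , e₁ = B∣B-* (+ 2 ℤ.* + t) k′
          q₂ , e₂ = B⁺1∣B⁺-odd s
          q₃ , e₃ = B∣B 1 d
      in q₁ * q₂ * q₃ , (begin
        q₁ * q₂ * q₃ * (B (+ t) * B (+ 2))
          ≈⟨ *-congˡ (*-congˡ (B⁺*B (+ 1))) ⟨
        q₁ * q₂ * q₃ * (B (+ t) * (B⁺ (+ 1) * B (+ 1)))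
          ≈⟨ solve 6 (λ p q r t c b → p :* q :* r :* (t :* (c :* b)) := p :* ((q :* c) :* t) :* (r :* b))
               refl q₁ q₂ q₃ _ _ _ ⟩
        q₁ * (q₂ * B⁺ (+ 1) * B (+ t)) * (q₃ * B (+ 1))
          ≈⟨ *-cong (*-congˡ (*-congʳ (trans e₂ (+-cong (e-≡ (odd≡ s t≡)) (e-≡ (≡.cong (λ m → ℤ.- m) (odd≡ s t≡)))))))
                    (trans e₃ (B-≡ (≡.cong (λ m → + m) (ℕ.*-identityˡ d)))) ⟩
        q₁ * (B⁺ (+ t) * B (+ t)) * B (+ d)
          ≈⟨ *-congʳ (*-congˡ (B⁺*B (+ t))) ⟩
        q₁ * B (+ 2 ℤ.* + t) * B (+ d)
          ≈⟨ *-congʳ (trans e₁ (B-≡ (mult k′ k≡))) ⟩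
        B (+ (t ℕ.* k)) * B (+ d) ∎)
      where
      odd≡ : ∀ s → t ≡ suc (2 ℕ.* s) → + 1 ℤ.+ + 2 ℤ.* + s ≡ + t
      odd≡ s t≡ = ≡.trans (≡.cong (λ m → + 1 ℤ.+ m) (≡.sym (ℤ.pos-* 2 s))) (≡.cong (λ m → + m) (≡.sym t≡))

      swap : ∀ t k → + 2 ℤ.* t ℤ.* k ≡ t ℤ.* (+ 2 ℤ.* k)
      swap = solve-∀

      mult : ∀ k′ → k ≡ 2 ℕ.* k′ → + 2 ℤ.* + t ℤ.* + k′ ≡ + (t ℕ.* k)
      mult k′ k≡ = ≡.trans (swap (+ t) (+ k′)) (≡.trans
        (≡.cong (λ m → + t ℤ.* m) (≡.trans (≡.sym (ℤ.pos-* 2 k′)) (≡.cong (λ m → + m) (≡.sym k≡))))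
        (≡.sym (ℤ.pos-* t k)))

  quotient : ∀ t k₁ k₂ d → parity (t ℕ.* k₁) ℙ.+ parity (t ℕ.* k₂) ℙ.+ parity d ≡ 0ℙ →
    B (+ t) * B (+ t) * B (+ 2) ∣ᴿ B (+ (t ℕ.* k₁)) * B (+ (t ℕ.* k₂)) * B (+ d)
  quotient t k₁ k₂ d even rewrite ℙ.*-homo-* t k₁ | ℙ.*-homo-* t k₂
    with parity d in parity-d | parity t in parity-t | parity k₁ in parity-k₁ | parity k₂ in parity-k₂
  -- For even d each factor of the denominator divides its own factor of the numerator, whatever the
  -- other parities are.
  ... | 0ℙ | _ | _ | _ =
    let k , d≡ = even⇒2* d parity-d
        q₁ , e₁ = B∣B t k₁
        q₂ , e₂ = B∣B t k₂
        q₃ , e₃ = scale (B-2* k) (B-≡ (≡.cong (λ m → + m) (≡.sym d≡)))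
    in q₁ * q₂ * q₃ , trans
      (solve 5 (λ p q r t b → p :* q :* r :* (t :* t :* b) := p :* t :* (q :* t) :* (r :* b)) refl q₁ q₂ q₃ _ _)
      (*-cong (*-cong e₁ e₂) e₃)
  -- Odd d forces odd t and exactly one even multiplier; the corresponding factor and `B d` jointly
  -- absorb `B t * B 2`.
  ... | 1ℙ | 1ℙ | 0ℙ | 1ℙ =
    let q₁ , e₁ = twice t k₁ d parity-t parity-k₁
        q₂ , e₂ = B∣B t k₂
    in q₁ * q₂ , trans
      (solve 4 (λ p q t b → p :* q :* (t :* t :* b) := p :* (t :* b) :* (q :* t)) refl q₁ q₂ _ _)
      (trans (*-cong e₁ e₂) (solve 3 (λ x y z → x :* z :* y := x :* y :* z) refl _ _ _))
  ... | 1ℙ | 1ℙ | 1ℙ | 0ℙ =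
    let q₁ , e₁ = B∣B t k₁
        q₂ , e₂ = twice t k₂ d parity-t parity-k₂
    in q₁ * q₂ , trans
      (solve 4 (λ p q t b → p :* q :* (t :* t :* b) := p :* t :* (q :* (t :* b))) refl q₁ q₂ _ _)
      (trans (*-cong e₁ e₂) (solve 3 (λ x y z → x :* (y :* z) := x :* y :* z) refl _ _ _))
  ... | 1ℙ | 0ℙ | _ | _ = contradiction even λ ()
  ... | 1ℙ | 1ℙ | 0ℙ | 0ℙ = contradiction even λ ()
  ... | 1ℙ | 1ℙ | 1ℙ | 1ℙ = contradiction even λ ()

-- Laurent polynomials

halve? : ∀ i → (∃ λ k → i ≡ + 2 ℤ.* k) ⊎ parity ℤ.∣ i ∣ ≡ 1ℙ
halve? i with parity ℤ.∣ i ∣ in eq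
... | 1ℙ = inj₂ ≡.refl
... | 0ℙ = inj₁ (half i (even⇒2* ℤ.∣ i ∣ eq))
  where
  half : ∀ i → ∃ (λ k → ℤ.∣ i ∣ ≡ 2 ℕ.* k) → ∃ λ k → i ≡ + 2 ℤ.* k
  half (+ n)    (k , n≡) = + k , ≡.trans (≡.cong (λ m → + m) n≡) (ℤ.pos-* 2 k)
  half -[1+ n ] (k , n≡) = ℤ.- + k , ≡.trans
    (≡.cong (λ m → ℤ.- + m) n≡) (≡.trans (≡.cong (λ m → ℤ.- m) (ℤ.pos-* 2 k)) (ℤ.neg-distribʳ-* (+ 2) (+ k)))

module LaurentProperties (R : CommutativeRing c ℓ) where

  open CommutativeRing R hiding (zero)
  open SignAction R
  open SignActionProperties R
  open LaurentPolynomials R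
  open IntegerSolver laurentRing using (solve; _:=_; _:+_; _:-_)
  open SemiringExp semiring using (_^_)
  module L = CommutativeRing laurentRing
  open SignAction laurentRing using () renaming (signed to signedᴸ)
  open import Relation.Binary.Reasoning.Setoid L.setoid
  open SemiringExp L.semiring using () renaming (_^_ to _^ᴸ_)

  _≈ᵗ_ : Carrier × ℤ → Carrier × ℤ → Set _
  (a , i) ≈ᵗ (b , j) = a ≈ b × i ≡ j

  -- Equal Laurent polynomials may have different lists, but `flip` respects products, squares and
  -- negation already term by term, so those laws need no computation of coefficients.
  pointwise : ∀ {p q} → Pointwise _≈ᵗ_ p q → p ≈ᴸ q
  pointwise []                                .coeff-≈ n = refl
  pointwise (_∷_ {_ , i} (a≈b , ≡.refl) p≈q) .coeff-≈ n = +-cong (head i) (pointwise p≈q .coeff-≈ n)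
    where
    head : ∀ i → (if does (i ℤ.≟ n) then _ else 0#) ≈ (if does (i ℤ.≟ n) then _ else 0#)
    head i with i ℤ.≟ n
    ... | yes _ = a≈b
    ... | no _  = refl

  mono-+ : ∀ i j → mono (i ℤ.+ j) L.≈ mono i L.* mono j
  mono-+ i j = pointwise ((sym (*-identityˡ 1#) , ≡.refl) ∷ [])

  const-* : ∀ a b → const a L.* const b L.≈ const (a * b)
  const-* a b = pointwise ((refl , ≡.refl) ∷ [])

  const-cong : ∀ {a b} → a ≈ b → const a L.≈ const b
  const-cong a≈b = pointwise ((a≈b , ≡.refl) ∷ [])

  const-^ : ∀ a n → const a ^ᴸ n L.≈ const (a ^ n)
  const-^ a zero    = L.refl
  const-^ a (suc n) = L.trans (L.*-congˡ {const a} (const-^ a n)) (const-* a (a ^ n))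

  const-- : ∀ a b → const (a - b) L.≈ const a L.- const b
  const-- a b .coeff-≈ n with + 0 ℤ.≟ n
  ... | yes _ = trans (+-identityʳ _) (+-congˡ (sym (+-identityʳ _)))
  ... | no _  = trans (+-identityʳ _) (sym (trans (+-identityˡ _) (+-identityʳ _)))

  open Exponential laurentRing mono mono-+ L.refl public

  coeff-flip : ∀ p n → coeff (flip p) n ≈ signed (-1^ ℤ.∣ n ∣) (coeff p n)
  coeff-flip []            n = sym (signed-0 (-1^ ℤ.∣ n ∣))
  coeff-flip ((a , i) ∷ p) n = trans (+-cong head (coeff-flip p n)) (sym (signed-+ (-1^ ℤ.∣ n ∣) _ _))
    where
    head : (if does (i ℤ.≟ n) then signed (-1^ ℤ.∣ i ∣) a else 0#) ≈
           signed (-1^ ℤ.∣ n ∣) (if does (i ℤ.≟ n) then a else 0#)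
    head with i ℤ.≟ n
    ... | yes ≡.refl = refl
    ... | no _       = sym (signed-0 (-1^ ℤ.∣ n ∣))

  flip-cong : ∀ {p q} → p L.≈ q → flip p L.≈ flip q
  flip-cong {p} {q} p≈q .coeff-≈ n = trans (coeff-flip p n)
    (trans (signed-cong (-1^ ℤ.∣ n ∣) (p≈q .coeff-≈ n)) (sym (coeff-flip q n)))

  flip-* : ∀ p q → flip (p L.* q) L.≈ flip p L.* flip q
  flip-* p q = pointwise (product p)
    where
    term : ∀ a i b j → signed (-1^ ℤ.∣ i ℤ.+ j ∣) (a * b) ≈ signed (-1^ ℤ.∣ i ∣) a * signed (-1^ ℤ.∣ j ∣) b
    term a i b j = trans
      (signed-≡ (a * b) (≡.trans (≡.cong toSign (parity-∣+∣ i j)) (ℙ.+-homo-* (parity ℤ.∣ i ∣) _)))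
      (signed-*-* (-1^ ℤ.∣ i ∣) (-1^ ℤ.∣ j ∣) a b)

    row : ∀ a i q → Pointwise _≈ᵗ_ (flip (mulTerm a i q)) (mulTerm (signed (-1^ ℤ.∣ i ∣) a) i (flip q))
    row a i []            = []
    row a i ((b , j) ∷ q) = (term a i b j , ≡.refl) ∷ row a i q

    product : ∀ p → Pointwise _≈ᵗ_ (flip (p L.* q)) (flip p L.* flip q)
    product []            = []
    product ((a , i) ∷ p) = ≡.subst (λ l → Pointwise _≈ᵗ_ l (flip ((a , i) ∷ p) L.* flip q))
      (≡.sym (List.map-++ _ (mulTerm a i q) (p L.* q)))
      (Pointwise.++⁺ (row a i q) (product p))

  flip-square : ∀ p → flip (square p) L.≈ square p
  flip-square p = pointwise (all p)
    where
    all : ∀ p → Pointwise _≈ᵗ_ (flip (square p)) (square p)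
    all []            = []
    all ((a , i) ∷ p) = (signed-≡ a (≡.cong toSign (parity-2* i)) , ≡.refl) ∷ all p

  flip-neg : ∀ p → flip (L.- p) L.≈ L.- flip p
  flip-neg p = pointwise (all p)
    where
    signed-neg : ∀ s a → signed s (- a) ≈ - signed s a
    signed-neg Sign.+ a = refl
    signed-neg Sign.- a = refl

    all : ∀ p → Pointwise _≈ᵗ_ (flip (L.- p)) (L.- flip p)
    all []            = []
    all ((a , i) ∷ p) = (signed-neg (-1^ ℤ.∣ i ∣) a , ≡.refl) ∷ all p

  flip-binomial : ∀ n {p} → parity ℤ.∣ n ∣ ≡ p → flip (binomial n) L.≈ signedᴸ (toSign p) (binomial n)
  flip-binomial n {p} parity≡p = L.trans (terms parity≡p) (signed-terms p)
    where
    flipped : Parity → Laurent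
    flipped p = (signed (toSign p) 1# , n) ∷ (signed (toSign p) (- 1#) , ℤ.- n) ∷ []

    terms : ∀ {p} → parity ℤ.∣ n ∣ ≡ p → flip (binomial n) L.≈ flipped p
    terms ≡.refl = pointwise ((refl , ≡.refl) ∷
      (signed-≡ (- 1#) (≡.cong -1^_ (ℤ.∣-i∣≡∣i∣ n)) , ≡.refl) ∷ [])

    signed-terms : ∀ p → flipped p L.≈ signedᴸ (toSign p) (binomial n)
    signed-terms 0ℙ = L.refl
    signed-terms 1ℙ = L.refl

  -- Terms of odd exponent are dropped. They need not vanish one by one, since exponents may repeat;
  -- `square-halve` asks only that their sums do.
  halve : Laurent → Laurent
  halve []            = []
  halve ((a , i) ∷ p) with halve? i
  ... | inj₁ (k , _) = (a , k) ∷ halve p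
  ... | inj₂ _       = halve p

  square-halve : ∀ p → (∀ n → parity ℤ.∣ n ∣ ≡ 1ℙ → coeff p n ≈ 0#) → square (halve p) L.≈ p
  square-halve p odd≈0 .coeff-≈ n with parity ℤ.∣ n ∣ in parity-n
  ... | 1ℙ = trans (square-odd (halve p)) (sym (odd≈0 n parity-n))
    where
    square-odd : ∀ q → coeff (square q) n ≈ 0#
    square-odd []            = refl
    square-odd ((a , i) ∷ q) with + 2 ℤ.* i ℤ.≟ n
    ... | yes ≡.refl = contradiction (≡.trans (≡.sym parity-n) (parity-2* i)) λ ()
    ... | no _       = trans (+-identityˡ _) (square-odd q)
  ... | 0ℙ = even p
    where
    even : ∀ p → coeff (square (halve p)) n ≈ coeff p n
    even []            = refl
    even ((a , i) ∷ p) with halve? i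
    ... | inj₁ (k , ≡.refl) = +-congˡ (even p)
    ... | inj₂ odd with i ℤ.≟ n
    ...   | yes ≡.refl = contradiction (≡.trans (≡.sym odd) parity-n) λ ()
    ...   | no _       = trans (even p) (sym (+-identityˡ _))

  -- At an odd exponent invariance says that the coefficient equals its own negative, so the
  -- cancellation of 2 kills it.
  flip-invariant⇒square : (∀ x → x + x ≈ 0# → x ≈ 0#) →
                          ∀ p → flip p L.≈ p → ∃ λ q → p L.≈ square q
  flip-invariant⇒square 2-cancel p flip≈ = halve p , L.sym (square-halve p λ n odd →
    2-cancel _ (trans
      (+-congˡ (trans (sym (flip≈ .coeff-≈ n)) (trans (coeff-flip p n) (signed-≡ _ (≡.cong toSign odd)))))
      (-‿inverseʳ _)))

  -- The sum telescopes: u²ʲ (u² - u⁻²) = u²ʲ⁺² - u²ʲ⁻².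
  square-weights : ∀ n a → square (tabulate {n = n} λ i → (1# , a ℤ.- + 2 ℤ.* + toℕ i)) L.* binomial (+ 2) L.≈
    mono (+ 2 ℤ.* a ℤ.+ + 2) L.- mono (+ 2 ℤ.* a ℤ.+ + 2 ℤ.- + 4 ℤ.* + n)
  square-weights zero a = L.sym (L.trans
    (L.+-congˡ {mono (+ 2 ℤ.* a ℤ.+ + 2)} (L.-‿cong (e-≡ (ℤ.+-identityʳ (+ 2 ℤ.* a ℤ.+ + 2)))))
    (L.-‿inverseʳ (mono (+ 2 ℤ.* a ℤ.+ + 2))))
  square-weights (suc n) a = begin
    (mono i₀ L.+ rest) L.* binomial (+ 2)
      ≈⟨ L.distribʳ (binomial (+ 2)) (mono i₀) rest ⟩
    mono i₀ L.* binomial (+ 2) L.+ rest L.* binomial (+ 2)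
      ≈⟨ L.+-cong (e-*-B i₀ (+ 2)) (L.trans
           (L.reflexive (≡.cong (λ p → square p L.* binomial (+ 2)) (List.tabulate-cong {n = n} λ i →
             ≡.cong (1# ,_) (shift a (+ toℕ i)))))
           (square-weights n (a ℤ.- + 2))) ⟩
    (mono (i₀ ℤ.+ + 2) L.- mono (i₀ ℤ.- + 2)) L.+ (mono j L.- mono k)
      ≈⟨ L.+-cong (L.+-cong (e-≡ (top a)) (L.-‿cong {mono (i₀ ℤ.- + 2)} (e-≡ (middle a))))
           (L.+-congˡ {mono j} (L.-‿cong (e-≡ (bottom a (+ n))))) ⟩
    (mono (+ 2 ℤ.* a ℤ.+ + 2) L.- mono j) L.+ (mono j L.- mono (+ 2 ℤ.* a ℤ.+ + 2 ℤ.- + 4 ℤ.* + suc n))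
      ≈⟨ telescope (mono (+ 2 ℤ.* a ℤ.+ + 2)) (mono j) (mono (+ 2 ℤ.* a ℤ.+ + 2 ℤ.- + 4 ℤ.* + suc n)) ⟩
    mono (+ 2 ℤ.* a ℤ.+ + 2) L.- mono (+ 2 ℤ.* a ℤ.+ + 2 ℤ.- + 4 ℤ.* + suc n) ∎
    where
    i₀ j k : ℤ
    i₀ = + 2 ℤ.* (a ℤ.- + 2 ℤ.* + 0)
    j  = + 2 ℤ.* (a ℤ.- + 2) ℤ.+ + 2
    k  = + 2 ℤ.* (a ℤ.- + 2) ℤ.+ + 2 ℤ.- + 4 ℤ.* + n

    rest : Laurent
    rest = square (tabulate {n = n} λ i → (1# , a ℤ.- + 2 ℤ.* + suc (toℕ i)))

    shift : ∀ a i → a ℤ.- + 2 ℤ.* (+ 1 ℤ.+ i) ≡ a ℤ.- + 2 ℤ.- + 2 ℤ.* i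
    shift = solve-∀

    top : ∀ a → + 2 ℤ.* (a ℤ.- + 2 ℤ.* + 0) ℤ.+ + 2 ≡ + 2 ℤ.* a ℤ.+ + 2
    top = solve-∀

    middle : ∀ a → + 2 ℤ.* (a ℤ.- + 2 ℤ.* + 0) ℤ.- + 2 ≡ + 2 ℤ.* (a ℤ.- + 2) ℤ.+ + 2
    middle = solve-∀

    bottom : ∀ a n → + 2 ℤ.* (a ℤ.- + 2) ℤ.+ + 2 ℤ.- + 4 ℤ.* n ≡ + 2 ℤ.* a ℤ.+ + 2 ℤ.- + 4 ℤ.* (+ 1 ℤ.+ n)
    bottom = solve-∀

    telescope : ∀ x y z → (x L.- y) L.+ (y L.- z) L.≈ x L.- z
    telescope = solve 3 (λ x y z → (x :- y) :+ (y :- z) := x :- z) L.refl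

  weights-character : ∀ k →
    square (tabulate {n = suc k} λ i → (1# , + k ℤ.- + 2 ℤ.* + toℕ i)) L.* binomial (+ 2) L.≈
    binomial (+ 2 ℤ.* + suc k)
  weights-character k = L.trans (square-weights (suc k) (+ k))
    (L.+-cong (e-≡ (top (+ k))) (L.-‿cong (e-≡ (bottom (+ k)))))
    where
    top : ∀ k → + 2 ℤ.* k ℤ.+ + 2 ≡ + 2 ℤ.* (+ 1 ℤ.+ k)
    top = solve-∀

    bottom : ∀ k → + 2 ℤ.* k ℤ.+ + 2 ℤ.- + 4 ℤ.* (+ 1 ℤ.+ k) ≡ ℤ.- (+ 2 ℤ.* (+ 1 ℤ.+ k))
    bottom = solve-∀

2∣⇒even : ∀ i → + 2 ℤ.∣ i → parity ℤ.∣ i ∣ ≡ 0ℙ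
2∣⇒even i (divides q eq) = ≡.trans (≡.cong parity eq)
  (≡.trans (ℙ.*-homo-* q 2) (ℙ.*-zeroʳ (parity q)))

even⇒2∣ : ∀ i → parity ℤ.∣ i ∣ ≡ 0ℙ → + 2 ℤ.∣ i
even⇒2∣ i even = let k , eq = even⇒2* ℤ.∣ i ∣ even in divides k (≡.trans eq (ℕ.*-comm 2 k))

parity-±2 : ∀ i → parity ℤ.∣ i ℤ.- + 2 ∣ ≡ parity ℤ.∣ i ∣
parity-±2 i = ≡.trans (parity-∣+∣ i (ℤ.- + 2)) (ℙ.+-identityʳ _)

-2+2 : ∀ i → i ℤ.- + 2 ℤ.+ + 2 ≡ i
-2+2 = solve-∀

-- Specialisation at the powers of ζ, z and z⁻¹

module Points (K : HeytingField c ℓ₁ ℓ₂) (char0 : CharacteristicZero K)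
  (t : ℕ) (2≤t : 2 ℕ.≤ t) (ζ : HeytingField.Carrier K) (root : IsPrimitiveRoot K t ζ) where

  open FieldUnits K using (2-cancel; 1≉0; root-difference-unit)
  open Specialisation K char0 t 2≤t ζ
  module K = CommutativeRing coefficients
  open LaurentProperties coefficients
  open SemiringExp K.semiring using (_^_; ^-assocʳ; ^-congˡ; ^-homo-*)
  open PowerProperties coefficients
  open SemiringExp L.semiring using () renaming (_^_ to _^ᴸ_)
  open FractionProperties laurentRing
  open Determinant laurentRing using (detᶜ; detᶜ-map; vandermonde-regular)
  open SignAction laurentRing renaming (signed to signedᴸ)
  open SignActionProperties laurentRing
  open IntegerSolver laurentRing
  open import Relation.Binary.Reasoning.Setoid L.setoid

  t≥1 : NonZero t
  t≥1 = ℕ.>-nonZero (ℕ.<-≤-trans ℕ.z<s 2≤t)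

  y : Vector Laurent t
  y i = const (ζ ^ toℕ i)

  y^t≈1 : ∀ i → y i ^ᴸ t L.≈ L.1#
  y^t≈1 i = L.trans (const-^ (ζ ^ toℕ i) t) (const-cong (K.trans
    (^-assocʳ ζ (toℕ i) t) (K.trans (K.reflexive (≡.cong (ζ ^_) (ℕ.*-comm (toℕ i) t)))
      (K.trans (K.sym (^-assocʳ ζ t (toℕ i))) (K.trans (^-congˡ (toℕ i) (proj₁ root)) (1^n≈1 (toℕ i)))))))

  open Alternants t {{t≥1}} y y^t≈1 points
    (Vector.lookup-++ˡ y _) (Vector.lookup-++ʳ y _ zero) (Vector.lookup-++ʳ y _ (suc zero)) public

  D₀ : Laurent
  D₀ = detᶜ W (allFin t)

  -- `D₀` is the Vandermonde determinant of 1, ζ, ..., with the columns in increasing order of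
  -- exponents. Its node differences are invertible constants.
  D₀-regular : Regular D₀
  D₀-regular = regular-resp-≈
    (L.trans (L.reflexive (≡.cong (detᶜ λ i k → y i ^ᴸ k) (≡.sym (List.map-tabulate {n = t} id toℕ))))
             (detᶜ-map toℕ (λ i k → y i ^ᴸ k) (allFin t)))
    (vandermonde-regular y λ i j i<j → regular-resp-≈ (const-- (ζ ^ toℕ j) (ζ ^ toℕ i))
      (const-regular (proj₂ (root-difference-unit root i<j (Fin.toℕ<n j)))))

  T : Laurent
  T = binomial (+ t) L.* binomial (+ t) L.* binomial (+ 2)

  t≢0 : + t ≢ + 0
  t≢0 e = ℕ.≢-nonZero⁻¹ t {{t≥1}} (ℤ.+-injective e)

  binomial-t-regular : Regular (binomial (+ t))
  binomial-t-regular = binomial-regular (+ t) t≢0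

  binomial-2-regular : Regular (binomial (+ 2))
  binomial-2-regular = binomial-regular (+ 2) λ ()

  T-regular : Regular T
  T-regular = *-regular (*-regular binomial-t-regular binomial-t-regular) binomial-2-regular

  vandermonde≈ : vandermonde points L.≈ signedᴸ (-1^ (t C 2)) (D₀ L.* L.- T)
  vandermonde≈ = vandermonde-formula 2≤t

  points-regular : Regular (vandermonde points)
  points-regular = regular-resp-≈ (L.sym vandermonde≈)
    (regular-signed (-1^ (t C 2)) (*-regular D₀-regular (regular-signed Sign.- T-regular)))

  P : ℤ → ℤ → ℤ → Laurent
  P i j k = binomial i L.* binomial j L.* binomial k

  -- The common cleared form of the two formulas. In `sinhRatio` the factor 1/2 occurs three times
  -- above and three times below; in `χRatio` the denominator u² - u⁻² occurs three times above and
  -- twice below, and the surplus one is the last factor of `T`.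
  ratio : ℤ → ℤ → ℤ → Frac
  ratio i j k = P i j k / T ⟨ T-regular ⟩

  ratio≃sinhRatio : ∀ i j k → ratio i j k ≃ sinhRatio i j k
  ratio≃sinhRatio i j k = solve 3 (λ p c t → p :* (c :* t) := p :* c :* t) L.refl
    (P i j k) (two L.* two L.* two) T
    where
    two : Laurent
    two = const (K.1# K.+ K.1#)

  ratio≃χRatio : ∀ i j k → ratio i j k ≃ χRatio i j k
  ratio≃χRatio i j k = L.trans
    (solve 3 (λ p t b → p :* (b :* b :* b :* (t :* t)) := p :* (b :* b) :* (t :* t :* b)) L.refl
      (P i j k) (binomial (+ t ℤ.- + 2 ℤ.+ + 2)) (binomial (+ 2)))
    (L.*-cong (L.*-congʳ {binomial (+ 2) L.* binomial (+ 2)} (L.*-cong (L.*-cong (shift i) (shift j)) (shift k)))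
              (L.*-congʳ {binomial (+ 2)} (L.*-cong unshift unshift)))
    where
    shift : ∀ i → binomial i L.≈ binomial (i ℤ.- + 2 ℤ.+ + 2)
    shift i = B-≡ (≡.sym (-2+2 i))

    unshift : binomial (+ t ℤ.- + 2 ℤ.+ + 2) L.≈ binomial (+ t)
    unshift = B-≡ (-2+2 (+ t))

  •-ratio≃ : ∀ s i j k {a v r} → a L.* T L.≈ signedᴸ s (P i j k) L.* v → a / v ⟨ r ⟩ ≃ s • ratio i j k
  •-ratio≃ Sign.+ i j k e = e
  •-ratio≃ Sign.- i j k e = e

  flip-P : ∀ i j k → parity ℤ.∣ i ∣ ℙ.+ parity ℤ.∣ j ∣ ℙ.+ parity ℤ.∣ k ∣ ≡ 0ℙ → flip (P i j k) L.≈ P i j k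
  flip-P i j k even = begin
    flip (P i j k)
      ≈⟨ L.trans (flip-* (binomial i L.* binomial j) (binomial k))
           (L.*-congʳ {flip (binomial k)} (flip-* (binomial i) (binomial j))) ⟩
    flip (binomial i) L.* flip (binomial j) L.* flip (binomial k)
      ≈⟨ L.*-cong (L.*-cong (flip-binomial i ≡.refl) (flip-binomial j ≡.refl)) (flip-binomial k ≡.refl) ⟩
    signedᴸ (toSign p) (binomial i) L.* signedᴸ (toSign q) (binomial j) L.* signedᴸ (toSign r) (binomial k)
      ≈⟨ L.*-congʳ {signedᴸ (toSign r) (binomial k)} (signed-*-* (toSign p) (toSign q) (binomial i) (binomial j)) ⟨
    signedᴸ (toSign p Sign.* toSign q) (binomial i L.* binomial j) L.* signedᴸ (toSign r) (binomial k)
      ≈⟨ signed-*-* (toSign p Sign.* toSign q) (toSign r) (binomial i L.* binomial j) (binomial k) ⟨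
    signedᴸ (toSign p Sign.* toSign q Sign.* toSign r) (P i j k)
      ≈⟨ signed-≡ (P i j k) (≡.trans (≡.cong (Sign._* toSign r) (≡.sym (ℙ.+-homo-* p q)))
           (≡.trans (≡.sym (ℙ.+-homo-* (p ℙ.+ q) r)) (≡.cong toSign even))) ⟩
    P i j k ∎
    where
    p q r : Parity
    p = parity ℤ.∣ i ∣
    q = parity ℤ.∣ j ∣
    r = parity ℤ.∣ k ∣

  flip-T : flip T L.≈ T
  flip-T = flip-P (+ t) (+ t) (+ 2) (≡.trans (ℙ.+-identityʳ _) (ℙ.p+p≡0ℙ (parity t)))

  -- Otherwise the binomial annihilates the constant 2, and regularity together with characteristic
  -- zero gives 1 = 0.
  binomial≉-binomial : ∀ n → n ≢ + 0 → ¬ (binomial n L.≈ L.- binomial n)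
  binomial≉-binomial n n≢0 e = 1≉0 char0
    (2-cancel char0 K.1# (K.trans (K.sym (K.+-identityʳ _)) (2≈0 .coeff-≈ (+ 0))))
    where
    two : Laurent
    two = const (K.1# K.+ K.1#)

    2≈0 : two L.≈ L.0#
    2≈0 = binomial-regular n n≢0 .cancel two (begin
      binomial n L.* two
        ≈⟨ L.*-congˡ {binomial n} two≈ ⟩
      binomial n L.* (L.1# L.+ L.1#)
        ≈⟨ L.distribˡ (binomial n) L.1# L.1# ⟩
      binomial n L.* L.1# L.+ binomial n L.* L.1#
        ≈⟨ L.+-cong (L.*-identityʳ (binomial n)) (L.*-identityʳ (binomial n)) ⟩
      binomial n L.+ binomial n
        ≈⟨ L.+-congˡ {binomial n} e ⟩
      binomial n L.- binomial n
        ≈⟨ L.-‿inverseʳ (binomial n) ⟩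
      L.0# ∎)
      where
      two≈ : two L.≈ L.1# L.+ L.1#
      two≈ .coeff-≈ m with + 0 ℤ.≟ m
      ... | yes _ = K.+-assoc _ _ _
      ... | no _  = K.sym (K.+-identityˡ _)

-- Differences of congruent exponents and the sign ε

pos-∸ : ∀ {m n} → n ℕ.≤ m → + m ℤ.- + n ≡ + (m ℕ.∸ n)
pos-∸ {m} {n} n≤m = ≡.trans (ℤ.m-n≡m⊖n m n) (ℤ.⊖-≥ n≤m)

-- The multiplier is returned as a successor, since it cannot be 0 when n < m; this gives positivity
-- of d₁ and d₂ along with divisibility by t.
congruent-difference : ∀ t .{{_ : NonZero t}} {m n} → n ℕ.< m → m % t ≡ n % t →
                       ∃ λ k → + m ℤ.- + n ≡ + (t ℕ.* suc k)
congruent-difference t {m} {n} n<m m≡n = positive (m / t ℕ.∸ n / t) difference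
  where
  difference : m ℕ.∸ n ≡ t ℕ.* (m / t ℕ.∸ n / t)
  difference = begin
    m ℕ.∸ n
      ≡⟨ ≡.cong₂ ℕ._∸_ (m≡m%n+[m/n]*n m t) (m≡m%n+[m/n]*n n t) ⟩
    (m % t ℕ.+ m / t ℕ.* t) ℕ.∸ (n % t ℕ.+ n / t ℕ.* t)
      ≡⟨ ≡.cong (λ r → (r ℕ.+ m / t ℕ.* t) ℕ.∸ (n % t ℕ.+ n / t ℕ.* t)) m≡n ⟩
    (n % t ℕ.+ m / t ℕ.* t) ℕ.∸ (n % t ℕ.+ n / t ℕ.* t)
      ≡⟨ ℕ.[m+n]∸[m+o]≡n∸o (n % t) (m / t ℕ.* t) (n / t ℕ.* t) ⟩
    m / t ℕ.* t ℕ.∸ n / t ℕ.* t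
      ≡⟨ ℕ.*-distribʳ-∸ t (m / t) (n / t) ⟨
    (m / t ℕ.∸ n / t) ℕ.* t
      ≡⟨ ℕ.*-comm (m / t ℕ.∸ n / t) t ⟩
    t ℕ.* (m / t ℕ.∸ n / t) ∎
    where open ≡.≡-Reasoning

  positive : ∀ k → m ℕ.∸ n ≡ t ℕ.* k → ∃ λ k → + m ℤ.- + n ≡ + (t ℕ.* suc k)
  positive zero    e = contradiction (≡.trans e (ℕ.*-zeroʳ t)) (ℕ.m>n⇒m∸n≢0 n<m)
  positive (suc k) e = k , ≡.trans (pos-∸ (ℕ.<⇒≤ n<m)) (≡.cong (λ m → + m) e)

sign-pos : ∀ {m n} → n ℕ.< m → ℤ.sign (+ m ℤ.- + n) ≡ Sign.+
sign-pos n<m = ≡.cong ℤ.sign (pos-∸ (ℕ.<⇒≤ n<m))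

sign-neg : ∀ {m n} → m ℕ.< n → ℤ.sign (+ m ℤ.- + n) ≡ Sign.-
sign-neg {m} {n} m<n = ≡.trans (≡.cong ℤ.sign (ℤ.m-n≡m⊖n m n)) (ℤ.sign-⊖-< m<n)

module SignFormula (t : ℕ) (2≤t : 2 ℕ.≤ t) (lam : Vector ℕ (t ℕ.+ 2)) (partition : IsPartition lam)
  (cfg : Residues.Configuration t 2≤t lam) where

  open Residues t 2≤t lam
  open ResidueProperties t 2≤t lam
  open Separated (separated cfg)

  private
    x : Sign
    x = -1^ (toℕ (jA₁ cfg) ℕ.+ toℕ (jB₁ cfg))

  -- β decreases along the columns, so sgn(a₁ - b₁) tells which of the columns `jA₁` and `jB₁` comes
  -- first, which is exactly the case distinction in the inversion count.
  columns-sign : -1^ inversions (jA₁ cfg ∷ jB₁ cfg ∷ S cfg) ≡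
    Sign.opposite x Sign.* ℤ.sign (a₁ cfg ℤ.- b₁ cfg)
  columns-sign with Fin.<-cmp (jA₁ cfg) (jB₁ cfg)
  ... | tri< A₁<B₁ _ _ = ≡.trans (-1^-inversions-< (S-sorted cfg) (columns-↭ cfg) A₁<B₁)
    (≡.sym (≡.trans (≡.cong (Sign.opposite x Sign.*_) (sign-pos (β-decreasing partition A₁<B₁))) (Sign.*-identityʳ _)))
  ... | tri≈ _ A₁≡B₁ _ = contradiction A₁≡B₁ A₁≢B₁
  ... | tri> _ _ B₁<A₁ = ≡.trans (-1^-inversions-> (S-sorted cfg) (columns-↭ cfg) B₁<A₁)
    (≡.sym (≡.trans (≡.cong (Sign.opposite x Sign.*_) (sign-neg (β-decreasing partition B₁<A₁)))
      (opposite-*- x)))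
    where
    opposite-*- : ∀ s → Sign.opposite s Sign.* Sign.- ≡ s
    opposite-*- Sign.+ = ≡.refl
    opposite-*- Sign.- = ≡.refl

  -- The left side combines the sorting signs of the two alternants with sgn(d̃₃). The minus left
  -- over in `columns-sign` is the one in `-1^-triangular`, and the two units by which the columns
  -- are renumbered from 1 cancel.
  ε-formula : -1^ inversions (jA₁ cfg ∷ jB₁ cfg ∷ S cfg) Sign.* -1^ inversions (map residue (S cfg)) Sign.*
              ℤ.sign (d̃₃ cfg) Sign.* -1^ (t C 2) ≡ ε cfg
  ε-formula = begin
    -1^ inversions (jA₁ cfg ∷ jB₁ cfg ∷ S cfg) Sign.* v Sign.* τ Sign.* s
      ≡⟨ ≡.cong (λ u → u Sign.* v Sign.* τ Sign.* s) columns-sign ⟩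
    Sign.- Sign.* x Sign.* g Sign.* v Sign.* τ Sign.* s
      ≡⟨ solve 6 (λ n x g v τ s → ((((n ⊕ x) ⊕ g) ⊕ v) ⊕ τ) ⊕ s ⊜
                                 (((n ⊕ s) ⊕ (x ⊕ v)) ⊕ g) ⊕ τ) ≡.refl Sign.- x g v τ s ⟩
    Sign.- Sign.* s Sign.* (x Sign.* v) Sign.* g Sign.* τ
      ≡⟨ ≡.cong₂ (λ u w → u Sign.* w Sign.* g Sign.* τ) (-1^-triangular t) columns ⟨
    ε cfg ∎
    where
    open ≡.≡-Reasoning
    open CommutativeMonoidSolver Sign.*-commutativeMonoid using (solve; _⊕_; _⊜_)

    v g τ s : Sign
    v = -1^ inversions (map residue (S cfg))
    g = ℤ.sign (a₁ cfg ℤ.- b₁ cfg)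
    τ = ℤ.sign (d̃₃ cfg)
    s = -1^ (t C 2)

    columns : -1^ (suc (toℕ (jA₁ cfg)) ℕ.+ suc (toℕ (jB₁ cfg)) ℕ.+ inv cfg (map residue (S cfg))) ≡ x Sign.* v
    columns = ≡.trans
      (≡.cong₂ (λ m n → -1^ (suc m ℕ.+ n)) (ℕ.+-suc (toℕ (jA₁ cfg)) (toℕ (jB₁ cfg)))
        (inv≡inversions cfg (map residue (S cfg))))
      (-1^-+ (toℕ (jA₁ cfg) ℕ.+ toℕ (jB₁ cfg)) (inversions (map residue (S cfg))))

-- The product formula and the behaviour of its factors

module ProductFormula (K : HeytingField c ℓ₁ ℓ₂) (char0 : CharacteristicZero K)
  (t : ℕ) (2≤t : 2 ℕ.≤ t) (ζ : HeytingField.Carrier K) (root : IsPrimitiveRoot K t ζ) where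

  open Specialisation K char0 t 2≤t ζ
  open FieldUnits K using (2-cancel)
  open LaurentProperties coefficients
  open Points K char0 t 2≤t ζ root
  open IrreducibleModules K char0 using (irreducible; irreducible-irreducible)
  open FractionProperties laurentRing
  open SignAction laurentRing using () renaming (signed to signedᴸ)
  open SignActionProperties laurentRing
  open IntegerSolver laurentRing
  open ExponentialQuotient laurentRing mono mono-+ L.refl using (quotient)
  open Schur laurentRing using (alternant)
  open import Relation.Binary.Reasoning.Setoid L.setoid

  character* : ∀ k → square (character (irreducible k)) L.* binomial (+ 2) L.≈ binomial (+ 2 ℤ.* + suc k)
  character* = weights-character

  χ≃character : ∀ k → χ[ + (2 ℕ.* k) /2] ≃ ι (square (character (irreducible k)))
  χ≃character k = L.trans (L.*-identityʳ (binomial (+ (2 ℕ.* k) ℤ.+ + 2)))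
    (L.trans (B-≡ index) (L.sym (character* k)))
    where
    arith : ∀ k → + 2 ℤ.* k ℤ.+ + 2 ≡ + 2 ℤ.* (+ 1 ℤ.+ k)
    arith = solve-∀

    index : + (2 ℕ.* k) ℤ.+ + 2 ≡ + 2 ℤ.* + suc k
    index = ≡.trans (≡.cong (ℤ._+ + 2) (ℤ.pos-* 2 k)) (arith (+ k))

  χ-denominator : t ≡ 2 → χ[ + t ℤ.- + 2 /2] ≃ ι (mono (+ 0))
  χ-denominator t≡2 = L.trans (L.*-identityʳ (binomial (+ t ℤ.- + 2 ℤ.+ + 2)))
    (L.trans (B-≡ (≡.trans (-2+2 (+ t)) (≡.cong (λ m → + m) t≡2))) (L.sym (L.*-identityˡ (binomial (+ 2)))))

  flip-binomial-2 : flip (binomial (+ 2)) L.≈ binomial (+ 2)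
  flip-binomial-2 = flip-binomial (+ 2) ≡.refl

  module _ (n : ℕ) where

    private
      d m : ℤ
      d = + suc n
      m = d ℤ.- + 2 ℤ.+ + 2

      m≡d : m ≡ d
      m≡d = -2+2 d

      b : Laurent
      b = binomial m

      b≉-b : ¬ (b L.≈ L.- b)
      b≉-b = binomial≉-binomial m λ m≡0 → contradiction (≡.trans (≡.sym m≡d) m≡0) λ ()

      flip-b : ∀ {p} → parity ℤ.∣ d ℤ.- + 2 ∣ ≡ p → flip b L.≈ signedᴸ (toSign p) b
      flip-b e = flip-binomial m (≡.trans (≡.cong (λ i → parity ℤ.∣ i ∣) m≡d) (≡.trans (≡.sym (parity-±2 d)) e))

    -- Positivity of d matters: for d = 0 the numerator is 0 and reverses sign although the index -1
    -- is integral. For d > 0 the numerator differs from its negative, so its sign behaviour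
    -- determines the parity.
    reverses-sign⇔half-integral : ReversesSign χ[ d ℤ.- + 2 /2] ⇔ HalfIntegral (d ℤ.- + 2)
    reverses-sign⇔half-integral = mk⇔ to from
      where
      to : ReversesSign χ[ d ℤ.- + 2 /2] → HalfIntegral (d ℤ.- + 2)
      to reverses 2∣ = b≉-b (regular-cancel binomial-2-regular b (L.- b) (begin
        binomial (+ 2) L.* b           ≈⟨ L.*-comm (binomial (+ 2)) b ⟩
        b L.* binomial (+ 2)           ≈⟨ L.*-congʳ {binomial (+ 2)} (flip-b (2∣⇒even (d ℤ.- + 2) 2∣)) ⟨
        flip b L.* binomial (+ 2)      ≈⟨ reverses ⟩
        L.- b L.* flip (binomial (+ 2)) ≈⟨ L.*-congˡ {L.- b} flip-binomial-2 ⟩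
        L.- b L.* binomial (+ 2)       ≈⟨ L.*-comm (L.- b) (binomial (+ 2)) ⟩
        binomial (+ 2) L.* L.- b       ∎))

      from : HalfIntegral (d ℤ.- + 2) → ReversesSign χ[ d ℤ.- + 2 /2]
      from half with parity ℤ.∣ d ℤ.- + 2 ∣ in eq
      ... | 0ℙ = contradiction (even⇒2∣ (d ℤ.- + 2) eq) half
      ... | 1ℙ = L.*-cong (flip-b eq) (L.sym flip-binomial-2)

    -- A Laurent polynomial in z is fixed by u ↦ -u, which a half-integral index contradicts; for an
    -- integral index an irreducible character is the witness.
    laurent-in-z⇔integral : IsLaurentInZ χ[ d ℤ.- + 2 /2] ⇔ + 2 ℤ.∣ (d ℤ.- + 2)
    laurent-in-z⇔integral = mk⇔ to from
      where
      to : IsLaurentInZ χ[ d ℤ.- + 2 /2] → + 2 ℤ.∣ (d ℤ.- + 2)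
      to (p , e) with parity ℤ.∣ d ℤ.- + 2 ∣ in eq
      ... | 0ℙ = even⇒2∣ (d ℤ.- + 2) eq
      ... | 1ℙ = contradiction (begin
        b                                         ≈⟨ b≈ ⟩
        square p L.* binomial (+ 2)               ≈⟨ L.*-cong (flip-square p) flip-binomial-2 ⟨
        flip (square p) L.* flip (binomial (+ 2)) ≈⟨ flip-* (square p) (binomial (+ 2)) ⟨
        flip (square p L.* binomial (+ 2))        ≈⟨ flip-cong b≈ ⟨
        flip b                                    ≈⟨ flip-b eq ⟩
        L.- b                                     ∎) b≉-b
        where
        b≈ : b L.≈ square p L.* binomial (+ 2)
        b≈ = L.trans (L.sym (L.*-identityʳ b)) e

      from : + 2 ℤ.∣ (d ℤ.- + 2) → IsLaurentInZ χ[ d ℤ.- + 2 /2]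
      from 2∣ with even⇒2* (suc n) (≡.trans (≡.sym (parity-±2 d)) (2∣⇒even (d ℤ.- + 2) 2∣))
      -- Since d = 2(k+1) is positive, its half is a successor, and the index d/2 - 1 is k.
      ... | suc k , 1+n≡ = character (irreducible k) , L.trans (L.*-identityʳ b)
        (L.trans (B-≡ (≡.trans m≡d (≡.trans (≡.cong (λ i → + i) 1+n≡) (ℤ.pos-* 2 (suc k))))) (L.sym (character* k)))

  module PartitionFormula (lam : Vector ℕ (t ℕ.+ 2)) (partition : IsPartition lam)
    (cfg : Residues.Configuration t 2≤t lam) (d̃₃≢0 : Residues.d̃₃ t 2≤t lam cfg ≢ + 0) where

    open Residues t 2≤t lam
    open ResidueProperties t 2≤t lam
    open Separated (separated cfg)
    open SignFormula t 2≤t lam partition cfg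

    d₁-multiple : ∃ λ k → d₁ cfg ≡ + (t ℕ.* suc k)
    d₁-multiple = congruent-difference t (β-decreasing partition A₁<A₂) (residue-% residue-A)

    d₂-multiple : ∃ λ k → d₂ cfg ≡ + (t ℕ.* suc k)
    d₂-multiple = congruent-difference t (β-decreasing partition B₁<B₂) (residue-% residue-B)

    d₃-positive : ∃ λ n → d₃ cfg ≡ + suc n
    d₃-positive with ℤ.∣ d̃₃ cfg ∣ in eq
    ... | zero  = contradiction (ℤ.∣i∣≡0⇒i≡0 eq) d̃₃≢0
    ... | suc n = n , ≡.refl

    d-sum : d₁ cfg ℤ.+ d₂ cfg ℤ.+ d̃₃ cfg ≡ + 2 ℤ.* (a₁ cfg ℤ.- b₂ cfg)
    d-sum = arith (a₁ cfg) (a₂ cfg) (b₁ cfg) (b₂ cfg)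
      where
      arith : ∀ a₁ a₂ b₁ b₂ → (a₁ ℤ.- a₂) ℤ.+ (b₁ ℤ.- b₂) ℤ.+ (a₁ ℤ.+ a₂ ℤ.- b₁ ℤ.- b₂) ≡ + 2 ℤ.* (a₁ ℤ.- b₂)
      arith = solve-∀

    -- d₃ and d̃₃ have the same absolute value by definition, so the parity can be read off from
    -- `d-sum`.
    d-even : parity ℤ.∣ d₁ cfg ∣ ℙ.+ parity ℤ.∣ d₂ cfg ∣ ℙ.+ parity ℤ.∣ d₃ cfg ∣ ≡ 0ℙ
    d-even = ≡.trans (≡.cong (ℙ._+ parity ℤ.∣ d̃₃ cfg ∣) (≡.sym (parity-∣+∣ (d₁ cfg) (d₂ cfg))))
      (≡.trans (≡.sym (parity-∣+∣ (d₁ cfg ℤ.+ d₂ cfg) (d̃₃ cfg)))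
        (≡.trans (≡.cong (λ i → parity ℤ.∣ i ∣) d-sum) (parity-2* (a₁ cfg ℤ.- b₂ cfg))))

    2∣d-sum : + 2 ℤ.∣ (d₁ cfg ℤ.+ d₂ cfg ℤ.+ d₃ cfg)
    2∣d-sum = even⇒2∣ (d₁ cfg ℤ.+ d₂ cfg ℤ.+ d₃ cfg) (≡.trans (parity-∣+∣ (d₁ cfg ℤ.+ d₂ cfg) (d₃ cfg))
      (≡.trans (≡.cong (ℙ._+ parity ℤ.∣ d₃ cfg ∣) (parity-∣+∣ (d₁ cfg) (d₂ cfg))) d-even))

    ratio₃ : Frac
    ratio₃ = ratio (d₁ cfg) (d₂ cfg) (d₃ cfg)

    -- The cross-multiplied formula. Each alternant carries a minus from its 2 by 2 minor; moving
    -- the one of the numerator from `P₃` over to `T` reproduces the denominator, `D₀` included.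
    alternant-identity : alternant (β lam) points L.* T L.≈
      signedᴸ (ε cfg) (num ratio₃) L.* vandermonde points
    alternant-identity = begin
      alternant (β lam) points L.* T
        ≈⟨ L.*-congʳ {T} (alternant-formula (β lam) (jA₁ cfg) (jA₂ cfg) (jB₁ cfg) (jB₂ cfg) (S cfg)
             (columns-↭ cfg) (columns-unique cfg) (jA₂∈ cfg) (jB₂∈ cfg) (residue-% residue-A) (residue-% residue-B)
             (word-↭ cfg) (word-unique cfg)) ⟩
      signedᴸ σ (D₀ L.* L.- (binomial (d₁ cfg) L.* binomial (d₂ cfg) L.* binomial (d̃₃ cfg))) L.* T
        ≈⟨ L.*-congʳ {T} (signed-cong σ (L.*-congˡ {D₀} (L.-‿cong (L.trans
             (L.*-congˡ {binomial (d₁ cfg) L.* binomial (d₂ cfg)} (B-∣∣ (d̃₃ cfg)))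
             (signed-*ʳ τ (binomial (d₁ cfg) L.* binomial (d₂ cfg)) (binomial (d₃ cfg))))))) ⟩
      signedᴸ σ (D₀ L.* L.- signedᴸ τ P₃) L.* T
        ≈⟨ L.*-congʳ {T} (signed-cong σ (L.trans
             (solve 2 (λ d p → d :* (:- p) := p :* (:- d)) L.refl D₀ (signedᴸ τ P₃))
             (signed-*ˡ τ P₃ (L.- D₀)))) ⟩
      signedᴸ σ (signedᴸ τ (P₃ L.* L.- D₀)) L.* T
        ≈⟨ L.*-congʳ {T} (signed-* σ τ (P₃ L.* L.- D₀)) ⟨
      signedᴸ (σ Sign.* τ) (P₃ L.* L.- D₀) L.* T
        ≈⟨ signed-*ˡ (σ Sign.* τ) (P₃ L.* L.- D₀) T ⟩
      signedᴸ (σ Sign.* τ) (P₃ L.* L.- D₀ L.* T)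
        ≈⟨ signed-cong (σ Sign.* τ) (solve 3 (λ p d t → p :* (:- d) :* t := p :* (d :* (:- t))) L.refl P₃ D₀ T) ⟩
      signedᴸ (σ Sign.* τ) (P₃ L.* (D₀ L.* L.- T))
        ≈⟨ signed-≡ (P₃ L.* (D₀ L.* L.- T)) signs ⟩
      signedᴸ (ε cfg Sign.* v) (P₃ L.* (D₀ L.* L.- T))
        ≈⟨ signed-*-* (ε cfg) v P₃ (D₀ L.* L.- T) ⟩
      signedᴸ (ε cfg) P₃ L.* signedᴸ v (D₀ L.* L.- T)
        ≈⟨ L.*-congˡ {signedᴸ (ε cfg) P₃} vandermonde≈ ⟨
      signedᴸ (ε cfg) P₃ L.* vandermonde points ∎
      where
      P₃ : Laurent
      P₃ = num ratio₃

      σ τ v : Sign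
      σ = -1^ inversions (jA₁ cfg ∷ jB₁ cfg ∷ S cfg) Sign.* -1^ inversions (map residue (S cfg))
      τ = ℤ.sign (d̃₃ cfg)
      v = -1^ (t C 2)

      -- A sign squares to +, so the denominator's sign `v` can be moved to the other side of
      -- `ε-formula`.
      signs : σ Sign.* τ ≡ ε cfg Sign.* v
      signs = ≡.sym (≡.trans (≡.cong (Sign._* v) (≡.sym ε-formula))
        (≡.trans (Sign.*-assoc (σ Sign.* τ) v v)
          (≡.trans (≡.cong (σ Sign.* τ Sign.*_) (Sign.s*s≡+ v)) (Sign.*-identityʳ _))))

    schur≃ratio : schur lam points points-regular ≃ ε cfg • ratio₃
    schur≃ratio = •-ratio≃ (ε cfg) (d₁ cfg) (d₂ cfg) (d₃ cfg)
      {alternant (β lam) points} {vandermonde points} {points-regular} alternant-identity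

    schur≃ : ∀ x → ratio₃ ≃ x → schur lam points points-regular ≃ ε cfg • x
    schur≃ x ratio≃x = ≃-trans {schur lam points points-regular} {ε cfg • ratio₃} {ε cfg • x}
      schur≃ratio (•-cong (ε cfg) {ratio₃} {x} ratio≃x)

    flip-χRatio : flipᶠ (χRatio (d₁ cfg) (d₂ cfg) (d₃ cfg)) ≃ χRatio (d₁ cfg) (d₂ cfg) (d₃ cfg)
    flip-χRatio = L.*-cong flip-num (L.sym flip-den)
      where
      B₂ Bₜ : Laurent
      B₂ = binomial (+ 2)
      Bₜ = binomial (+ t ℤ.- + 2 ℤ.+ + 2)

      parity-shift : ∀ i → parity ℤ.∣ i ℤ.- + 2 ℤ.+ + 2 ∣ ≡ parity ℤ.∣ i ∣
      parity-shift i = ≡.cong (λ j → parity ℤ.∣ j ∣) (-2+2 i)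

      P′ : Laurent
      P′ = P (d₁ cfg ℤ.- + 2 ℤ.+ + 2) (d₂ cfg ℤ.- + 2 ℤ.+ + 2) (d₃ cfg ℤ.- + 2 ℤ.+ + 2)

      flip-B₂B₂ : flip (B₂ L.* B₂) L.≈ B₂ L.* B₂
      flip-B₂B₂ = L.trans (flip-* B₂ B₂) (L.*-cong flip-binomial-2 flip-binomial-2)

      flip-BₜBₜ : flip (Bₜ L.* Bₜ) L.≈ Bₜ L.* Bₜ
      flip-BₜBₜ = L.trans (flip-* Bₜ Bₜ) (L.trans
        (L.*-cong flip-Bₜ flip-Bₜ)
        (L.trans (L.sym (signed-*-* r r Bₜ Bₜ)) (signed-≡ (Bₜ L.* Bₜ) (Sign.s*s≡+ r))))
        where
        r : Sign
        r = toSign (parity ℤ.∣ + t ℤ.- + 2 ℤ.+ + 2 ∣)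

        flip-Bₜ : flip Bₜ L.≈ signedᴸ r Bₜ
        flip-Bₜ = flip-binomial (+ t ℤ.- + 2 ℤ.+ + 2) ≡.refl

      flip-num : flip (P′ L.* (B₂ L.* B₂)) L.≈ P′ L.* (B₂ L.* B₂)
      flip-num = L.trans (flip-* P′ (B₂ L.* B₂)) (L.*-cong
        (flip-P (d₁ cfg ℤ.- + 2 ℤ.+ + 2) (d₂ cfg ℤ.- + 2 ℤ.+ + 2) (d₃ cfg ℤ.- + 2 ℤ.+ + 2) (≡.trans
          (≡.cong₂ ℙ._+_ (≡.cong₂ ℙ._+_ (parity-shift (d₁ cfg)) (parity-shift (d₂ cfg))) (parity-shift (d₃ cfg))) d-even))
        flip-B₂B₂)

      flip-den : flip (B₂ L.* B₂ L.* B₂ L.* (Bₜ L.* Bₜ)) L.≈ B₂ L.* B₂ L.* B₂ L.* (Bₜ L.* Bₜ)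
      flip-den = L.trans (flip-* (B₂ L.* B₂ L.* B₂) (Bₜ L.* Bₜ)) (L.*-cong
        (L.trans (flip-* (B₂ L.* B₂) B₂) (L.*-cong flip-B₂B₂ flip-binomial-2)) flip-BₜBₜ)

    ratio-quotient : ∃ λ q → q L.* T L.≈ num ratio₃
    ratio-quotient =
      let k₁ , e₁ = d₁-multiple
          k₂ , e₂ = d₂-multiple
          q , qT≈ = quotient t (suc k₁) (suc k₂) ℤ.∣ d̃₃ cfg ∣
            (≡.subst₂ (λ i j → parity ℤ.∣ i ∣ ℙ.+ parity ℤ.∣ j ∣ ℙ.+ parity ℤ.∣ d₃ cfg ∣ ≡ 0ℙ) e₁ e₂ d-even)
      in q , L.trans qT≈ (L.*-congʳ {binomial (d₃ cfg)} (L.*-cong (B-≡ (≡.sym e₁)) (B-≡ (≡.sym e₂))))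

    laurent-in-z : ∀ x → ratio₃ ≃ x → ∃ λ p →
      schur lam points points-regular ≃ ι (square p) × ε cfg • x ≃ ι (square p)
    laurent-in-z x ratio≃x =
      let q , qT≈P = ratio-quotient
          p , eq≈p = flip-invariant⇒square (2-cancel char0) (signedᴸ (ε cfg) q)
            (flip-signed (ε cfg) q (flip-q q qT≈P))
          ratio≃p = laurent q p qT≈P eq≈p
      in p , ≃-trans {schur lam points points-regular} {ε cfg • ratio₃} {ι (square p)} schur≃ratio ratio≃p ,
         ≃-trans {ε cfg • x} {ε cfg • ratio₃} {ι (square p)}
           (•-cong (ε cfg) {x} {ratio₃} (≃-sym {ratio₃} {x} ratio≃x)) ratio≃p
      where
      -- Numerator and denominator are both fixed by u ↦ -u; cancelling the regular `T` transfers
      -- this to the quotient.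
      flip-q : ∀ q → q L.* T L.≈ num ratio₃ → flip q L.≈ q
      flip-q q qT≈P = regular-cancel T-regular (flip q) q (begin
        T L.* flip q        ≈⟨ L.*-comm T (flip q) ⟩
        flip q L.* T        ≈⟨ L.*-congˡ {flip q} flip-T ⟨
        flip q L.* flip T   ≈⟨ flip-* q T ⟨
        flip (q L.* T)      ≈⟨ flip-cong qT≈P ⟩
        flip (num ratio₃)   ≈⟨ flip-P (d₁ cfg) (d₂ cfg) (d₃ cfg) d-even ⟩
        num ratio₃          ≈⟨ qT≈P ⟨
        q L.* T             ≈⟨ L.*-comm q T ⟩
        T L.* q             ∎)

      flip-signed : ∀ s q → flip q L.≈ q → flip (signedᴸ s q) L.≈ signedᴸ s q
      flip-signed Sign.+ q flip≈ = flip≈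
      flip-signed Sign.- q flip≈ = L.trans (flip-neg q) (L.-‿cong flip≈)

      laurent : ∀ q p → q L.* T L.≈ num ratio₃ → signedᴸ (ε cfg) q L.≈ square p →
                ε cfg • ratio₃ ≃ ι (square p)
      laurent q p qT≈P eq≈p = ≃-sym {ι (square p)} {ε cfg • ratio₃}
        (•-ratio≃ (ε cfg) (d₁ cfg) (d₂ cfg) (d₃ cfg) {square p} {L.1#} {1-regular} (begin
        square p L.* T                        ≈⟨ L.*-congʳ {T} eq≈p ⟨
        signedᴸ (ε cfg) q L.* T               ≈⟨ signed-*ˡ (ε cfg) q T ⟩
        signedᴸ (ε cfg) (q L.* T)             ≈⟨ signed-cong (ε cfg) qT≈P ⟩
        signedᴸ (ε cfg) (num ratio₃)          ≈⟨ L.*-identityʳ (signedᴸ (ε cfg) (num ratio₃)) ⟨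
        signedᴸ (ε cfg) (num ratio₃) L.* L.1# ∎))

    -- For t = 2 the denominator `T` is the cube of u² - u⁻², one copy for each of the three
    -- numerator factors, and each factor divided by its copy is a character.
    ratio≃characters : t ≡ 2 → ∀ k₁ k₂ k₃ →
      d₁ cfg ≡ + 2 ℤ.* + suc k₁ → d₂ cfg ≡ + 2 ℤ.* + suc k₂ → d₃ cfg ≡ + 2 ℤ.* + suc k₃ →
      let χ : ℕ → Frac
          χ k = ι (square (character (irreducible k)))
      in ratio₃ ≃ χ k₁ · χ k₂ · χ k₃
    ratio≃characters t≡2 k₁ k₂ k₃ e₁ e₂ e₃ = begin
      num ratio₃ L.* (L.1# L.* L.1# L.* L.1#)
        ≈⟨ L.*-congˡ {num ratio₃} (L.trans (L.*-identityʳ (L.1# L.* L.1#)) (L.*-identityʳ L.1#)) ⟩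
      num ratio₃ L.* L.1#
        ≈⟨ L.*-identityʳ (num ratio₃) ⟩
      num ratio₃
        ≈⟨ L.*-cong (L.*-cong (factor k₁ e₁) (factor k₂ e₂)) (factor k₃ e₃) ⟩
      X k₁ L.* B₂ L.* (X k₂ L.* B₂) L.* (X k₃ L.* B₂)
        ≈⟨ solve 4 (λ x y z b → x :* b :* (y :* b) :* (z :* b) := x :* y :* z :* (b :* b :* b)) L.refl
             (X k₁) (X k₂) (X k₃) B₂ ⟩
      X k₁ L.* X k₂ L.* X k₃ L.* (B₂ L.* B₂ L.* B₂)
        ≈⟨ L.*-congˡ {X k₁ L.* X k₂ L.* X k₃} (L.*-congʳ {B₂} (L.*-cong Bₜ≈ Bₜ≈)) ⟨
      X k₁ L.* X k₂ L.* X k₃ L.* T ∎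
      where
      B₂ : Laurent
      B₂ = binomial (+ 2)

      X : ℕ → Laurent
      X k = square (character (irreducible k))

      factor : ∀ k {d} → d ≡ + 2 ℤ.* + suc k → binomial d L.≈ X k L.* B₂
      factor k d≡ = L.trans (B-≡ d≡) (L.sym (character* k))

      Bₜ≈ : binomial (+ t) L.≈ B₂
      Bₜ≈ = B-≡ (≡.cong (λ m → + m) t≡2)

    d-halves : t ≡ 2 → ∃ λ k₁ → ∃ λ k₂ → ∃ λ k₃ →
      d₁ cfg ≡ + 2 ℤ.* + suc k₁ × d₂ cfg ≡ + 2 ℤ.* + suc k₂ × d₃ cfg ≡ + 2 ℤ.* + suc k₃
    d-halves t≡2 =
      let k₁ , e₁ = d₁-multiple
          k₂ , e₂ = d₂-multiple
          n , e₃ = d₃-positive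
          k₃ , e₃′ = half n (≡.trans (≡.cong (λ i → parity ℤ.∣ i ∣) (≡.sym e₃))
            (third-even (even e₁) (even e₂) d-even))
      in k₁ , k₂ , k₃ , twice e₁ , twice e₂ , ≡.trans e₃ e₃′
      where
      twice : ∀ {d k} → d ≡ + (t ℕ.* suc k) → d ≡ + 2 ℤ.* + suc k
      twice {k = k} e = ≡.trans e (≡.trans (≡.cong (λ m → + (m ℕ.* suc k)) t≡2) (ℤ.pos-* 2 (suc k)))

      even : ∀ {d k} → d ≡ + (t ℕ.* suc k) → parity ℤ.∣ d ∣ ≡ 0ℙ
      even {k = k} e = ≡.trans (≡.cong (λ i → parity ℤ.∣ i ∣) (twice e)) (parity-2* (+ suc k))

      third-even : ∀ {p q r} → p ≡ 0ℙ → q ≡ 0ℙ → p ℙ.+ q ℙ.+ r ≡ 0ℙ → r ≡ 0ℙ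
      third-even ≡.refl ≡.refl e = e

      half : ∀ n → parity (suc n) ≡ 0ℙ → ∃ λ k → + suc n ≡ + 2 ℤ.* + suc k
      half n e with even⇒2* (suc n) e
      ... | suc k , 1+n≡ = k , ≡.trans (≡.cong (λ m → + m) 1+n≡) (ℤ.pos-* 2 (suc k))

    character-product : t ≡ 2 → ∃ λ k₁ → ∃ λ k₂ → ∃ λ k₃ →
      d₁ cfg ≡ + 2 ℤ.* + suc k₁ × d₂ cfg ≡ + 2 ℤ.* + suc k₂ × d₃ cfg ≡ + 2 ℤ.* + suc k₃ ×
      ∃ λ V₁ → ∃ λ V₂ → ∃ λ V₃ →
        Irreducible {suc k₁} V₁ × Irreducible {suc k₂} V₂ × Irreducible {suc k₃} V₃ ×
        schur lam points points-regular ≃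
          ε cfg • (ι (square (character V₁)) · ι (square (character V₂)) · ι (square (character V₃)))
    character-product t≡2 = let k₁ , k₂ , k₃ , e₁ , e₂ , e₃ = d-halves t≡2 in
      k₁ , k₂ , k₃ , e₁ , e₂ , e₃ , irreducible k₁ , irreducible k₂ , irreducible k₃ ,
      irreducible-irreducible k₁ , irreducible-irreducible k₂ , irreducible-irreducible k₃ ,
      schur≃ (χ k₁ · χ k₂ · χ k₃) (ratio≃characters t≡2 k₁ k₂ k₃ e₁ e₂ e₃)
      where
      χ : ℕ → Frac
      χ k = ι (square (character (irreducible k)))

-- The formula in terms of sl₂ characters

open import Data.Integer.Base using (_+_; _-_; _*_)
open import Data.Integer.Divisibility using (_∣_)

corollary3p3 :
  ∀ {c ℓ₁ ℓ₂} (K : HeytingField c ℓ₁ ℓ₂) (char0 : CharacteristicZero K)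
  (t : ℕ) (2≤t : 2 ℕ.≤ t)
  (ζ : HeytingField.Carrier K) → IsPrimitiveRoot K t ζ →
  (lam : Vector ℕ (t ℕ.+ 2)) → IsPartition lam →
  let open Residues t 2≤t lam
      open Specialisation K char0 t 2≤t ζ
  in
  (∀ i → ∃ λ j → residue j ≡ i) →
  -- the quotient of alternants is defined
  Σ (Regular (vandermonde points)) λ reg →
  -- χₖ is the character of an irreducible module of dimension k + 1
  (∀ (k : ℕ) → Σ (Sl₂Module (suc k)) λ V →
     Irreducible V × χ[ + (2 ℕ.* k) /2] ≃ ι (square (character V)))
  ×
  -- there are two classes of size 2, or one of size 3
  Configuration
  ×
  (∀ (cfg : Configuration) → d̃₃ cfg ≢ + 0 →
    let s  = schur lam points reg
        D₁ = d₁ cfg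
        D₂ = d₂ cfg
        D₃ = d₃ cfg
        Q  = χRatio D₁ D₂ D₃
    in
    -- the product formula, and its form in terms of the χ
    s ≃ ε cfg • sinhRatio D₁ D₂ D₃
    ×
    s ≃ ε cfg • Q
    ×
    -- t = 2: a signed product of three characters
    (t ≡ 2 →
      χ[ + t - + 2 /2] ≃ ι (mono (+ 0))
      ×
      ∃ λ (k₁ : ℕ) → ∃ λ (k₂ : ℕ) → ∃ λ (k₃ : ℕ) →
        D₁ ≡ + 2 * + suc k₁ × D₂ ≡ + 2 * + suc k₂ × D₃ ≡ + 2 * + suc k₃
        ×
        Σ (Sl₂Module (suc k₁)) λ V₁ → Σ (Sl₂Module (suc k₂)) λ V₂ →
        Σ (Sl₂Module (suc k₃)) λ V₃ →
          Irreducible V₁ × Irreducible V₂ × Irreducible V₃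
          ×
          s ≃ ε cfg • (ι (square (character V₁)) · ι (square (character V₂))
                                                 · ι (square (character V₃))))
    ×
    -- t odd: the index t/2 - 1 is a half-integer
    (¬ (+ 2 ∣ + t) →
      HalfIntegral (+ t - + 2) × ¬ IsLaurentInZ χ[ + t - + 2 /2])
    ×
    -- behaviour of the individual factors
    All (λ d → (ReversesSign χ[ d - + 2 /2] ⇔ HalfIntegral (d - + 2))
             × (IsLaurentInZ χ[ d - + 2 /2] ⇔ + 2 ∣ (d - + 2)))
        (D₁ ∷ D₂ ∷ D₃ ∷ + t ∷ [])
    ×
    -- parity
    D₁ + D₂ + d̃₃ cfg ≡ + 2 * (a₁ cfg - b₂ cfg)
    ×
    + 2 ∣ (D₁ + D₂ + D₃)
    ×
    -- the ratio is a Laurent polynomial in z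
    flipᶠ Q ≃ Q
    ×
    (∃ λ p → s ≃ ι (square p) × ε cfg • Q ≃ ι (square p)))
corollary3p3 K char0 t 2≤t ζ root lam partition surjective =
  points-regular ,
  (λ k → irreducible k , irreducible-irreducible k , χ≃character k) ,
  configuration surjective ,
  λ cfg d̃₃≢0 →
    schur≃ cfg d̃₃≢0 _ (ratio≃sinhRatio (d₁ cfg) (d₂ cfg) (d₃ cfg)) ,
    schur≃ cfg d̃₃≢0 _ (ratio≃χRatio (d₁ cfg) (d₂ cfg) (d₃ cfg)) ,
    (λ t≡2 → χ-denominator t≡2 , character-product cfg d̃₃≢0 t≡2) ,
    (λ 2∤t → half-integral 2∤t ,
      λ laurent → half-integral 2∤t (Equivalence.to (proj₂ (factor t-positive)) laurent)) ,
    (factor (positive (d₁-multiple cfg d̃₃≢0)) ∷ factor (positive (d₂-multiple cfg d̃₃≢0)) ∷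
     factor (d₃-positive cfg d̃₃≢0) ∷ factor t-positive ∷ []) ,
    d-sum cfg d̃₃≢0 ,
    2∣d-sum cfg d̃₃≢0 ,
    flip-χRatio cfg d̃₃≢0 ,
    laurent-in-z cfg d̃₃≢0 _ (ratio≃χRatio (d₁ cfg) (d₂ cfg) (d₃ cfg))
  where
  open Residues t 2≤t lam
  open Specialisation K char0 t 2≤t ζ
  open ResidueProperties t 2≤t lam using (configuration)
  open Points K char0 t 2≤t ζ root using (points-regular; ratio≃sinhRatio; ratio≃χRatio)
  open IrreducibleModules K char0 using (irreducible; irreducible-irreducible)
  open ProductFormula K char0 t 2≤t ζ root
  open PartitionFormula lam partition

  half-integral : ¬ (+ 2 ∣ + t) → HalfIntegral (+ t - + 2)
  half-integral 2∤t 2∣t-2 = 2∤t (even⇒2∣ (+ t)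
    (≡.trans (≡.sym (parity-±2 (+ t))) (2∣⇒even (+ t - + 2) 2∣t-2)))

  t-positive : ∃ λ n → + t ≡ + suc n
  t-positive = ℕ.pred t , ≡.cong +_ (≡.sym (ℕ.suc-pred t))

  positive : ∀ {d} → (∃ λ k → d ≡ + (t ℕ.* suc k)) → ∃ λ n → d ≡ + suc n
  positive (k , e) = let n , t≡ = t-positive in
    k ℕ.+ n ℕ.* suc k , ≡.trans e (≡.cong (λ m → + (m ℕ.* suc k)) (ℤ.+-injective t≡))

  factor : ∀ {d} → (∃ λ n → d ≡ + suc n) →
    (ReversesSign χ[ d - + 2 /2] ⇔ HalfIntegral (d - + 2)) × (IsLaurentInZ χ[ d - + 2 /2] ⇔ + 2 ∣ (d - + 2))
  factor (n , ≡.refl) = reverses-sign⇔half-integral n , laurent-in-z⇔integral n
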